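{- Fix an integer $z\ge1$. For $k\ge1$ let $P_z(k)$ be the proportion of integers $n\in[0,k^2+k)$ for which $N(n,k)=z$. Then $P_z(k)\to \frac{3}{\pi^2}\left(\frac{1}{z^2}+\frac{1}{(z+1)^2}\right)$ as $k\to\infty$.
   Context: For $n>k\ge1$, $N(n,k)$ is the nullity of the $n\times n$ skew-symmetric Toeplitz matrix $A(n,k)$ whose first $k$ superdiagonals have all entries $1$ and whose remaining superdiagonals have all entries $0$. This nullity depends only on $n\bmod (k^2+k)$, and $N(n,k)$ is defined for every integer $n$ as $N(n',k)$ for any $n'>k$ with $n'\equiv n\pmod{k^2+k}$. -}

module Defs where

open import Algebra.Bundles using (CommutativeRing)
open import Data.Bool using (if_then_else_)
open import Data.Fin using (Fin; zero; suc; toℕ; punchIn)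
open import Data.Fin.Properties using (any?)
open import Data.Integer as ℤ using (ℤ; +_; -[1+_]; +[1+_]; +0; _⊖_)
open import Data.Integer.DivMod using (_%ℕ_)
open import Data.List using (filter; length; upTo)
open import Data.Nat as ℕ using (ℕ; zero; suc)
import Data.Nat.Properties as ℕₚ
open import Data.Product using (∃; ∃₂; _×_; _,_; proj₁; proj₂)
open import Data.Rational
  using (ℚ; mkℚ; 0ℚ; 1ℚ; ½; _+_; _*_; _-_; -_; 1/_; ∣_∣; _/_; _<_; _≤_; toℚᵘ
        ; NonZero; ≢-nonZero; positive; nonNegative)
open import Data.Rational.Properties
open import Data.Rational.Solver using (module +-*-Solver)
import Data.Rational.Unnormalised as ℚᵘ
import Data.Rational.Unnormalised.Properties as ℚᵘₚ
open import Data.Sum using (inj₁; inj₂)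
open import Data.Vec.Functional using (Vector; insertAt; removeAt)
open import Data.Vec.Functional.Properties using (insertAt-lookup; insertAt-punchIn)
open import Function using (_∘_)
open import Relation.Binary.PropositionalEquality
  using (_≡_; _≢_; refl; sym; trans; cong; cong₂; subst; subst₂; module ≡-Reasoning)
open import Relation.Nullary using (yes; no; ¬?; ⌊_⌋)
open import Relation.Nullary.Decidable using (decidable-stable)

open import Algebra.Properties.Semiring.Sum (CommutativeRing.semiring +-*-commutativeRing)
  using (sum; sum-cong-≋; sum-remove; sum-replicate-zero; ∑-distrib-+; ∑-comm; *-distribˡ-sum)
open +-*-Solver using (solve; _:=_; _:+_; _:*_; :-_; _:-_)

Matrix : ℕ → ℕ → Set
Matrix m n = Fin m → Vector ℚ n

infix 8 _∙_

_∙_ : ∀ {n} → Vector ℚ n → Vector ℚ n → ℚ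
u ∙ v = sum (λ j → u j * v j)

-- The entries of all matrices below are rational, so the nullity over ℚ is that over ℝ or ℂ.
Kernel : ∀ {m n} → Matrix m n → Vector ℚ n → Set
Kernel A x = ∀ i → A i ∙ x ≡ 0ℚ

linComb : ∀ {d n} → Vector ℚ d → Vector (Vector ℚ n) d → Vector ℚ n
linComb c b j = sum (λ i → c i * b i j)

record IsBasis {d n} (S : Vector ℚ n → Set) (b : Vector (Vector ℚ n) d) : Set where
  field
    members     : ∀ i → S (b i)
    independent : ∀ c → (∀ j → linComb c b j ≡ 0ℚ) → ∀ i → c i ≡ 0ℚ
    spanning    : ∀ x → S x → ∃ λ c → ∀ j → x j ≡ linComb c b j

unit : ∀ {n} → Matrix n n
unit zero    zero    = 1ℚ
unit zero    (suc _) = 0ℚ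
unit (suc _) zero    = 0ℚ
unit (suc i) (suc j) = unit i j

sum-zero : ∀ {n} (f : Vector ℚ n) → (∀ i → f i ≡ 0ℚ) → sum f ≡ 0ℚ
sum-zero {n} f f≡0 = trans (sum-cong-≋ f≡0) (sum-replicate-zero n)

linComb-unit : ∀ {n} (c : Vector ℚ n) j → linComb c unit j ≡ c j
linComb-unit c zero = trans
  (cong₂ _+_ (*-identityʳ (c zero)) (sum-zero _ (λ i → *-zeroʳ (c (suc i)))))
  (+-identityʳ (c zero))
linComb-unit c (suc j) = trans
  (cong₂ _+_ (*-zeroʳ (c zero)) (linComb-unit (c ∘ suc) j))
  (+-identityˡ (c (suc j)))

∙-linComb : ∀ {d n} (a : Vector ℚ n) (c : Vector ℚ d) b →
            a ∙ linComb c b ≡ sum (λ i → c i * (a ∙ b i))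
∙-linComb a c b = begin
  sum (λ j → a j * sum (λ i → c i * b i j))
    ≡⟨ sum-cong-≋ (λ j → *-distribˡ-sum (a j) (λ i → c i * b i j)) ⟩
  sum (λ j → sum (λ i → a j * (c i * b i j)))
    ≡⟨ ∑-comm (λ j i → a j * (c i * b i j)) ⟩
  sum (λ i → sum (λ j → a j * (c i * b i j)))
    ≡⟨ sum-cong-≋ (λ i → sum-cong-≋ (λ j →
         solve 3 (λ x y z → x :* (y :* z) := y :* (x :* z)) refl (a j) (c i) (b i j))) ⟩
  sum (λ i → sum (λ j → c i * (a j * b i j)))
    ≡⟨ sum-cong-≋ (λ i → sym (*-distribˡ-sum (c i) (λ j → a j * b i j))) ⟩
  sum (λ i → c i * (a ∙ b i)) ∎
  where open ≡-Reasoning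

∙-eliminate : ∀ {n} (a u v : Vector ℚ n) t →
              a ∙ (λ j → u j - t * v j) ≡ a ∙ u - t * (a ∙ v)
∙-eliminate a u v t = begin
  sum (λ j → a j * (u j - t * v j))
    ≡⟨ sum-cong-≋ (λ j → solve 4 (λ a u v t →
         a :* (u :- t :* v) := a :* u :+ (:- t) :* (a :* v)) refl (a j) (u j) (v j) t) ⟩
  sum (λ j → a j * u j + (- t) * (a j * v j))
    ≡⟨ ∑-distrib-+ (λ j → a j * u j) (λ j → (- t) * (a j * v j)) ⟩
  a ∙ u + sum (λ j → (- t) * (a j * v j))
    ≡⟨ cong (λ s → a ∙ u + s) (sym (*-distribˡ-sum (- t) (λ j → a j * v j))) ⟩
  a ∙ u + (- t) * (a ∙ v)
    ≡⟨ cong (λ s → a ∙ u + s) (sym (neg-distribˡ-* t (a ∙ v))) ⟩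
  a ∙ u - t * (a ∙ v) ∎
  where open ≡-Reasoning

module Eliminate {d n} (b : Vector (Vector ℚ n) (suc d)) (p : Fin (suc d))
                 (t : Vector ℚ d) where

  eliminate : Vector (Vector ℚ n) d
  eliminate i j = b (punchIn p i) j - t i * b p j

  linComb-eliminate : ∀ C j → linComb C b j ≡
    linComb (removeAt C p) eliminate j + (C p + removeAt C p ∙ t) * b p j
  linComb-eliminate C j = begin
    linComb C b j
      ≡⟨ sum-remove (λ i → C i * b i j) ⟩
    C p * β + sum (λ i → c i * b (punchIn p i) j)
      ≡⟨ cong (λ s → C p * β + s) (sum-cong-≋ (λ i → solve 4 (λ c b t β →
           c :* b := c :* (b :- t :* β) :+ β :* (c :* t)) refl
           (c i) (b (punchIn p i) j) (t i) β)) ⟩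
    C p * β + sum (λ i → c i * eliminate i j + β * (c i * t i))
      ≡⟨ cong (λ s → C p * β + s) (∑-distrib-+ (λ i → c i * eliminate i j) _) ⟩
    C p * β + (linComb c eliminate j + sum (λ i → β * (c i * t i)))
      ≡⟨ cong (λ s → C p * β + (linComb c eliminate j + s))
           (sym (*-distribˡ-sum β (λ i → c i * t i))) ⟩
    C p * β + (linComb c eliminate j + β * (c ∙ t))
      ≡⟨ solve 4 (λ C β l s → C :* β :+ (l :+ β :* s) := l :+ (C :+ s) :* β) refl
           (C p) β (linComb c eliminate j) (c ∙ t) ⟩
    linComb c eliminate j + (C p + c ∙ t) * β ∎
    where open ≡-Reasoning
          c = removeAt C p
          β = b p j

-- Gaussian elimination, one row of A at a time.
kernelBasis : ∀ {m n} (A : Matrix m n) →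
              ∃ λ d → ∃ λ (b : Vector (Vector ℚ n) d) → IsBasis (Kernel A) b
kernelBasis {zero} {n} A = n , unit , record
  { members     = λ _ ()
  ; independent = λ c c≡0 i → trans (sym (linComb-unit c i)) (c≡0 i)
  ; spanning    = λ x _ → x , λ j → sym (linComb-unit x j)
  }
kernelBasis {suc m} {n} A with kernelBasis (A ∘ suc)
... | d , b , isBasis with any? (λ i → ¬? (A zero ∙ b i ≟ 0ℚ))
... | no all-zero = d , b , record
  { members     = λ { i zero    → decidable-stable (_ ≟ 0ℚ) (λ ≢0 → all-zero (i , ≢0))
                    ; i (suc r) → IsBasis.members isBasis i r }
  ; independent = IsBasis.independent isBasis
  ; spanning    = λ x x∈ → IsBasis.spanning isBasis x (x∈ ∘ suc)
  }
kernelBasis {suc m} {n} A | suc d , b , isBasis | yes (p , f≢0) = d , eliminate , record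
  { members     = members′
  ; independent = independent′
  ; spanning    = spanning′
  }
  where
  open ≡-Reasoning
  open IsBasis isBasis
  f : Vector ℚ (suc d)
  f i = A zero ∙ b i
  instance fp-nonZero = ≢-nonZero f≢0
  r = 1/ f p
  t : Vector ℚ d
  t i = f (punchIn p i) * r
  open Eliminate b p t

  r*fp : r * f p ≡ 1ℚ
  r*fp = *-inverseˡ (f p)

  members′ : ∀ i → Kernel A (eliminate i)
  members′ i zero = begin
    A zero ∙ eliminate i         ≡⟨ ∙-eliminate (A zero) (b (punchIn p i)) (b p) (t i) ⟩
    φ - φ * r * f p              ≡⟨ cong (λ s → φ - s) (*-assoc φ r (f p)) ⟩
    φ - φ * (r * f p)            ≡⟨ cong (λ s → φ - φ * s) r*fp ⟩
    φ - φ * 1ℚ                   ≡⟨ cong (λ s → φ - s) (*-identityʳ φ) ⟩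
    φ - φ                        ≡⟨ +-inverseʳ φ ⟩
    0ℚ ∎
    where φ = f (punchIn p i)
  members′ i (suc k) = begin
    A (suc k) ∙ eliminate i      ≡⟨ ∙-eliminate (A (suc k)) (b (punchIn p i)) (b p) (t i) ⟩
    A (suc k) ∙ b (punchIn p i) - t i * (A (suc k) ∙ b p)
      ≡⟨ cong₂ (λ u v → u - t i * v) (members (punchIn p i) k) (members p k) ⟩
    0ℚ - t i * 0ℚ                ≡⟨ cong (λ s → 0ℚ - s) (*-zeroʳ (t i)) ⟩
    0ℚ - 0ℚ                      ≡⟨⟩
    0ℚ ∎

  independent′ : ∀ c → (∀ j → linComb c eliminate j ≡ 0ℚ) → ∀ i → c i ≡ 0ℚ
  independent′ c c≡0 i = trans (sym (C-rest i)) (independent C C≡0 (punchIn p i))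
    where
    C = insertAt c p (- (c ∙ t))
    C-rest : ∀ i → C (punchIn p i) ≡ c i
    C-rest = insertAt-punchIn c p _
    C≡0 : ∀ j → linComb C b j ≡ 0ℚ
    C≡0 j = begin
      linComb C b j
        ≡⟨ linComb-eliminate C j ⟩
      linComb (removeAt C p) eliminate j + (C p + removeAt C p ∙ t) * b p j
        ≡⟨ cong₂ (λ u v → u + v * b p j)
             (trans (sum-cong-≋ (λ i → cong (_* eliminate i j) (C-rest i))) (c≡0 j))
             (cong₂ _+_ (insertAt-lookup c p _) (sum-cong-≋ (λ i → cong (_* t i) (C-rest i)))) ⟩
      0ℚ + (- (c ∙ t) + c ∙ t) * b p j
        ≡⟨ cong (λ s → 0ℚ + s * b p j) (+-inverseˡ (c ∙ t)) ⟩
      0ℚ + 0ℚ * b p j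
        ≡⟨ trans (+-identityˡ (0ℚ * b p j)) (*-zeroˡ (b p j)) ⟩
      0ℚ ∎

  spanning′ : ∀ x → Kernel A x → ∃ λ c → ∀ j → x j ≡ linComb c eliminate j
  spanning′ x x∈ with spanning x (x∈ ∘ suc)
  ... | C , x≡ = removeAt C p , λ j → begin
    x j
      ≡⟨ trans (x≡ j) (linComb-eliminate C j) ⟩
    linComb c eliminate j + (C p + c ∙ t) * b p j
      ≡⟨ cong (λ s → linComb c eliminate j + s * b p j) vanishes ⟩
    linComb c eliminate j + 0ℚ * b p j
      ≡⟨ cong (λ s → linComb c eliminate j + s) (*-zeroˡ (b p j)) ⟩
    linComb c eliminate j + 0ℚ
      ≡⟨ +-identityʳ _ ⟩
    linComb c eliminate j ∎
    where
    c = removeAt C p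
    vanishes : C p + c ∙ t ≡ 0ℚ
    vanishes = begin
      C p + c ∙ t
        ≡⟨ cong₂ _+_ (trans (sym (*-identityʳ (C p))) (cong (C p *_) (sym (*-inverseʳ (f p)))))
             (sum-cong-≋ (λ i → solve 3 (λ c φ r → c :* (φ :* r) := r :* (c :* φ)) refl
               (c i) (f (punchIn p i)) r)) ⟩
      C p * (f p * r) + sum (λ i → r * (c i * f (punchIn p i)))
        ≡⟨ cong₂ _+_
             (solve 3 (λ C φ r → C :* (φ :* r) := r :* (C :* φ)) refl (C p) (f p) r)
             (sym (*-distribˡ-sum r (λ i → c i * f (punchIn p i)))) ⟩
      r * (C p * f p) + r * sum (λ i → c i * f (punchIn p i))
        ≡⟨ sym (*-distribˡ-+ r (C p * f p) _) ⟩
      r * (C p * f p + sum (λ i → c i * f (punchIn p i)))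
        ≡⟨ cong (r *_) (sym (sum-remove (λ i → C i * f i))) ⟩
      r * sum (λ i → C i * f i)
        ≡⟨ cong (r *_) (sym (∙-linComb (A zero) C b)) ⟩
      r * (A zero ∙ linComb C b)
        ≡⟨ cong (r *_) (sum-cong-≋ (λ j → cong (A zero j *_) (sym (x≡ j)))) ⟩
      r * (A zero ∙ x)
        ≡⟨ cong (r *_) (x∈ zero) ⟩
      r * 0ℚ
        ≡⟨ *-zeroʳ r ⟩
      0ℚ ∎

nullity : ∀ {m n} → Matrix m n → ℕ
nullity A = proj₁ (kernelBasis A)

record ℝ : Set where
  field
    seq    : ℕ → ℚ
    cauchy : ∀ ε → 0ℚ < ε → ∃ λ N → ∀ m n → N ℕ.≤ m → N ℕ.≤ n → ∣ seq m - seq n ∣ < ε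

open ℝ

infix  4 _<ᴿ_
infixl 6 _-ᴿ_
infixl 7 _*ᴿ_

_<ᴿ_ : ℝ → ℝ → Set
x <ᴿ y = ∃₂ λ δ N → 0ℚ < δ × (∀ n → N ℕ.≤ n → seq x n + δ ≤ seq y n)

0<½ : ∀ {ε} → 0ℚ < ε → 0ℚ < ε * ½
0<½ {ε} 0<ε = subst (_< ε * ½) (*-zeroˡ ½) (*-monoˡ-<-pos ½ 0<ε)

½+½ : ∀ ε → ε * ½ + ε * ½ ≡ ε
½+½ ε = trans (sym (*-distribˡ-+ ε ½ ½)) (*-identityʳ ε)

+-mono-<-½ : ∀ {p q ε} → p < ε * ½ → q < ε * ½ → p + q < ε
+-mono-<-½ {p} {q} {ε} p< q< = subst (p + q <_) (½+½ ε) (+-mono-< p< q<)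

∣p-q∣≡∣q-p∣ : ∀ p q → ∣ p - q ∣ ≡ ∣ q - p ∣
∣p-q∣≡∣q-p∣ p q = trans (sym (∣-p∣≡∣p∣ (p - q)))
  (cong ∣_∣ (solve 2 (λ p q → :- (p :- q) := q :- p) refl p q))

∣p-r∣≤ : ∀ p q r → ∣ p - r ∣ ≤ ∣ p - q ∣ + ∣ q - r ∣
∣p-r∣≤ p q r = subst (λ s → ∣ s ∣ ≤ ∣ p - q ∣ + ∣ q - r ∣)
  (solve 3 (λ p q r → (p :- q) :+ (q :- r) := p :- r) refl p q r)
  (∣p+q∣≤∣p∣+∣q∣ (p - q) (q - r))

*-mono-≤-nonNeg : ∀ {p q r s} → 0ℚ ≤ p → 0ℚ ≤ s → p ≤ q → r ≤ s → p * r ≤ q * s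
*-mono-≤-nonNeg {p} {q} {r} {s} 0≤p 0≤s p≤q r≤s = ≤-trans
  (*-monoˡ-≤-nonNeg p {{nonNegative 0≤p}} r≤s)
  (*-monoʳ-≤-nonNeg s {{nonNegative 0≤s}} p≤q)

0<* : ∀ {p q} → 0ℚ < p → 0ℚ < q → 0ℚ < p * q
0<* {p} {q} 0<p 0<q = positive⁻¹ (p * q)
  {{pos*pos⇒pos p {{positive 0<p}} q {{positive 0<q}}}}

0<1/ : ∀ {p} .{{_ : NonZero p}} → 0ℚ < p → 0ℚ < 1/ p
0<1/ {p} {{nz}} 0<p = positive⁻¹ ((1/ p) {{nz}}) {{1/pos⇒pos p {{positive 0<p}}}}

0<p⇒≢0 : ∀ {p} → 0ℚ < p → p ≢ 0ℚ
0<p⇒≢0 0<p p≡0 = <-irrefl (sym p≡0) 0<p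

bounded : ∀ x → ∃₂ λ B N → 0ℚ < B × (∀ n → N ℕ.≤ n → ∣ seq x n ∣ ≤ B)
bounded x with cauchy x 1ℚ (positive⁻¹ 1ℚ)
... | N , close = B , N , 0<B , bound
  where
  a = seq x N
  B = 1ℚ + ∣ a ∣
  0<B : 0ℚ < B
  0<B = <-≤-trans (positive⁻¹ 1ℚ)
    (subst (_≤ B) (+-identityʳ 1ℚ) (+-monoʳ-≤ 1ℚ (0≤∣p∣ a)))
  bound : ∀ n → N ℕ.≤ n → ∣ seq x n ∣ ≤ B
  bound n N≤n = subst (λ s → ∣ s ∣ ≤ B)
    (solve 2 (λ u a → (u :- a) :+ a := u) refl (seq x n) a)
    (≤-trans (∣p+q∣≤∣p∣+∣q∣ (seq x n - a) a)
      (+-monoˡ-≤ ∣ a ∣ (<⇒≤ (close n N N≤n ℕₚ.≤-refl))))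

fromℚ : ℚ → ℝ
fromℚ q = record
  { seq    = λ _ → q
  ; cauchy = λ ε 0<ε → 0 , λ _ _ _ _ → subst (_< ε) (sym (cong ∣_∣ (+-inverseʳ q))) 0<ε
  }

0ᴿ : ℝ
0ᴿ = fromℚ 0ℚ

∣[a-b]-[c-d]∣≤ : ∀ a b c d → ∣ (a - b) - (c - d) ∣ ≤ ∣ a - c ∣ + ∣ b - d ∣
∣[a-b]-[c-d]∣≤ a b c d = subst (λ s → ∣ s ∣ ≤ ∣ a - c ∣ + ∣ b - d ∣)
  (solve 4 (λ a b c d → (a :- c) :- (b :- d) := (a :- b) :- (c :- d)) refl a b c d)
  (∣p-q∣≤∣p∣+∣q∣ (a - c) (b - d))

_-ᴿ_ : ℝ → ℝ → ℝ
x -ᴿ y = record { seq = λ n → seq x n - seq y n ; cauchy = cauchy′ }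
  where
  cauchy′ : ∀ ε → 0ℚ < ε → ∃ λ N → ∀ m n → N ℕ.≤ m → N ℕ.≤ n →
            ∣ (seq x m - seq y m) - (seq x n - seq y n) ∣ < ε
  cauchy′ ε 0<ε =
    let (M , close-x) = cauchy x (ε * ½) (0<½ 0<ε)
        (N , close-y) = cauchy y (ε * ½) (0<½ 0<ε)
    in M ℕ.⊔ N , λ m n ≤m ≤n → ≤-<-trans
      (∣[a-b]-[c-d]∣≤ (seq x m) (seq y m) (seq x n) (seq y n))
      (+-mono-<-½
        (close-x m n (ℕₚ.m⊔n≤o⇒m≤o M N ≤m) (ℕₚ.m⊔n≤o⇒m≤o M N ≤n))
        (close-y m n (ℕₚ.m⊔n≤o⇒n≤o M N ≤m) (ℕₚ.m⊔n≤o⇒n≤o M N ≤n)))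

*-close : ∀ {B C η} a b c d → 0ℚ < B → 0ℚ < C → ∣ a ∣ ≤ B → ∣ d ∣ ≤ C →
          ∣ a - b ∣ < η → ∣ c - d ∣ < η → ∣ a * c - b * d ∣ < (B + C) * η
*-close {B} {C} {η} a b c d 0<B 0<C a≤B d≤C a-b<η c-d<η = begin-strict
  ∣ a * c - b * d ∣
    ≡⟨ cong ∣_∣ (solve 4 (λ a b c d → a :* c :- b :* d := a :* (c :- d) :+ d :* (a :- b))
         refl a b c d) ⟩
  ∣ a * (c - d) + d * (a - b) ∣
    ≤⟨ ∣p+q∣≤∣p∣+∣q∣ (a * (c - d)) (d * (a - b)) ⟩
  ∣ a * (c - d) ∣ + ∣ d * (a - b) ∣
    ≡⟨ cong₂ _+_ (∣p*q∣≡∣p∣*∣q∣ a (c - d)) (∣p*q∣≡∣p∣*∣q∣ d (a - b)) ⟩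
  ∣ a ∣ * ∣ c - d ∣ + ∣ d ∣ * ∣ a - b ∣
    ≤⟨ +-mono-≤
         (*-monoʳ-≤-nonNeg ∣ c - d ∣ {{∣-∣-nonNeg (c - d)}} a≤B)
         (*-monoʳ-≤-nonNeg ∣ a - b ∣ {{∣-∣-nonNeg (a - b)}} d≤C) ⟩
  B * ∣ c - d ∣ + C * ∣ a - b ∣
    <⟨ +-mono-< (*-monoʳ-<-pos B {{positive 0<B}} c-d<η)
                (*-monoʳ-<-pos C {{positive 0<C}} a-b<η) ⟩
  B * η + C * η
    ≡⟨ sym (*-distribʳ-+ η B C) ⟩
  (B + C) * η ∎
  where open ≤-Reasoning

divide : ∀ {D ε} → 0ℚ < D → 0ℚ < ε → ∃ λ η → 0ℚ < η × D * η ≡ ε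
divide {D} {ε} 0<D 0<ε = 1/ D * ε , 0<* (0<1/ 0<D) 0<ε ,
  trans (sym (*-assoc D (1/ D) ε)) (trans (cong (_* ε) (*-inverseʳ D)) (*-identityˡ ε))
  where instance D-nonZero = ≢-nonZero (0<p⇒≢0 0<D)

_*ᴿ_ : ℝ → ℝ → ℝ
x *ᴿ y = record { seq = λ n → seq x n * seq y n ; cauchy = cauchy′ }
  where
  cauchy′ : ∀ ε → 0ℚ < ε → ∃ λ N → ∀ m n → N ℕ.≤ m → N ℕ.≤ n →
            ∣ seq x m * seq y m - seq x n * seq y n ∣ < ε
  cauchy′ ε 0<ε =
    let (B , K , 0<B , bound-x) = bounded x
        (C , L , 0<C , bound-y) = bounded y
        (η , 0<η , Dη≡ε)        = divide (+-mono-< 0<B 0<C) 0<ε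
        (M , close-x)           = cauchy x η 0<η
        (N , close-y)           = cauchy y η 0<η
        left : ∀ {m} → K ℕ.⊔ L ℕ.⊔ (M ℕ.⊔ N) ℕ.≤ m → K ℕ.⊔ L ℕ.≤ m
        left  = ℕₚ.m⊔n≤o⇒m≤o (K ℕ.⊔ L) (M ℕ.⊔ N)
        right : ∀ {m} → K ℕ.⊔ L ℕ.⊔ (M ℕ.⊔ N) ℕ.≤ m → M ℕ.⊔ N ℕ.≤ m
        right = ℕₚ.m⊔n≤o⇒n≤o (K ℕ.⊔ L) (M ℕ.⊔ N)
    in K ℕ.⊔ L ℕ.⊔ (M ℕ.⊔ N) , λ m n ≤m ≤n →
      subst (∣ seq x m * seq y m - seq x n * seq y n ∣ <_) Dη≡ε
        (*-close (seq x m) (seq x n) (seq y m) (seq y n) 0<B 0<C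
          (bound-x m (ℕₚ.m⊔n≤o⇒m≤o K L (left ≤m)))
          (bound-y n (ℕₚ.m⊔n≤o⇒n≤o K L (left ≤n)))
          (close-x m n (ℕₚ.m⊔n≤o⇒m≤o M N (right ≤m)) (ℕₚ.m⊔n≤o⇒m≤o M N (right ≤n)))
          (close-y m n (ℕₚ.m⊔n≤o⇒n≤o M N (right ≤m)) (ℕₚ.m⊔n≤o⇒n≤o M N (right ≤n))))

∣_∣ᴿ : ℝ → ℝ
∣ x ∣ᴿ = record
  { seq    = λ n → ∣ seq x n ∣
  ; cauchy = λ ε 0<ε → let (N , close) = cauchy x ε 0<ε in
      N , λ m n ≤m ≤n → ≤-<-trans (reverse (seq x m) (seq x n)) (close m n ≤m ≤n)
  }
  where
  half : ∀ p q → ∣ p ∣ - ∣ q ∣ ≤ ∣ p - q ∣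
  half p q = subst (∣ p ∣ - ∣ q ∣ ≤_)
    (solve 2 (λ s q → s :+ q :- q := s) refl ∣ p - q ∣ ∣ q ∣)
    (+-monoˡ-≤ (- ∣ q ∣) (subst (λ s → ∣ s ∣ ≤ ∣ p - q ∣ + ∣ q ∣)
      (solve 2 (λ p q → (p :- q) :+ q := p) refl p q) (∣p+q∣≤∣p∣+∣q∣ (p - q) q)))
  reverse : ∀ p q → ∣ ∣ p ∣ - ∣ q ∣ ∣ ≤ ∣ p - q ∣
  reverse p q with ∣p∣≡p∨∣p∣≡-p (∣ p ∣ - ∣ q ∣)
  ... | inj₁ eq = subst (_≤ ∣ p - q ∣) (sym eq) (half p q)
  ... | inj₂ eq = subst₂ _≤_
    (trans (solve 2 (λ p q → q :- p := :- (p :- q)) refl ∣ p ∣ ∣ q ∣) (sym eq))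
    (∣p-q∣≡∣q-p∣ q p) (half q p)

∣1/p∣≤1/δ : ∀ {δ p} .{{_ : NonZero δ}} .{{_ : NonZero p}} → 0ℚ < δ → δ ≤ ∣ p ∣ → ∣ 1/ p ∣ ≤ 1/ δ
∣1/p∣≤1/δ {δ} {p} 0<δ δ≤ = *-cancelʳ-≤-pos δ {{positive 0<δ}} (begin
  ∣ 1/ p ∣ * δ       ≤⟨ *-monoˡ-≤-nonNeg ∣ 1/ p ∣ {{∣-∣-nonNeg (1/ p)}} δ≤ ⟩
  ∣ 1/ p ∣ * ∣ p ∣   ≡⟨ sym (∣p*q∣≡∣p∣*∣q∣ (1/ p) p) ⟩
  ∣ 1/ p * p ∣       ≡⟨ cong ∣_∣ (*-inverseˡ p) ⟩
  1ℚ                 ≡⟨ sym (*-inverseˡ δ) ⟩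
  1/ δ * δ           ∎)
  where open ≤-Reasoning

1/p-1/q : ∀ p q .{{_ : NonZero p}} .{{_ : NonZero q}} →
          ∣ 1/ p - 1/ q ∣ ≡ ∣ q - p ∣ * (∣ 1/ p ∣ * ∣ 1/ q ∣)
1/p-1/q p q = begin
  ∣ u - v ∣                          ≡⟨ cong ∣_∣ (sym (cong₂ _-_
                                          (trans (cong (u *_) (*-inverseʳ q)) (*-identityʳ u))
                                          (trans (cong (v *_) (*-inverseʳ p)) (*-identityʳ v)))) ⟩
  ∣ u * (q * v) - v * (p * u) ∣      ≡⟨ cong ∣_∣ (lemma u v p q) ⟩
  ∣ (q - p) * (u * v) ∣              ≡⟨ ∣p*q∣≡∣p∣*∣q∣ (q - p) (u * v) ⟩
  ∣ q - p ∣ * ∣ u * v ∣              ≡⟨ cong (∣ q - p ∣ *_) (∣p*q∣≡∣p∣*∣q∣ u v) ⟩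
  ∣ q - p ∣ * (∣ u ∣ * ∣ v ∣)        ∎
  where
  open ≡-Reasoning
  u = 1/ p
  v = 1/ q
  lemma : ∀ u v p q → u * (q * v) - v * (p * u) ≡ (q - p) * (u * v)
  lemma = solve 4 (λ u v p q → u :* (q :* v) :- v :* (p :* u) := (q :- p) :* (u :* v)) refl

infix 9 _⁻¹⟨_⟩

-- The first N terms of x, which may vanish, are dropped.
_⁻¹⟨_⟩ : ∀ x → 0ᴿ <ᴿ ∣ x ∣ᴿ → ℝ
x ⁻¹⟨ δ , N , 0<δ , apart ⟩ = record { seq = λ n → 1/ x↑ n ; cauchy = cauchy′ }
  where
  x↑ : ℕ → ℚ
  x↑ n = seq x (N ℕ.+ n)
  δ≤ : ∀ n → δ ≤ ∣ x↑ n ∣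
  δ≤ n = subst (_≤ ∣ x↑ n ∣) (+-identityˡ δ) (apart (N ℕ.+ n) (ℕₚ.m≤m+n N n))
  instance
    x↑-nonZero : ∀ {n} → NonZero (x↑ n)
    x↑-nonZero {n} = ≢-nonZero λ x≡0 →
      <-irrefl refl (<-≤-trans 0<δ (subst (λ s → δ ≤ ∣ s ∣) x≡0 (δ≤ n)))
    δ-nonZero : NonZero δ
    δ-nonZero = ≢-nonZero (0<p⇒≢0 0<δ)
  r = 1/ δ
  0<r : 0ℚ < r
  0<r = 0<1/ 0<δ

  cauchy′ : ∀ ε → 0ℚ < ε → ∃ λ M → ∀ m n → M ℕ.≤ m → M ℕ.≤ n → ∣ 1/ x↑ m - 1/ x↑ n ∣ < ε
  cauchy′ ε 0<ε =
    let (η , 0<η , rrη≡ε) = divide (0<* 0<r 0<r) 0<ε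
        (M , close)       = cauchy x η 0<η
    in M , λ m n ≤m ≤n → begin-strict
      ∣ 1/ x↑ m - 1/ x↑ n ∣
        ≡⟨ 1/p-1/q (x↑ m) (x↑ n) ⟩
      ∣ x↑ n - x↑ m ∣ * (∣ 1/ x↑ m ∣ * ∣ 1/ x↑ n ∣)
        ≤⟨ *-monoˡ-≤-nonNeg ∣ x↑ n - x↑ m ∣ {{∣-∣-nonNeg (x↑ n - x↑ m)}}
             (*-mono-≤-nonNeg (0≤∣p∣ (1/ x↑ m)) (<⇒≤ 0<r)
               (∣1/p∣≤1/δ 0<δ (δ≤ m)) (∣1/p∣≤1/δ 0<δ (δ≤ n))) ⟩
      ∣ x↑ n - x↑ m ∣ * (r * r)
        <⟨ *-monoˡ-<-pos (r * r) {{positive (0<* 0<r 0<r)}}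
             (close (N ℕ.+ n) (N ℕ.+ m) (ℕₚ.m≤n⇒m≤o+n N ≤n) (ℕₚ.m≤n⇒m≤o+n N ≤m)) ⟩
      η * (r * r)
        ≡⟨ trans (*-comm η (r * r)) rrη≡ε ⟩
      ε ∎
    where open ≤-Reasoning

infix 4 _⟶_

_⟶_ : ((k : ℕ) .{{_ : ℕ.NonZero k}} → ℝ) → ℝ → Set
a ⟶ L = ∀ ε → 0ᴿ <ᴿ ε → ∃ λ K → ∀ k .{{_ : ℕ.NonZero k}} → K ℕ.≤ k → ∣ a k -ᴿ L ∣ᴿ <ᴿ ε

-- a 0 - (a 1 - (a 2 - ⋯ a (n - 1))) = Σ_{i < n} (-1)^i a i
alternatingSum : (ℕ → ℚ) → ℕ → ℚ
alternatingSum a zero    = 0ℚ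
alternatingSum a (suc n) = a 0 - alternatingSum (a ∘ suc) n

Antitone NonNeg : (ℕ → ℚ) → Set
Antitone a = ∀ i → a (suc i) ≤ a i
NonNeg   a = ∀ i → 0ℚ ≤ a i

p-q≤p : ∀ {p q} → 0ℚ ≤ q → p - q ≤ p
p-q≤p {p} {q} 0≤q = subst (p - q ≤_) (+-identityʳ p) (+-monoʳ-≤ p (neg-antimono-≤ 0≤q))

0≤p-q : ∀ {p q} → q ≤ p → 0ℚ ≤ p - q
0≤p-q {p} {q} q≤p = subst (_≤ p - q) (+-inverseʳ q) (+-monoˡ-≤ (- q) q≤p)

alternatingSum-bounds : ∀ a → Antitone a → NonNeg a → ∀ n →
  0ℚ ≤ alternatingSum a n × alternatingSum a n ≤ a 0
alternatingSum-bounds a ↓ ≥0 zero    = ≤-refl , ≥0 0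
alternatingSum-bounds a ↓ ≥0 (suc n) =
  let (0≤s , s≤) = alternatingSum-bounds (a ∘ suc) (↓ ∘ suc) (≥0 ∘ suc) n
  in 0≤p-q (≤-trans s≤ (↓ 0)) , p-q≤p 0≤s

alternatingSum-tail : ∀ a N p →
  ∣ alternatingSum a (N ℕ.+ p) - alternatingSum a N ∣ ≡ ∣ alternatingSum (a ∘ (N ℕ.+_)) p ∣
alternatingSum-tail a zero    p = cong ∣_∣ (+-identityʳ _)
alternatingSum-tail a (suc N) p = trans
  (cong ∣_∣ (solve 3 (λ a s t → (a :- s) :- (a :- t) := t :- s) refl (a 0) S T))
  (trans (∣p-q∣≡∣q-p∣ T S) (alternatingSum-tail (a ∘ suc) N p))
  where S = alternatingSum (a ∘ suc) (N ℕ.+ p)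
        T = alternatingSum (a ∘ suc) N

alternatingSum-close : ∀ a → Antitone a → NonNeg a → ∀ N n → N ℕ.≤ n →
  ∣ alternatingSum a n - alternatingSum a N ∣ ≤ a N
alternatingSum-close a ↓ ≥0 N n N≤n = subst
  (λ n → ∣ alternatingSum a n - alternatingSum a N ∣ ≤ a N) (ℕₚ.m+[n∸m]≡n N≤n)
  (subst₂ _≤_
    (sym (trans (alternatingSum-tail a N p) (0≤p⇒∣p∣≡p (proj₁ bounds))))
    (cong a (ℕₚ.+-identityʳ N))
    (proj₂ bounds))
  where
  p = n ℕ.∸ N
  bounds = alternatingSum-bounds (a ∘ (N ℕ.+_))
    (λ i → subst (λ j → a j ≤ a (N ℕ.+ i)) (sym (ℕₚ.+-suc N i)) (↓ (N ℕ.+ i)))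
    (λ i → ≥0 (N ℕ.+ i)) p

term : ℕ → ℚ
term i = + 4 / suc (2 ℕ.* i)

toℚᵘ-term : ∀ i → toℚᵘ (term i) ℚᵘ.≃ ℚᵘ.mkℚᵘ (+ 4) (2 ℕ.* i)
toℚᵘ-term i = toℚᵘ-fromℚᵘ (ℚᵘ.mkℚᵘ (+ 4) (2 ℕ.* i))

term-nonNeg : NonNeg term
term-nonNeg i = nonNegative⁻¹ (term i) {{normalize-nonNeg 4 (suc (2 ℕ.* i))}}

term-antitone : Antitone term
term-antitone i = toℚᵘ-cancel-≤
  (ℚᵘₚ.≤-respˡ-≃ (ℚᵘₚ.≃-sym (toℚᵘ-term (suc i)))
    (ℚᵘₚ.≤-respʳ-≃ (ℚᵘₚ.≃-sym (toℚᵘ-term i))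
      (ℚᵘ.*≤* (ℤ.+≤+ (ℕₚ.*-monoʳ-≤ 4 (ℕ.s≤s (ℕₚ.*-monoʳ-≤ 2 (ℕₚ.n≤1+n i))))))))

term-small : ∀ ε → 0ℚ < ε → ∃ λ N → term N < ε
term-small ε@(mkℚ (+ zero) d _) 0<ε with positive 0<ε
... | ()
term-small ε@(mkℚ (-[1+ p ]) d _) 0<ε with positive 0<ε
... | ()
term-small ε@(mkℚ (+ suc p) d _) 0<ε = N , toℚᵘ-cancel-<
  (ℚᵘₚ.<-respˡ-≃ (ℚᵘₚ.≃-sym (toℚᵘ-term N)) (ℚᵘ.*<* (ℤ.+<+ (begin-strict
    4 ℕ.* suc d             ≡⟨ ℕₚ.*-assoc 2 2 (suc d) ⟩
    2 ℕ.* N                 <⟨ ℕₚ.n<1+n _ ⟩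
    suc (2 ℕ.* N)           ≤⟨ ℕₚ.m≤n*m (suc (2 ℕ.* N)) (suc p) ⟩
    suc p ℕ.* suc (2 ℕ.* N) ∎))))
  where
  open ℕₚ.≤-Reasoning
  N = 2 ℕ.* suc d

-- Leibniz's series π = Σ_{i ≥ 0} (-1)^i 4/(2i+1).
π : ℝ
π = record { seq = alternatingSum term ; cauchy = cauchy′ }
  where
  s : ℕ → ℚ
  s = alternatingSum term
  cauchy′ : ∀ ε → 0ℚ < ε → ∃ λ N → ∀ m n → N ℕ.≤ m → N ℕ.≤ n → ∣ s m - s n ∣ < ε
  cauchy′ ε 0<ε =
    let (N , small) = term-small (ε * ½) (0<½ 0<ε)
        close : ∀ n → N ℕ.≤ n → ∣ s n - s N ∣ ≤ term N
        close = alternatingSum-close term term-antitone term-nonNeg N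
    in N , λ m n ≤m ≤n → ≤-<-trans
      (∣p-r∣≤ (s m) (s N) (s n))
      (+-mono-<-½
        (≤-<-trans (close m ≤m) small)
        (≤-<-trans (subst (_≤ term N) (∣p-q∣≡∣q-p∣ (s n) (s N)) (close n ≤n)) small))

π²≠0 : 0ᴿ <ᴿ ∣ π *ᴿ π ∣ᴿ
π²≠0 = 1ℚ , 2 , positive⁻¹ 1ℚ , λ n 2≤n → begin
  0ℚ + 1ℚ           ≡⟨⟩
  1ℚ * 1ℚ           ≤⟨ *-mono-≤-nonNeg (<⇒≤ (positive⁻¹ 1ℚ)) (0≤∣p∣ (s n)) (1≤∣s∣ n 2≤n) (1≤∣s∣ n 2≤n) ⟩
  ∣ s n ∣ * ∣ s n ∣ ≡⟨ sym (∣p*q∣≡∣p∣*∣q∣ (s n) (s n)) ⟩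
  ∣ s n * s n ∣     ∎
  where
  open ≤-Reasoning
  s = alternatingSum term
  1≤s : ∀ n → 1ℚ ≤ s (2 ℕ.+ n)
  1≤s n = begin
    1ℚ                    ≤⟨ ≤ᵇ⇒≤ _ ⟩
    term 0 - term 1       ≤⟨ +-monoʳ-≤ (term 0) (neg-antimono-≤ (p-q≤p {term 1} 0≤rest)) ⟩
    s (2 ℕ.+ n)           ∎
    where
    0≤rest : 0ℚ ≤ alternatingSum (λ i → term (2 ℕ.+ i)) n
    0≤rest = proj₁ (alternatingSum-bounds (λ i → term (2 ℕ.+ i))
      (λ i → term-antitone (2 ℕ.+ i)) (λ i → term-nonNeg (2 ℕ.+ i)) n)
  1≤∣s∣ : ∀ n → 2 ℕ.≤ n → 1ℚ ≤ ∣ s n ∣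
  1≤∣s∣ (suc (suc n)) _ = subst (1ℚ ≤_) (sym (0≤p⇒∣p∣≡p (≤-trans (<⇒≤ (positive⁻¹ 1ℚ)) (1≤s n)))) (1≤s n)
  1≤∣s∣ (suc zero) (ℕ.s≤s ())

1/_² : (n : ℕ) .{{_ : ℕ.NonZero n}} → ℚ
1/ n ² = (+ 1 / n) * (+ 1 / n)

band : ℕ → ℕ → ℚ
band k d = if d ℕ.≤ᵇ k then 1ℚ else 0ℚ

-- The entry on the d-th superdiagonal; negative d are subdiagonals.
symbol : ℕ → ℤ → ℚ
symbol k +0       = 0ℚ
symbol k +[1+ d ] = band k (suc d)
symbol k -[1+ d ] = - band k (suc d)

A : (n k : ℕ) → Matrix n n
A n k i j = symbol k (toℕ j ⊖ toℕ i)

period : ℕ → ℕ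
period k = k ℕ.* k ℕ.+ k

instance
  period-nonZero : ∀ {k} .{{_ : ℕ.NonZero k}} → ℕ.NonZero (period k)
  period-nonZero {suc _} = _

-- Some n′ > k congruent to n modulo k² + k, namely n itself whenever n > k.
-- The nullity of A n′ k does not depend on the choice of n′.
representative : ℤ → (k : ℕ) .{{_ : ℕ.NonZero k}} → ℕ
representative n k =
  if ⌊ + k ℤ.<? n ⌋ then ℤ.∣ n ∣ else n %ℕ period k ℕ.+ period k

N : ℤ → (k : ℕ) .{{_ : ℕ.NonZero k}} → ℕ
N n k = nullity (A (representative n k) k)

P : ℕ → (k : ℕ) .{{_ : ℕ.NonZero k}} → ℚ
P z k = + length (filter (λ n → N (+ n) k ℕ.≟ z) (upTo (period k))) / period k

{-
With m = n + k, a kernel vector of A n k is v_j = c(j mod k + 1) - c(j) for a (k+1)-periodic c with c(0) = 0,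
because the symbol of A n k is x^(-k) (x^k - 1) (x^(k+1) - 1) / (x - 1). The boundary conditions say that c is
constant along the orbits of a partial rotation of ℤ/(k+1) with one break, depending on m. Hence the nullity is
the number of orbits that avoid 0.

Order the multiples of a fraction p/q (coprime, q ≤ k) slightly increased by their fractional parts, and let
F = Σ_{x≤k} ⌊xp/q⌋. The resulting permutation of {1, …, k} conjugates the rotation for m = 2F + k - w, where
0 ≤ w ≤ k/q, to a shift with w closed loops of length q, so that N = w there; by symmetry the same holds at
k(k+1) - m. Taking p/q = i/j with 0 ≤ i < j ≤ k and w = gcd(i,j) - 1, respectively w = gcd(i,j) at the reflected
position, gives distinct values of m, and there are k(k+1) of them, so they exhaust one period. Up to O(k),
the number of n with N(n,k) = z is therefore the number of pairs 0 ≤ i < j ≤ k whose gcd is z or z + 1, that is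
Φ(k/z) + Φ(k/(z+1)) with Φ(x) = Σ_{j≤x} φ(j).

The asymptotics Φ(x) ~ x²/(2ζ(2)) follows from Σ_g Φ(x/g) = x(x+1)/2 by iteration, as ζ(2) - 1 < 1, and
6ζ(2) = π² is obtained by squaring Leibniz's series.
-}
module Submission where

-- The loops come from a coincidence of ranks. Write K = k + 1. As k is -1 modulo K, the boundary
-- conditions identify σ with σ - (a + 1) for σ ≤ r and with σ - a for σ > r, where m = k a + r.
-- Ranking multiples of a slope α among α, ..., kα turns j ↦ j - 1 into just such a map, with r the
-- rank of Kα. Once p/q is raised slightly, j + q directly follows j in rank, so K - q, K - 2q, ...
-- occupy the ranks r, r - 1, .... Lowering r by w therefore alters the map at w points only and
-- moves each image up by one rank, that is, by q indices: w closed loops of length q split off.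
-- That the positions exhaust a period is never proved directly. They give a lower bound for the
-- number of n whose nullity has a given property; applied to the complementary property this
-- becomes an upper bound, because positions and period are equally many. All estimates stay in ℚ:
-- ζ(2) is replaced by a partial sum whose length depends on the tolerance, and π by its partial
-- sums.

open import Algebra.Bundles using (CommutativeSemiring)
open import Level using (0ℓ)

-- Finite sums over a commutative semiring.

module Sum (R : CommutativeSemiring 0ℓ 0ℓ) where
  open import Data.Nat.Base using (ℕ; zero; suc; _<_; _∸_)
  import Data.Nat.Properties as ℕₚ
  open import Function.Base using (_∘_)
  open CommutativeSemiring R
  open import Relation.Binary.Reasoning.Setoid setoid
  open import Algebra.Properties.CommutativeSemigroup +-commutativeSemigroup using (interchange)

  Σ< : ℕ → (ℕ → Carrier) → Carrier
  Σ< zero    f = 0#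
  Σ< (suc n) f = Σ< n f + f n

  Σ<-cong : ∀ n {f g} → (∀ i → i < n → f i ≈ g i) → Σ< n f ≈ Σ< n g
  Σ<-cong zero    f≈g = refl
  Σ<-cong (suc n) f≈g = +-cong (Σ<-cong n (λ i i<n → f≈g i (ℕₚ.m<n⇒m<1+n i<n))) (f≈g n (ℕₚ.n<1+n n))

  Σ<-0 : ∀ n → Σ< n (λ _ → 0#) ≈ 0#
  Σ<-0 zero    = refl
  Σ<-0 (suc n) = trans (+-identityʳ _) (Σ<-0 n)

  Σ<-+ : ∀ n f g → Σ< n (λ i → f i + g i) ≈ Σ< n f + Σ< n g
  Σ<-+ zero    f g = sym (+-identityˡ 0#)
  Σ<-+ (suc n) f g = trans (+-congʳ (Σ<-+ n f g)) (interchange _ _ _ _)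

  Σ<-* : ∀ n c f → Σ< n (λ i → c * f i) ≈ c * Σ< n f
  Σ<-* zero    c f = sym (zeroʳ c)
  Σ<-* (suc n) c f = trans (+-congʳ (Σ<-* n c f)) (sym (distribˡ c _ _))

  Σ<-head : ∀ n f → Σ< (suc n) f ≈ f 0 + Σ< n (f ∘ suc)
  Σ<-head zero    f = +-comm 0# (f 0)
  Σ<-head (suc n) f = trans (+-congʳ (Σ<-head n f)) (+-assoc _ _ _)

  Σ<-reverse : ∀ n f → Σ< n (λ i → f (n ∸ suc i)) ≈ Σ< n f
  Σ<-reverse zero    f = refl
  Σ<-reverse (suc n) f = begin
    Σ< (suc n) (λ i → f (n ∸ i))             ≈⟨ Σ<-head n _ ⟩
    f n + Σ< n (λ i → f (n ∸ suc i))         ≈⟨ +-comm _ _ ⟩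
    Σ< n (λ i → f (n ∸ suc i)) + f n         ≈⟨ +-congʳ (Σ<-reverse n f) ⟩
    Σ< n f + f n ∎

-- Sums of naturals, uniqueness of quotients, and the 0-1 indicator of an inequality.

module NatSum where
  open import Data.Nat
  open import Data.Nat.Properties
  open import Data.Nat.DivMod
  open import Data.Sum using (inj₁; inj₂)
  open import Relation.Binary.PropositionalEquality
  open import Relation.Nullary using (contradiction)
  open Sum +-*-commutativeSemiring public

  quotient-unique : ∀ {V} a b x y → a < V → b < V → a + x * V ≡ b + y * V → x ≡ y
  quotient-unique {V} a b zero    zero    a<V b<V eq = refl
  quotient-unique {V} a b zero    (suc y) a<V b<V eq = contradiction
    (≤-trans (m≤m+n V _) (≤-trans (m≤n+m _ b) (≤-reflexive (trans (sym eq) (+-identityʳ a))))) (<⇒≱ a<V)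
  quotient-unique {V} a b (suc x) zero    a<V b<V eq = contradiction
    (≤-trans (m≤m+n V _) (≤-trans (m≤n+m _ a) (≤-reflexive (trans eq (+-identityʳ b))))) (<⇒≱ b<V)
  quotient-unique {V} a b (suc x) (suc y) a<V b<V eq = cong suc (quotient-unique a b x y a<V b<V
    (+-cancelʳ-≡ V _ _ (trans (shuffle a x) (trans eq (sym (shuffle b y))))))
    where
    shuffle : ∀ c z → c + z * V + V ≡ c + (V + z * V)
    shuffle c z = trans (+-assoc c (z * V) V) (cong (c +_) (+-comm (z * V) V))

  /-unique : ∀ {V} .{{_ : NonZero V}} n a x → a < V → n ≡ a + x * V → n / V ≡ x
  /-unique {V} n a x a<V n≡ = quotient-unique (n % V) a (n / V) x (m%n<n n V) a<V
    (trans (sym (m≡m%n+[m/n]*n n V)) n≡)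

  %-unique : ∀ {V} .{{_ : NonZero V}} n a x → a < V → n ≡ a + x * V → n % V ≡ a
  %-unique {V} n a x a<V refl = trans ([m+kn]%n≡m%n a x V) (m<n⇒m%n≡m a<V)

  le : ℕ → ℕ → ℕ
  le zero    _       = 1
  le (suc a) zero    = 0
  le (suc a) (suc b) = le a b

  le-≤ : ∀ {a b} → a ≤ b → le a b ≡ 1
  le-≤ z≤n       = refl
  le-≤ (s≤s a≤b) = le-≤ a≤b

  le-> : ∀ {a b} → b < a → le a b ≡ 0
  le-> {suc a} {zero}  _         = refl
  le-> {suc a} {suc b} (s≤s b<a) = le-> b<a

  le≤1 : ∀ a b → le a b ≤ 1
  le≤1 zero    b       = ≤-refl
  le≤1 (suc a) zero    = z≤n
  le≤1 (suc a) (suc b) = le≤1 a b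

  le-total : ∀ a b → a ≢ b → le a b + le b a ≡ 1
  le-total a b a≢b with ≤-<-connex a b
  ... | inj₁ a≤b = cong₂ _+_ (le-≤ a≤b) (le-> (≤∧≢⇒< a≤b a≢b))
  ... | inj₂ b<a = cong₂ _+_ (le-> b<a) (le-≤ (<⇒≤ b<a))

  le-mono : ∀ a {b c} → b ≤ c → le a b ≤ le a c
  le-mono a {b} {c} b≤c with ≤-<-connex a b
  ... | inj₁ a≤b = ≤-reflexive (trans (le-≤ a≤b) (sym (le-≤ (≤-trans a≤b b≤c))))
  ... | inj₂ b<a = subst (_≤ le a c) (sym (le-> b<a)) z≤n

  Σ<-mono : ∀ n {f g} → (∀ i → i < n → f i ≤ g i) → Σ< n f ≤ Σ< n g
  Σ<-mono zero    f≤g = z≤n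
  Σ<-mono (suc n) f≤g = +-mono-≤ (Σ<-mono n (λ i i<n → f≤g i (m<n⇒m<1+n i<n))) (f≤g n (n<1+n n))

  Σ<-mono-< : ∀ n {f g} i → i < n → (∀ i → i < n → f i ≤ g i) → f i < g i → Σ< n f < Σ< n g
  Σ<-mono-< (suc n) {f} {g} i i<1+n f≤g fi<gi with m≤n⇒m<n∨m≡n (s≤s⁻¹ i<1+n)
  ... | inj₁ i<n  = +-mono-<-≤ (Σ<-mono-< n i i<n (λ i i<n → f≤g i (m<n⇒m<1+n i<n)) fi<gi) (f≤g n (n<1+n n))
  ... | inj₂ refl = +-mono-≤-< (Σ<-mono n (λ i i<n → f≤g i (m<n⇒m<1+n i<n))) fi<gi

  Σ<-const : ∀ n c → Σ< n (λ _ → c) ≡ n * c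
  Σ<-const zero    c = refl
  Σ<-const (suc n) c = trans (cong (_+ c) (Σ<-const n c)) (+-comm (n * c) c)

  Σ<-≤ : ∀ n f → (∀ i → i < n → f i ≤ 1) → Σ< n f ≤ n
  Σ<-≤ n f f≤1 = subst (Σ< n f ≤_) (trans (Σ<-const n 1) (*-identityʳ n)) (Σ<-mono n f≤1)

  Σ<-suc-at : ∀ n {f g} i → i < n → f i ≡ suc (g i) → (∀ l → l < n → l ≢ i → f l ≡ g l) → Σ< n f ≡ suc (Σ< n g)
  Σ<-suc-at (suc n) {f} {g} i i<1+n fi f≡g with m≤n⇒m<n∨m≡n (s≤s⁻¹ i<1+n)
  ... | inj₁ i<n  = cong₂ _+_ (Σ<-suc-at n i i<n fi (λ l l<n → f≡g l (m<n⇒m<1+n l<n))) (f≡g n (n<1+n n) (>⇒≢ i<n))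
  ... | inj₂ refl = trans (cong₂ _+_ (Σ<-cong n (λ l l<n → f≡g l (m<n⇒m<1+n l<n) (<⇒≢ l<n))) fi) (+-suc _ _)

-- Ranks of the fractional parts of the multiples of a rational slope.

module Rotation where
  open import Data.Nat
  open import Data.Nat.Properties
  open import Data.Nat.DivMod
  open import Data.Nat.Tactic.RingSolver using (solve-∀)
  open import Data.Sum using (inj₁; inj₂)
  open import Relation.Binary.PropositionalEquality
  open import Function.Base using (_∘_)
  open NatSum

  module Ranks (k U V : ℕ) .{{_ : NonZero V}} where
    K = suc k

    L y : ℕ → ℕ
    L x = x * U / V
    y x = x * U % V

    y<V : ∀ x → y x < V
    y<V x = m%n<n (x * U) V

    split : ∀ x → x * U ≡ y x + L x * V
    split x = m≡m%n+[m/n]*n (x * U) V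

    -- ⌊jα⌋ - ⌊iα⌋ - ⌊(j - i)α⌋ is 0 or 1 according to the order of the fractional parts of iα and jα.
    carry : ∀ i x j s → i + x ≡ j + V * s → le (y i) (y j) + (L j + U * s) ≡ 1 + (L i + L x)
    carry i x j s i+x≡ with ≤-<-connex (y i) (y j)
    ... | inj₁ yi≤yj = trans (cong (_+ (L j + U * s)) (le-≤ yi≤yj)) (cong suc (sym
        (quotient-unique (y x) (y j ∸ y i) (L i + L x) (L j + U * s)
          (y<V x) (≤-<-trans (m∸n≤m (y j) (y i)) (y<V j)) (+-cancelˡ-≡ (y i) _ _ eq))))
      where
      open ≡-Reasoning
      eq : y i + (y x + (L i + L x) * V) ≡ y i + (y j ∸ y i + (L j + U * s) * V)
      eq = begin
        y i + (y x + (L i + L x) * V) ≡⟨ lemma₁ (y i) (y x) (L i) (L x) V ⟩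
        (y i + L i * V) + (y x + L x * V) ≡⟨ cong₂ _+_ (sym (split i)) (sym (split x)) ⟩
        i * U + x * U ≡⟨ sym (*-distribʳ-+ U i x) ⟩
        (i + x) * U ≡⟨ cong (_* U) i+x≡ ⟩
        (j + V * s) * U ≡⟨ lemma₂ j V s U ⟩
        j * U + U * s * V ≡⟨ cong (_+ U * s * V) (split j) ⟩
        y j + L j * V + U * s * V ≡⟨ cong (λ t → t + L j * V + U * s * V) (sym (m+[n∸m]≡n yi≤yj)) ⟩
        y i + (y j ∸ y i) + L j * V + U * s * V ≡⟨ lemma₃ (y i) (y j ∸ y i) (L j) (U * s) V ⟩
        y i + (y j ∸ y i + (L j + U * s) * V) ∎
        where
        lemma₁ : ∀ a b c d v → a + (b + (c + d) * v) ≡ (a + c * v) + (b + d * v)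
        lemma₁ = solve-∀
        lemma₂ : ∀ j v s u → (j + v * s) * u ≡ j * u + u * s * v
        lemma₂ = solve-∀
        lemma₃ : ∀ a b c d v → a + b + c * v + d * v ≡ a + (b + (c + d) * v)
        lemma₃ = solve-∀
    ... | inj₂ yj<yi = trans (cong (_+ (L j + U * s)) (le-> yj<yi)) (sym
        (quotient-unique (y x) (V ∸ d) (1 + (L i + L x)) (L j + U * s)
          (y<V x) (∸-monoʳ-< {V} (m<n⇒0<n∸m yj<yi) d≤V)
          (+-cancelˡ-≡ (y i + d) _ _ eq)))
      where
      open ≡-Reasoning
      d = y i ∸ y j
      d≤V : d ≤ V
      d≤V = ≤-trans (m∸n≤m (y i) (y j)) (<⇒≤ (y<V i))
      eq : y i + d + (y x + (1 + (L i + L x)) * V) ≡ y i + d + (V ∸ d + (L j + U * s) * V)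
      eq = begin
        y i + d + (y x + (1 + (L i + L x)) * V) ≡⟨ lemma₁ (y i) d (y x) (L i) (L x) V ⟩
        (y i + L i * V) + (y x + L x * V) + (d + V) ≡⟨ cong₂ (λ a b → a + b + (d + V)) (sym (split i)) (sym (split x)) ⟩
        i * U + x * U + (d + V) ≡⟨ cong (_+ (d + V)) (sym (*-distribʳ-+ U i x)) ⟩
        (i + x) * U + (d + V) ≡⟨ cong (λ t → t * U + (d + V)) i+x≡ ⟩
        (j + V * s) * U + (d + V) ≡⟨ lemma₂ j V s U (d + V) ⟩
        j * U + U * s * V + (d + V) ≡⟨ cong (λ t → t + U * s * V + (d + V)) (split j) ⟩
        y j + L j * V + U * s * V + (d + V) ≡⟨ lemma₃ (y j) d V (L j) (U * s) ⟩
        y j + d + (V + (L j + U * s) * V) ≡⟨ cong₂ (λ a b → a + (b + (L j + U * s) * V))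
                                                     (m+[n∸m]≡n (<⇒≤ yj<yi)) (sym (m+[n∸m]≡n d≤V)) ⟩
        y i + (d + (V ∸ d) + (L j + U * s) * V) ≡⟨ lemma₄ (y i) d (V ∸ d) ((L j + U * s) * V) ⟩
        y i + d + (V ∸ d + (L j + U * s) * V) ∎
        where
        lemma₁ : ∀ a d b c e v → a + d + (b + (1 + (c + e)) * v) ≡ (a + c * v) + (b + e * v) + (d + v)
        lemma₁ = solve-∀
        lemma₂ : ∀ j v s u w → (j + v * s) * u + w ≡ j * u + u * s * v + w
        lemma₂ = solve-∀
        lemma₃ : ∀ a d v l u → a + l * v + u * v + (d + v) ≡ a + d + (v + (l + u) * v)
        lemma₃ = solve-∀
        lemma₄ : ∀ a b c d → a + (b + c + d) ≡ a + b + (c + d)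
        lemma₄ = solve-∀

    -- The rank of the fractional part of jα among those of α, …, kα, where α = U/V.
    ψ : ℕ → ℕ
    ψ j = Σ< k (λ i → le (y (suc i)) (y j))

    floors : ℕ
    floors = Σ< k (L ∘ suc)

    private
      T : ℕ → ℕ
      -- Adding a multiple of the denominator keeps the fractional part of jα and makes `T j ∸ i` a
      -- genuine difference for every i ≤ K.
      T j = j + V * K

      S : ℕ → ℕ
      S j = Σ< k (λ i → L (T j ∸ suc i))

      u = U * K

      K≤T : ∀ j → K ≤ T j
      K≤T j = ≤-trans (m≤n*m K V) (m≤n+m (V * K) j)

      L-T : ∀ j → L (T j) ≡ L j + u
      L-T j = suc-injective (sym (trans (cong (_+ (L j + u)) (sym (le-≤ (subst (_≤ y j) (sym y0≡0) z≤n))))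
        (trans (carry 0 (T j) j K refl) (cong (λ t → 1 + (t + L (T j))) L0≡0))))
        where
        y0≡0 : y 0 ≡ 0
        y0≡0 = m<n⇒m%n≡m {m = 0} (>-nonZero⁻¹ V)
        L0≡0 : L 0 ≡ 0
        L0≡0 = m<n⇒m/n≡0 {m = 0} (>-nonZero⁻¹ V)

    -- The sum of `carry` over i = 1, ..., k: every comparison counted by the rank is traded for a
    -- relation between floors.
    ψ-formula : ∀ j → ψ j + k * (L j + u) ≡ k + (floors + S j)
    ψ-formula j = begin
      ψ j + k * (L j + u) ≡⟨ cong (ψ j +_) (sym (Σ<-const k (L j + u))) ⟩
      ψ j + Σ< k (λ _ → L j + u) ≡⟨ sym (Σ<-+ k (λ i → le (y (suc i)) (y j)) (λ _ → L j + u)) ⟩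
      Σ< k (λ i → le (y (suc i)) (y j) + (L j + u)) ≡⟨ Σ<-cong k (λ i i<k → carry (suc i) (T j ∸ suc i) j K
                                                                  (m+[n∸m]≡n (≤-trans (m<n⇒m<1+n i<k) (K≤T j)))) ⟩
      Σ< k (λ i → 1 + (L (suc i) + L (T j ∸ suc i))) ≡⟨ Σ<-+ k (λ _ → 1) _ ⟩
      Σ< k (λ _ → 1) + Σ< k (λ i → L (suc i) + L (T j ∸ suc i)) ≡⟨ cong₂ _+_ (trans (Σ<-const k 1) (*-identityʳ k))
                                                                  (Σ<-+ k (L ∘ suc) _) ⟩
      k + (floors + S j) ∎
      where open ≡-Reasoning

    private
      S-suc : ∀ j → S (suc j) + L (T j ∸ k) ≡ L j + u + S j
      S-suc j = trans (Σ<-head k (λ i → L (T j ∸ i))) (cong (_+ S j) (L-T j))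

    -- Modulo `K` the rank moves by `L K` or `L K + 1` when j grows by 1, so ranks perform a
    -- rotation with one break. To see this, subtract `ψ-formula` at j from that at j + 1: the
    -- windows `S` overlap except at their ends, and the leftover end is removed by `carry` for the
    -- pair `K`, `suc j`.
    ψ-suc : ∀ j → y K ≢ y (suc j) → ψ (suc j) + K * L (suc j) ≡ ψ j + K * L j + (L K + le (y (suc j)) (y K))
    ψ-suc j y≢ = +-cancelʳ-≡ rest _ _ (begin
      ψ (suc j) + K * L (suc j) + rest
        ≡⟨ lemma₁ (ψ (suc j)) k (L (suc j)) u floors (S j) (S (suc j)) X c′ ⟩
      (ψ (suc j) + k * (L (suc j) + u)) + (k + (floors + S j)) + (S (suc j) + X) + (c′ + (L (suc j) + u)) + 1
        ≡⟨ cong₂ _+_ (cong₂ _+_ (cong₂ _+_ (cong₂ _+_ (ψ-formula (suc j)) (sym (ψ-formula j))) (S-suc j))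
             (carry K (T j ∸ k) (suc j) K (cong suc (m+[n∸m]≡n (≤-trans (n≤1+n k) (K≤T j))))))
             (sym (le-total (y K) (y (suc j)) y≢)) ⟩
      (k + (floors + S (suc j))) + (ψ j + k * (L j + u)) + (L j + u + S j) + (1 + (L K + X)) + (c′ + c)
        ≡⟨ lemma₂ (ψ j) k (L j) u floors (S j) (S (suc j)) X c′ (L K) c ⟩
      ψ j + K * L j + (L K + c) + rest ∎)
      where
      open ≡-Reasoning
      X = L (T j ∸ k)
      c = le (y (suc j)) (y K)
      c′ = le (y K) (y (suc j))
      rest = k * u + k + floors + S j + S (suc j) + X + c′ + u + 1
      lemma₁ : ∀ p k l u f s s′ x c → p + (1 + k) * l + (k * u + k + f + s + s′ + x + c + u + 1) ≡
               (p + k * (l + u)) + (k + (f + s)) + (s′ + x) + (c + (l + u)) + 1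
      lemma₁ = solve-∀
      lemma₂ : ∀ p k l u f s s′ x c′ a c →
               (k + (f + s′)) + (p + k * (l + u)) + (l + u + s) + (1 + (a + x)) + (c′ + c) ≡
               p + (1 + k) * l + (a + c) + (k * u + k + f + s + s′ + x + c′ + u + 1)
      lemma₂ = solve-∀

    -- At j = `K` the window of `S` is the list of `floors` reversed. This is the source of the
    -- position 2F + k - w: `L K` becomes the `a` of `Loops`, and `ψ K` lowered by w becomes its
    -- `r`.
    ψ-K : ψ K + k * L K ≡ k + (floors + floors)
    ψ-K = +-cancelʳ-≡ (k * u) _ _ (begin
      ψ K + k * L K + k * u ≡⟨ lemma (ψ K) k (L K) u ⟩
      ψ K + k * (L K + u) ≡⟨ ψ-formula K ⟩
      k + (floors + S K) ≡⟨ cong (λ t → k + (floors + t)) S-K ⟩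
      k + (floors + (floors + k * u)) ≡⟨ lemma′ k floors (k * u) ⟩
      k + (floors + floors) + k * u ∎)
      where
      open ≡-Reasoning
      lemma : ∀ p k l u → p + k * l + k * u ≡ p + k * (l + u)
      lemma = solve-∀
      lemma′ : ∀ k f u → k + (f + (f + u)) ≡ k + (f + f) + u
      lemma′ = solve-∀
      S-K : S K ≡ floors + k * u
      S-K = begin
        Σ< k (λ i → L (k + V * K ∸ i)) ≡⟨ Σ<-cong k (λ i i<k → trans
                                                           (cong L (trans (cong (_∸ i) (+-comm k (V * K))) (trans (+-∸-assoc (V * K) (<⇒≤ i<k)) (+-comm (V * K) (k ∸ i)))))
                                                           (trans (L-T (k ∸ i)) (cong (λ t → L t + u) (+-∸-assoc 1 {n = k} {o = suc i} i<k)))) ⟩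
        Σ< k (λ i → L (suc (k ∸ suc i)) + u) ≡⟨ Σ<-+ k _ _ ⟩
        Σ< k (λ i → L (suc (k ∸ suc i))) + Σ< k (λ _ → u) ≡⟨ cong₂ _+_ (Σ<-reverse k (L ∘ suc)) (Σ<-const k u) ⟩
        floors + k * u ∎

-- Closed loops of the partial rotation and their reflection.

module Orbits where
  open import Data.Nat
  open import Data.Nat.Properties
  open import Data.Nat.DivMod
  open import Data.Nat.Divisibility
  open import Data.Nat.Coprimality using (Coprime; coprime-divisor)
  import Data.Nat.Coprimality as C
  open import Data.Nat.Tactic.RingSolver using (solve-∀)
  open import Data.Sum using (inj₁; inj₂)
  open import Data.Product using (_×_; _,_; ∃; ∃₂; proj₁; proj₂)
  open import Relation.Binary.PropositionalEquality
  open import Relation.Binary.Definitions using (tri<; tri≈; tri>)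
  open import Relation.Nullary using (contradiction)
  open import Function.Base using (_∘_)
  open NatSum
  open Rotation

  infix 4 _≈_[mod_]

  _≈_[mod_] : ℕ → ℕ → ℕ → Set
  x ≈ y [mod K ] = ∃₂ λ s t → x + s * K ≡ y + t * K

  -- As k is -1 modulo k + 1, this subtracts a + 1 or a. The multiple of k is kept because it is
  -- what the kernel conditions produce when m = k a + r, and because it needs no subtraction.
  Step : (k a r σ τ : ℕ) → Set
  Step k a r σ τ = (σ ≤ r → σ + suc a * k ≈ τ [mod suc k ]) × (r < σ → σ + a * k ≈ τ [mod suc k ])

  -- The orbits of a partial rotation of {0, …, k}, listed by φ: w closed loops of length q, then
  -- a path which ends at 0.
  record Loops (k m q w : ℕ) : Set where
    field
      a r   : ℕ
      r≤k   : r ≤ k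
      m≡    : m ≡ k * a + r
      w*q≤k : w * q ≤ k
      φ     : ℕ → ℕ
      φ≤k   : ∀ i → i ≤ k → φ i ≤ k
      φ-injective : ∀ i j → i ≤ k → j ≤ k → φ i ≡ φ j → i ≡ j
      φ-k   : φ k ≡ 0
      along : ∀ i → i < k → (∀ t → t ≤ w → suc i ≢ t * q) → Step k a r (φ i) (φ (suc i))
      close : ∀ t i → t < w → suc i ≡ suc t * q → Step k a r (φ i) (φ (t * q))

  module Slope (k p q : ℕ) .{{_ : NonZero q}} (q≤k : q ≤ k) (coprime : Coprime p q) where
    M = 2 + k
    -- The slope p/q is raised by 1/(qM) to separate the multiples of p/q, without changing any floor.
    open Ranks k (p * M + 1) (q * M) {{m*n≢0 q M}} public

    K<M : K < M
    K<M = n<1+n K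

    private
      e : ℕ → ℕ
      e x = x * p % q

      remainder< : ∀ x → x < M → e x * M + x < q * M
      remainder< x x<M = <-≤-trans (+-monoʳ-< (e x * M) x<M)
        (≤-trans (≤-reflexive (+-comm (e x * M) M)) (*-monoˡ-≤ M (m%n<n (x * p) q)))

      decompose : ∀ x → x * (p * M + 1) ≡ e x * M + x + x * p / q * (q * M)
      decompose x = begin
        x * (p * M + 1) ≡⟨ lemma x p M ⟩
        x * p * M + x ≡⟨ cong (λ t → t * M + x) (m≡m%n+[m/n]*n (x * p) q) ⟩
        (e x + x * p / q * q) * M + x ≡⟨ lemma′ (e x) (x * p / q) q M x ⟩
        e x * M + x + x * p / q * (q * M) ∎
        where
        open ≡-Reasoning
        lemma : ∀ x p m → x * (p * m + 1) ≡ x * p * m + x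
        lemma = solve-∀
        lemma′ : ∀ e l q m x → (e + l * q) * m + x ≡ e * m + x + l * (q * m)
        lemma′ = solve-∀

    -- Below `M` the order of the values of `y` is therefore lexicographic: first the residue of xp
    -- modulo q, then x itself, which breaks every tie.
    y≡ : ∀ x → x < M → y x ≡ e x * M + x
    y≡ x x<M = %-unique {{m*n≢0 q M}} (x * (p * M + 1)) (e x * M + x) (x * p / q) (remainder< x x<M) (decompose x)

    L≡ : ∀ x → x < M → L x ≡ x * p / q
    L≡ x x<M = /-unique {{m*n≢0 q M}} (x * (p * M + 1)) (e x * M + x) (x * p / q) (remainder< x x<M) (decompose x)

    private
      lex : ∀ {x x′} → x < M → x′ < M → y x ≡ y x′ → x ≡ x′
      lex {x} {x′} x<M x′<M eq = +-cancelˡ-≡ (e x * M) x x′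
        (trans eq′ (cong (λ t → t * M + x′) (sym (quotient-unique x x′ (e x) (e x′) x<M x′<M
          (trans (+-comm x (e x * M)) (trans eq′ (+-comm (e x′ * M) x′)))))))
        where
        eq′ : e x * M + x ≡ e x′ * M + x′
        eq′ = trans (sym (y≡ x x<M)) (trans eq (y≡ x′ x′<M))

      multiple : ∀ i d → e (i + d) ≡ e i → q ∣ d
      multiple i d eq = coprime-divisor (C.sym coprime) (subst (q ∣_) (*-comm d p) (∣m+n∣m⇒∣n {m = i * p / q * q} {n = d * p}
        (divides ((i + d) * p / q) (+-cancelˡ-≡ (e i) _ _ eq′)) (n∣m*n (i * p / q))))
        where
        open ≡-Reasoning
        eq′ : e i + (i * p / q * q + d * p) ≡ e i + (i + d) * p / q * q
        eq′ = begin
          e i + (i * p / q * q + d * p) ≡⟨ sym (+-assoc (e i) _ _) ⟩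
          e i + i * p / q * q + d * p ≡⟨ cong (_+ d * p) (sym (m≡m%n+[m/n]*n (i * p) q)) ⟩
          i * p + d * p ≡⟨ sym (*-distribʳ-+ p i d) ⟩
          (i + d) * p ≡⟨ m≡m%n+[m/n]*n ((i + d) * p) q ⟩
          e (i + d) + (i + d) * p / q * q ≡⟨ cong (_+ (i + d) * p / q * q) eq ⟩
          e i + (i + d) * p / q * q ∎

      e-+q : ∀ j → e (j + q) ≡ e j
      e-+q j = trans (cong (_% q) (trans (*-distribʳ-+ p j q) (cong (j * p +_) (*-comm q p)))) ([m+kn]%n≡m%n (j * p) p q)

      y-+q : ∀ j → j + q < M → y (j + q) ≡ y j + q
      y-+q j j+q<M = begin
        y (j + q) ≡⟨ y≡ (j + q) j+q<M ⟩
        e (j + q) * M + (j + q) ≡⟨ cong (λ t → t * M + (j + q)) (e-+q j) ⟩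
        e j * M + (j + q) ≡⟨ sym (+-assoc (e j * M) j q) ⟩
        e j * M + j + q ≡⟨ cong (_+ q) (sym (y≡ j (m+n≤o⇒m≤o (suc j) j+q<M))) ⟩
        y j + q ∎
        where open ≡-Reasoning

      -- A larger residue `e` would cost at least `M`, more than j + q allows, so i and j have the
      -- same residue. Their distance is then a positive multiple of q, and it is at most q.
      gap : ∀ i j → i < M → j + q < M → y j < y i → y i ≤ y j + q → i ≡ j + q
      gap i j i<M j+q<M yj<yi yi≤ = ≤-antisym i≤ (subst (j + q ≤_) (m+[n∸m]≡n (<⇒≤ j<i))
        (+-monoʳ-≤ j (∣⇒≤ {{>-nonZero (m<n⇒0<n∸m j<i)}} (multiple j (i ∸ j) (trans (cong e (m+[n∸m]≡n (<⇒≤ j<i))) (sym same))))))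
        where
        j<M = m+n≤o⇒m≤o (suc j) j+q<M
        lt : e j * M + j < e i * M + i
        lt = subst₂ _<_ (y≡ j j<M) (y≡ i i<M) yj<yi
        le′ : e i * M + i ≤ e j * M + (j + q)
        le′ = subst₂ _≤_ (y≡ i i<M) (trans (cong (_+ q) (y≡ j j<M)) (+-assoc (e j * M) j q)) yi≤
        same : e j ≡ e i
        same = ≤-antisym
          (≮⇒≥ λ ei<ej → <⇒≱ lt (≤-trans (+-monoʳ-≤ (e i * M) (<⇒≤ i<M))
            (≤-trans (≤-reflexive (+-comm (e i * M) M)) (≤-trans (*-monoˡ-≤ M ei<ej) (m≤m+n _ j)))))
          (≮⇒≥ λ ej<ei → <⇒≱ (<-≤-trans (+-monoʳ-< (e j * M) j+q<M)
            (≤-trans (≤-reflexive (+-comm (e j * M) M)) (≤-trans (*-monoˡ-≤ M ej<ei) (m≤m+n _ i)))) le′)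
        j<i : j < i
        j<i = +-cancelˡ-< (e j * M) j i (subst (λ t → e j * M + j < t * M + i) (sym same) lt)
        i≤ : i ≤ j + q
        i≤ = +-cancelˡ-≤ (e j * M) i (j + q) (subst (λ t → t * M + i ≤ e j * M + (j + q)) (sym same) le′)

      1+i<M : ∀ {i} → i < k → suc i < M
      1+i<M i<k = s≤s (m<n⇒m<1+n i<k)

      others : ∀ i j → i < M → j + q < M → i ≢ j + q → le (y i) (y (j + q)) ≡ le (y i) (y j)
      others i j i<M j+q<M i≢ with ≤-<-connex (y i) (y j)
      ... | inj₁ yi≤yj = trans (le-≤ (≤-trans yi≤yj (≤-trans (m≤m+n (y j) q) (≤-reflexive (sym (y-+q j j+q<M)))))) (sym (le-≤ yi≤yj))
      ... | inj₂ yj<yi with ≤-<-connex (y i) (y (j + q))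
      ...   | inj₁ yi≤ = contradiction (gap i j i<M j+q<M yj<yi (subst (y i ≤_) (y-+q j j+q<M) yi≤)) i≢
      ...   | inj₂ <yi = trans (le-> <yi) (sym (le-> yj<yi))

    y-mono⇒ψ-mono : ∀ {i j} → y i ≤ y j → ψ i ≤ ψ j
    y-mono⇒ψ-mono yi≤yj = Σ<-mono k (λ l _ → le-mono (y (suc l)) yi≤yj)

    ψ-< : ∀ i j → j < k → y i < y (suc j) → ψ i < ψ (suc j)
    ψ-< i j j<k yi<yj = Σ<-mono-< k j j<k (λ l _ → le-mono (y (suc l)) (<⇒≤ yi<yj))
      (subst₂ _<_ (sym (le-> yi<yj)) (sym (le-≤ {y (suc j)} ≤-refl)) (s≤s z≤n))

    y-K≢ : ∀ j → j < k → y K ≢ y (suc j)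
    y-K≢ j j<k eq = <⇒≢ (s≤s j<k) (sym (lex K<M (1+i<M j<k) eq))

    ψ≤k : ∀ j → ψ j ≤ k
    ψ≤k j = Σ<-≤ k _ (λ i _ → le≤1 (y (suc i)) (y j))

    private
      y0≡0 : y 0 ≡ 0
      y0≡0 = trans (y≡ 0 (s≤s z≤n)) (trans (+-identityʳ (e 0 * M)) (cong (_* M) (m<n⇒m%n≡m {m = 0} (>-nonZero⁻¹ q))))

    0<y : ∀ i → i < k → 0 < y (suc i)
    0<y i i<k = n≢0⇒n>0 λ eq → contradiction (lex (1+i<M i<k) (s≤s z≤n) (trans eq (sym y0≡0))) λ ()

    ψ-0 : ψ 0 ≡ 0
    ψ-0 = trans (Σ<-cong k (λ i i<k → le-> (subst (_< y (suc i)) (sym y0≡0) (0<y i i<k)))) (Σ<-0 k)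

    ψ-injective : ∀ i j → i ≤ k → j ≤ k → ψ i ≡ ψ j → i ≡ j
    ψ-injective zero    zero    _   _   eq = refl
    ψ-injective zero    (suc j) i≤k j≤k eq = contradiction eq (<⇒≢ (ψ-< 0 j j≤k (subst (_< y (suc j)) (sym y0≡0) (0<y j j≤k))))
    ψ-injective (suc i) zero    i≤k j≤k eq = contradiction (sym eq) (<⇒≢ (ψ-< 0 i i≤k (subst (_< y (suc i)) (sym y0≡0) (0<y i i≤k))))
    ψ-injective (suc i) (suc j) i≤k j≤k eq with <-cmp (y (suc i)) (y (suc j))
    ... | tri< lt _ _ = contradiction eq (<⇒≢ (ψ-< (suc i) j j≤k lt))
    ... | tri≈ _ yi≡yj _ = lex (1+i<M i≤k) (1+i<M j≤k) yi≡yj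
    ... | tri> _ _ gt = contradiction (sym eq) (<⇒≢ (ψ-< (suc j) i i≤k gt))

    -- By `gap` no multiple lies between j and j + q, so the two ranks differ only by counting j + q
    -- itself.
    ψ-+q : ∀ j → j + q ≤ k → ψ (j + q) ≡ suc (ψ j)
    ψ-+q j j+q≤k = Σ<-suc-at k (pred (j + q)) (subst (_≤ k) (sym s) j+q≤k)
      (trans (trans (cong (λ t → le (y t) (y (j + q))) s) (le-≤ {y (j + q)} ≤-refl))
        (cong suc (sym (trans (cong (λ t → le (y t) (y j)) s) (le-> yj<)))))
      (λ l l<k l≢ → others (suc l) j (1+i<M l<k) j+q<M λ eq → l≢ (cong pred eq))
      where
      j+q<M = s≤s (m≤n⇒m≤1+n j+q≤k)
      s : suc (pred (j + q)) ≡ j + q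
      s = suc-pred (j + q) {{>-nonZero (≤-trans (>-nonZero⁻¹ q) (m≤n+m q j))}}
      yj< : y j < y (j + q)
      yj< = subst (y j <_) (sym (y-+q j j+q<M)) (m<m+n (y j) (>-nonZero⁻¹ q))

    r = ψ K

    -- `K` directly follows `K ∸ q` in the order but is not among the k multiples that are ranked,
    -- so it adds nothing.
    ψ-K∸q : ψ (K ∸ q) ≡ r
    ψ-K∸q = trans (sym (Σ<-cong k λ i i<k → others (suc i) (K ∸ q) (1+i<M i<k) (subst (_< M) (sym eq) K<M)
      (λ eq′ → <⇒≢ (s≤s i<k) (trans eq′ eq)))) (cong ψ eq)
      where eq = m∸n+n≡m (m≤n⇒m≤1+n q≤k)

    -- The points K - q, K - 2q, ... fill the ranks r, r - 1, ... just below the break; lowering the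
    -- break by w passes over exactly the first w of them.
    ψ-K∸ : ∀ t → suc t * q ≤ k → ψ (K ∸ suc t * q) + t ≡ r
    ψ-K∸ zero    q≤k  = trans (+-identityʳ _) (trans (cong (λ t → ψ (K ∸ t)) (+-identityʳ q)) ψ-K∸q)
    ψ-K∸ (suc t) tq≤k = begin
      ψ j + suc t ≡⟨ +-suc (ψ j) t ⟩
      suc (ψ j) + t ≡⟨ cong (_+ t) (sym (ψ-+q j (subst (_≤ k) (sym j+q≡) (∸-monoʳ-≤ {suc zero} K (≤-trans (>-nonZero⁻¹ q) (m≤m+n q (t * q))))))) ⟩
      ψ (j + q) + t ≡⟨ cong (λ i → ψ i + t) j+q≡ ⟩
      ψ (K ∸ suc t * q) + t ≡⟨ ψ-K∸ t (m+n≤o⇒n≤o q tq≤k) ⟩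
      r ∎
      where
      open ≡-Reasoning
      j = K ∸ suc (suc t) * q
      j+q≡ : j + q ≡ K ∸ suc t * q
      j+q≡ = trans (cong (_+ q) (trans (cong (K ∸_) (+-comm q (suc t * q))) (sym (∸-+-assoc K (suc t * q) q))))
        (m∸n+n≡m (m+n≤o⇒m≤o∸n q (m≤n⇒m≤1+n tq≤k)))

    -- `ψ-suc` read backwards. The comparison of `y (suc j)` with `y K` is the comparison of the
    -- rank with r, because ranks are monotone in `y`.
    ψ-step : ∀ j → j < k → Step k (L K) r (ψ (suc j)) (ψ j)
    ψ-step j j<k = (λ ≤r → step (suc (L K)) (trans (cong (L K +_) (le-≤ {y (suc j)} {y K} (≮⇒≥ λ < → <⇒≱ (ψ-< K j j<k <) ≤r))) (+-comm (L K) 1)))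
                 , (λ r< → step (L K) (trans (cong (L K +_) (le-> {y (suc j)} {y K} (≰⇒> λ ≤ → <⇒≱ r< (y-mono⇒ψ-mono {suc j} {K} ≤)))) (+-identityʳ (L K))))
      where
      step : ∀ a → L K + le (y (suc j)) (y K) ≡ a → ψ (suc j) + a * k ≈ ψ j [mod K ]
      step a refl = L (suc j) , L j + a , (begin
        ψ (suc j) + a * k + L (suc j) * K ≡⟨ lemma (ψ (suc j)) a k (L (suc j)) ⟩
        ψ (suc j) + K * L (suc j) + a * k ≡⟨ cong (_+ a * k) (ψ-suc j (y-K≢ j j<k)) ⟩
        ψ j + K * L j + a + a * k ≡⟨ lemma′ (ψ j) a k (L j) ⟩
        ψ j + (L j + a) * K ∎)
        where
        open ≡-Reasoning
        lemma : ∀ p a k l → p + a * k + l * (1 + k) ≡ p + (1 + k) * l + a * k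
        lemma = solve-∀
        lemma′ : ∀ p a k l → p + (1 + k) * l + a + a * k ≡ p + (l + a) * (1 + k)
        lemma′ = solve-∀

    module _ (w : ℕ) (w*q≤k : w * q ≤ k) where
      private
        w≤r : w ≤ r
        w≤r = bound w w*q≤k
          where
          bound : ∀ w → w * q ≤ k → w ≤ r
          bound zero    _  = z≤n
          bound (suc t) tq = ≤-trans (+-monoˡ-≤ t {1} (n≢0⇒n>0 λ eq → contradiction
            (ψ-injective (K ∸ suc t * q) 0 (∸-monoʳ-≤ {suc zero} K (≤-trans (>-nonZero⁻¹ q) (m≤m+n q (t * q)))) z≤n (trans eq (sym ψ-0)))
            (m>n⇒m∸n≢0 (s≤s tq)))) (≤-reflexive (ψ-K∸ t tq))

        r′ = r ∸ w

        complement : ∀ {i} → i < k → suc (k ∸ suc i) ≡ k ∸ i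
        complement {i} i<k = sym (+-∸-assoc 1 {n = k} {o = suc i} i<k)

        step′ : ∀ i → i < k → Step k (L K) r (ψ (k ∸ i)) (ψ (k ∸ suc i))
        step′ i i<k = subst (λ t → Step k (L K) r (ψ t) (ψ (k ∸ suc i))) (complement i<k)
          (ψ-step (k ∸ suc i) (subst (_≤ k) (sym (complement i<k)) (m∸n≤m k i)))

        -- Breaks at r and at r - w give different steps only for ranks above r - w and at most r.
        -- By `ψ-K∸` such a rank forces i + 1 = (t + 1) q with t < w, which is excluded.
        along : ∀ i → i < k → (∀ t → t ≤ w → suc i ≢ t * q) → Step k (L K) r′ (ψ (k ∸ i)) (ψ (k ∸ suc i))
        along i i<k i≢ = (λ ≤r′ → proj₁ (step′ i i<k) (≤-trans ≤r′ (m∸n≤m r w))) , λ r′< → proj₂ (step′ i i<k) (≰⇒> λ ≤r →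
          let t  = r ∸ ψ (k ∸ i)
              t<w : t < w
              t<w = +-cancelˡ-< (ψ (k ∸ i)) t w (<-≤-trans (≤-<-trans (≤-reflexive (m+[n∸m]≡n ≤r)) (n<1+n r))
                (≤-trans (s≤s (m≤n+m∸n r w)) (≤-trans (≤-reflexive (sym (+-suc w r′))) (≤-trans (+-monoʳ-≤ w r′<) (≤-reflexive (+-comm w (ψ (k ∸ i))))))))
              tq≤k : suc t * q ≤ k
              tq≤k = ≤-trans (*-monoˡ-≤ q t<w) w*q≤k
              ψ≡ : ψ (k ∸ i) ≡ ψ (K ∸ suc t * q)
              ψ≡ = +-cancelʳ-≡ t _ _ (trans (m+[n∸m]≡n ≤r) (sym (ψ-K∸ t tq≤k)))
              k∸i≡ : k ∸ i ≡ K ∸ suc t * q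
              k∸i≡ = ψ-injective (k ∸ i) (K ∸ suc t * q) (m∸n≤m k i)
                (∸-monoʳ-≤ {suc zero} K (≤-trans (>-nonZero⁻¹ q) (m≤m+n q (t * q)))) ψ≡
          in i≢ (suc t) t<w (∸-cancelˡ-≡ (s≤s (<⇒≤ i<k)) (m≤n⇒m≤1+n tq≤k) k∸i≡))

        -- Here the lowered break makes the step subtract one less, so it lands one rank above the
        -- old image. By `ψ-+q` that is the rank of the index q higher, where the loop began.
        close : ∀ t i → t < w → suc i ≡ suc t * q → Step k (L K) r′ (ψ (k ∸ i)) (ψ (k ∸ t * q))
        close t i t<w 1+i≡ = (λ ≤r′ → contradiction ≤r′ (<⇒≱ r′<)) , λ _ → subst (λ z → ψ (k ∸ i) + L K * k ≈ z [mod K ]) ψ≡ (shift {ψ (k ∸ i)} {ψ (k ∸ suc i)} {L K} (proj₁ (step′ i i<k) ≤r))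
          where
          tq≤k : suc t * q ≤ k
          tq≤k = ≤-trans (*-monoˡ-≤ q t<w) w*q≤k
          i<k : i < k
          i<k = subst (_≤ k) (sym 1+i≡) tq≤k
          ψ+t : ψ (k ∸ i) + t ≡ r
          ψ+t = trans (cong (λ z → ψ (K ∸ z) + t) 1+i≡) (ψ-K∸ t tq≤k)
          ≤r : ψ (k ∸ i) ≤ r
          ≤r = m+n≤o⇒m≤o (ψ (k ∸ i)) (≤-reflexive ψ+t)
          r′< : r′ < ψ (k ∸ i)
          r′< = subst (r′ <_) (trans (cong (_∸ t) (sym ψ+t)) (m+n∸n≡m (ψ (k ∸ i)) t)) (∸-monoʳ-< t<w w≤r)
          j+q≡ : k ∸ suc i + q ≡ k ∸ t * q
          j+q≡ = trans (cong (λ z → k ∸ z + q) (trans 1+i≡ (+-comm q (t * q)))) (trans (cong (_+ q) (sym (∸-+-assoc k (t * q) q)))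
            (m∸n+n≡m (m+n≤o⇒m≤o∸n q tq≤k)))
          ψ≡ : suc (ψ (k ∸ suc i)) ≡ ψ (k ∸ t * q)
          ψ≡ = trans (sym (ψ-+q (k ∸ suc i) (subst (_≤ k) (sym j+q≡) (m∸n≤m k (t * q))))) (cong ψ j+q≡)
          shift : ∀ {σ τ a} → σ + suc a * k ≈ τ [mod K ] → σ + a * k ≈ suc τ [mod K ]
          shift {σ} {τ} {a} (s , t , eq) = suc s , t , trans (lemma σ a k s) (cong suc eq)
            where
            lemma : ∀ σ a k s → σ + a * k + suc s * suc k ≡ suc (σ + suc a * k + s * suc k)
            lemma = solve-∀

      rightLoops : ∀ m → m + w ≡ k + (floors + floors) → Loops k m q w
      rightLoops m m+w≡ = record
        { a = L K ; r = r′ ; r≤k = ≤-trans (m∸n≤m r w) (ψ≤k K)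
        ; m≡ = +-cancelʳ-≡ w _ _ (begin
            m + w ≡⟨ m+w≡ ⟩
            k + (floors + floors) ≡⟨ sym ψ-K ⟩
            r + k * L K ≡⟨ cong (_+ k * L K) (sym (m∸n+n≡m w≤r)) ⟩
            r′ + w + k * L K ≡⟨ lemma r′ w (k * L K) ⟩
            k * L K + r′ + w ∎)
        ; w*q≤k = w*q≤k
        ; φ = λ i → ψ (k ∸ i) ; φ≤k = λ i _ → ψ≤k (k ∸ i)
        ; φ-injective = λ i j i≤k j≤k eq → ∸-cancelˡ-≡ i≤k j≤k (ψ-injective (k ∸ i) (k ∸ j) (m∸n≤m k i) (m∸n≤m k j) eq)
        ; φ-k = trans (cong ψ (n∸n≡0 k)) ψ-0
        ; along = along ; close = close }
        where
        open ≡-Reasoning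
        lemma : ∀ r w l → r + w + l ≡ l + r + w
        lemma = solve-∀

  negate : ℕ → ℕ → ℕ
  negate k zero    = 0
  negate k (suc x) = k ∸ x

  negate-≈ : ∀ {k x} → x ≤ k → ∃ λ s → x + negate k x ≡ s * suc k
  negate-≈ {k} {zero}  _   = 0 , refl
  negate-≈ {k} {suc x} x<k = 1 , cong suc (trans (m+[n∸m]≡n (<⇒≤ x<k)) (sym (+-identityʳ k)))

  negate-injective : ∀ {k} x y → x ≤ k → y ≤ k → negate k x ≡ negate k y → x ≡ y
  negate-injective zero    zero    _   _   _  = refl
  negate-injective zero    (suc y) _   y<k eq = contradiction (sym eq) (m>n⇒m∸n≢0 y<k)
  negate-injective (suc x) zero    x<k _   eq = contradiction eq (m>n⇒m∸n≢0 x<k)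
  negate-injective (suc x) (suc y) x<k y<k eq = cong suc (∸-cancelˡ-≡ (<⇒≤ x<k) (<⇒≤ y<k) eq)

  negate-≤ : ∀ k x → negate k x ≤ k
  negate-≤ k zero    = z≤n
  negate-≤ k (suc x) = m∸n≤m k x

  -- Conjugation by σ ↦ -σ modulo k + 1. It exchanges the two cases of `Step`, which requires σ ≠ 0;
  -- this holds because only the last index is sent to 0.
  reflectLoops : ∀ {k m q w} m′ → 0 < m′ → m + m′ ≡ k * suc k → Loops k m q w → Loops k m′ q w
  reflectLoops {k} {m} {q} {w} m′ 0<m′ sum≡ loops = record
    { a = k ∸ a ; r = k ∸ r ; r≤k = m∸n≤m k r
    ; m≡ = +-cancelˡ-≡ m _ _ (trans sum≡ (sym (begin
        m + (k * (k ∸ a) + (k ∸ r)) ≡⟨ cong (_+ (k * (k ∸ a) + (k ∸ r))) m≡ ⟩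
        k * a + r + (k * (k ∸ a) + (k ∸ r)) ≡⟨ lemma k a r (k ∸ a) (k ∸ r) ⟩
        k * (a + (k ∸ a)) + (r + (k ∸ r)) ≡⟨ cong₂ (λ x y → k * x + y) (m+[n∸m]≡n a≤k) (m+[n∸m]≡n r≤k) ⟩
        k * k + k ≡⟨ trans (+-comm (k * k) k) (sym (*-suc k k)) ⟩
        k * suc k ∎)))
    ; w*q≤k = w*q≤k
    ; φ = negate k ∘ φ ; φ≤k = λ i _ → negate-≤ k (φ i)
    ; φ-injective = λ i j i≤k j≤k eq → φ-injective i j i≤k j≤k (negate-injective (φ i) (φ j) (φ≤k i i≤k) (φ≤k j j≤k) eq)
    ; φ-k = cong (negate k) φ-k
    ; along = λ i i<k i≢ → negate-step i<k (φ≤k (suc i) i<k) (along i i<k i≢)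
    ; close = λ t i t<w 1+i≡ → let tq≤k = ≤-trans (*-monoˡ-≤ q t<w) w*q≤k in
        negate-step (subst (_≤ k) (sym 1+i≡) tq≤k) (φ≤k (t * q) (m+n≤o⇒n≤o q tq≤k)) (close t i t<w 1+i≡) }
    where
    open Loops loops
    open ≡-Reasoning
    lemma : ∀ k a r b s → k * a + r + (k * b + s) ≡ k * (a + b) + (r + s)
    lemma = solve-∀
    -- Positivity of `m′` rules out a = k + 1.
    a≤k : a ≤ k
    a≤k = s≤s⁻¹ (*-cancelˡ-< k a (suc k) (≤-<-trans (≤-trans (m≤m+n (k * a) r) (≤-reflexive (sym m≡)))
      (<-≤-trans (m<m+n m 0<m′) (≤-reflexive sum≡))))

    negate-step : ∀ {i τ} → i < k → τ ≤ k → Step k a r (φ i) τ → Step k (k ∸ a) (k ∸ r) (negate k (φ i)) (negate k τ)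
    negate-step {i} {τ} i<k τ≤k (low , high) with φ i in φi≡ | φ≤k i (<⇒≤ i<k)
    ... | zero  | _ = contradiction (φ-injective i k (<⇒≤ i<k) ≤-refl (trans φi≡ (sym φ-k))) (<⇒≢ i<k)
    ... | suc σ | σ<k =
        (λ ≤k∸r → negated (high (s≤s (≮⇒≥ λ σ<r → <⇒≱ (∸-monoʳ-< σ<r r≤k) ≤k∸r))) a (suc (k ∸ a)) (trans (+-suc a (k ∸ a)) (cong suc (m+[n∸m]≡n a≤k))))
      , (λ k∸r< → negated (low (≰⇒> λ r≤σ → <⇒≱ k∸r< (∸-monoʳ-≤ k r≤σ))) (suc a) (k ∸ a) (cong suc (m+[n∸m]≡n a≤k)))
      where
      -- Modulo k + 1, adding c k subtracts c, hence adds b: the original step with its sign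
      -- changed.
      negated : ∀ {a} → suc σ + a * k ≈ τ [mod suc k ] → ∀ b c → b + c ≡ suc k → {{a ≡ b}} → (k ∸ σ) + c * k ≈ negate k τ [mod suc k ]
      negated {a} (s , t , eq) b c b+c≡ {{refl}} with negate-≈ {k} {τ} τ≤k
      ... | v , τ+≡ = v + t , 1 + k + s , +-cancelˡ-≡ (suc σ + a * k + τ) _ _ (begin
        suc σ + a * k + τ + (k ∸ σ + c * k + (v + t) * suc k) ≡⟨ lemma₁ σ a k τ (k ∸ σ) c v t ⟩
        suc (σ + (k ∸ σ)) + (a + c) * k + (τ + t * suc k) + v * suc k ≡⟨ cong₂ _+_ (cong₂ _+_ (cong₂ (λ x y → suc x + y * k) (m+[n∸m]≡n (<⇒≤ σ<k)) b+c≡) (sym eq)) (sym τ+≡) ⟩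
        suc k + suc k * k + (suc σ + a * k + s * suc k) + (τ + negate k τ) ≡⟨ lemma₂ σ a k τ (negate k τ) s ⟩
        suc σ + a * k + τ + (negate k τ + (1 + k + s) * suc k) ∎)
        where
        lemma₁ : ∀ σ a k τ u c v t → suc σ + a * k + τ + (u + c * k + (v + t) * suc k) ≡ suc (σ + u) + (a + c) * k + (τ + t * suc k) + v * suc k
        lemma₁ = solve-∀
        lemma₂ : ∀ σ a k τ u s → suc k + suc k * k + (suc σ + a * k + s * suc k) + (τ + u) ≡ suc σ + a * k + τ + (u + (1 + k + s) * suc k)
        lemma₂ = solve-∀

-- Invariance of dimension over ℚ.

module LinAlg where
  open import Algebra.Bundles using (CommutativeRing)
  open import Data.Empty using (⊥)
  open import Data.Fin.Base using (Fin; zero; suc)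
  open import Data.Fin.Properties using (any?)
  open import Data.Maybe.Base using (Maybe; just; nothing)
  open import Data.Nat.Base as ℕ using (ℕ; zero; suc)
  import Data.Nat.Properties as ℕₚ
  open import Data.Product using (_,_; ∃; proj₁; proj₂)
  open import Data.Rational
  open import Data.Rational.Properties
  open import Data.Vec.Functional using (Vector)
  open import Function.Base using (_∘_)
  open import Level using (0ℓ)
  open import Relation.Binary.PropositionalEquality
  open import Relation.Nullary using (yes; no; ¬?; contradiction)
  open import Tactic.RingSolver.Core.AlmostCommutativeRing using (AlmostCommutativeRing; fromCommutativeRing)
  open import Tactic.RingSolver using (solve-∀)
  open import Algebra.Properties.Semiring.Sum (CommutativeRing.semiring +-*-commutativeRing)
    using (sum; sum-cong-≋; ∑-comm; *-distribˡ-sum)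
  open import Defs using (Matrix; Kernel; linComb; IsBasis; unit; _∙_; kernelBasis; nullity; sum-zero)

  ℚ-ring : AlmostCommutativeRing 0ℓ 0ℓ
  ℚ-ring = fromCommutativeRing +-*-commutativeRing zero?
    where
    zero? : ∀ x → Maybe (0ℚ ≡ x)
    zero? x with 0ℚ ≟ x
    ... | yes eq = just eq
    ... | no _   = nothing

  -- Each row processed by the elimination removes at most one basis vector.
  nullity-≥ : ∀ {m n} (A : Matrix m n) → n ℕ.≤ m ℕ.+ nullity A
  nullity-≥ {zero}  A = ℕₚ.≤-refl
  nullity-≥ {suc m} {n} A with kernelBasis (A ∘ suc) | nullity-≥ (A ∘ suc)
  ... | d , b , isBasis | n≤m+d with any? (λ i → ¬? (A zero ∙ b i ≟ 0ℚ))
  ...   | no _ = ℕₚ.m≤n⇒m≤1+n n≤m+d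
  nullity-≥ {suc m} {n} A | suc d , b , isBasis | n≤m+d | yes _ = subst (n ℕ.≤_) (ℕₚ.+-suc m d) n≤m+d

  unit-diagonal : ∀ {n} (i : Fin n) → unit i i ≡ 1ℚ
  unit-diagonal zero    = refl
  unit-diagonal (suc i) = unit-diagonal i

  -- If d < d′, the d by d′ matrix `C` of coefficients of b′ with respect to b has a nonzero kernel
  -- vector by `nullity-≥`, and this vector is a linear relation among the b′.
  independent-≤ : ∀ {d d′ n} {S : Vector ℚ n → Set} {b : Vector (Vector ℚ n) d} {b′ : Vector (Vector ℚ n) d′} →
                  IsBasis S b → IsBasis S b′ → d′ ℕ.≤ d
  independent-≤ {d} {d′} {n} {S} {b} {b′} isB isB′ = ℕₚ.≮⇒≥ λ d<d′ → absurd (ℕₚ.+-cancelˡ-≤ d 1 _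
    (ℕₚ.≤-trans (ℕₚ.≤-reflexive (ℕₚ.+-comm d 1)) (ℕₚ.≤-trans d<d′ (nullity-≥ C)))) (proj₂ (proj₂ (kernelBasis C)))
    where
    open IsBasis
    coefficients : ∀ i → ∃ λ c → ∀ j → b′ i j ≡ linComb c b j
    coefficients i = spanning isB (b′ i) (members isB′ i)
    C : Matrix d d′
    C l i = proj₁ (coefficients i) l
    open ≡-Reasoning

    vanish : ∀ x → Kernel C x → ∀ j → linComb x b′ j ≡ 0ℚ
    vanish x x∈ j = begin
      sum (λ i → x i * b′ i j) ≡⟨ sum-cong-≋ (λ i → cong (x i *_) (proj₂ (coefficients i) j)) ⟩
      sum (λ i → x i * sum (λ l → C l i * b l j)) ≡⟨ sum-cong-≋ (λ i → *-distribˡ-sum (x i) (λ l → C l i * b l j)) ⟩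
      sum (λ i → sum (λ l → x i * (C l i * b l j))) ≡⟨ ∑-comm (λ i l → x i * (C l i * b l j)) ⟩
      sum (λ l → sum (λ i → x i * (C l i * b l j))) ≡⟨ sum-cong-≋ (λ l → trans (sum-cong-≋ (λ i → lemma (x i) (C l i) (b l j)))
                                                              (sym (*-distribˡ-sum (b l j) (λ i → C l i * x i)))) ⟩
      sum (λ l → b l j * (C l ∙ x)) ≡⟨ sum-zero _ (λ l → trans (cong (b l j *_) (x∈ l)) (*-zeroʳ (b l j))) ⟩
      0ℚ ∎
      where
      lemma : ∀ a b c → a * (b * c) ≡ c * (b * a)
      lemma = solve-∀ ℚ-ring

    absurd : ∀ {e} {β : Vector (Vector ℚ d′) e} → 1 ℕ.≤ e → IsBasis (Kernel C) β → ⊥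
    absurd {suc e} {β} _ isKernelBasis = contradiction (trans (sym (unit-diagonal {suc e} zero))
      (independent isKernelBasis (unit {suc e} zero)
        (λ j → sum-zero (λ i → unit {suc e} zero i * β i j) (λ i → trans (cong (unit {suc e} zero i *_)
          (independent isB′ (β i) (vanish (β i) (members isKernelBasis i)) j)) (*-zeroʳ (unit {suc e} zero i))))
        zero)) 1≢0

  nullity-unique : ∀ {m n w} (A : Matrix m n) (b : Vector (Vector ℚ n) w) → IsBasis (Kernel A) b → nullity A ≡ w
  nullity-unique A b isBasis = ℕₚ.≤-antisym (independent-≤ isBasis isKernelBasis) (independent-≤ isKernelBasis isBasis)
    where isKernelBasis = proj₂ (proj₂ (kernelBasis A))

-- Kernel vectors of the band matrix as periodic profiles.

module Band where
  open import Algebra.Bundles using (CommutativeRing)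
  open import Data.Fin.Base using (zero; suc; toℕ; fromℕ<)
  open import Data.Fin.Properties using (toℕ<n; toℕ-fromℕ<)
  open import Data.Integer.Base using (_⊖_)
  import Data.Integer.Properties as ℤₚ
  open import Data.Nat.Base as ℕ using (ℕ; zero; suc; _%_; NonZero; s≤s; z≤n)
  import Data.Nat.Properties as ℕₚ
  open import Data.Nat.DivMod using (m%n<n; m≡m%n+[m/n]*n; [m+n]%n≡m%n; m<n⇒m%n≡m)
  import Data.Nat.Tactic.RingSolver as ℕ-Solver
  open import Data.Product using (_×_; _,_; ∃)
  open import Data.Rational hiding (NonZero)
  open import Data.Rational.Properties
  open import Data.Sum using (inj₁; inj₂)
  open import Data.Vec.Functional using (Vector)
  open import Function.Base using (_∘_)
  open import Relation.Binary.PropositionalEquality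
  open import Tactic.RingSolver using (solve-∀)
  open import Algebra.Properties.Semiring.Sum (CommutativeRing.semiring +-*-commutativeRing)
    using (sum; sum-cong-≋)
  open import Defs using (Kernel; _∙_; A; symbol; band)
  open LinAlg
  open Sum (CommutativeRing.commutativeSemiring +-*-commutativeRing)

  sum-Σ< : ∀ {n} (f : ℕ → ℚ) → sum {n} (f ∘ toℕ) ≡ Σ< n f
  sum-Σ< {zero}  f = refl
  sum-Σ< {suc n} f = trans (cong (f 0 +_) (sum-Σ< {n} (f ∘ suc))) (sym (Σ<-head n f))

  Σ<-split : ∀ a b f → Σ< (a ℕ.+ b) f ≡ Σ< a f + Σ< b (λ i → f (a ℕ.+ i))
  Σ<-split a zero    f = trans (cong (λ n → Σ< n f) (ℕₚ.+-identityʳ a)) (sym (+-identityʳ (Σ< a f)))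
  Σ<-split a (suc b) f = trans (cong (λ n → Σ< n f) (ℕₚ.+-suc a b))
    (trans (cong (_+ f (a ℕ.+ b)) (Σ<-split a b f)) (+-assoc (Σ< a f) _ _))

  Σ<-tail : ∀ {a n} f → a ℕ.≤ n → (∀ x → a ℕ.≤ x → f x ≡ 0ℚ) → Σ< n f ≡ Σ< a f
  Σ<-tail {a} {n} f a≤n f≡0 = begin
    Σ< n f ≡⟨ cong (λ m → Σ< m f) (sym (ℕₚ.m+[n∸m]≡n a≤n)) ⟩
    Σ< (a ℕ.+ (n ℕ.∸ a)) f ≡⟨ Σ<-split a (n ℕ.∸ a) f ⟩
    Σ< a f + Σ< (n ℕ.∸ a) (λ i → f (a ℕ.+ i)) ≡⟨ cong (Σ< a f +_) (trans (Σ<-cong (n ℕ.∸ a) (λ i _ → f≡0 (a ℕ.+ i) (ℕₚ.m≤m+n a i))) (Σ<-0 (n ℕ.∸ a))) ⟩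
    Σ< a f + 0ℚ ≡⟨ +-identityʳ _ ⟩
    Σ< a f ∎
    where open ≡-Reasoning

  window-shift : ∀ k f → (∀ x → f (x ℕ.+ k) ≡ f x) → ∀ z → Σ< k (λ u → f (z ℕ.+ u)) ≡ Σ< k f
  window-shift k f periodic zero    = refl
  window-shift k f periodic (suc z) = trans (+-cancelˡ (f z) _ _ (begin
    f z + Σ< k (λ u → f (suc z ℕ.+ u)) ≡⟨ cong₂ _+_ (cong f (sym (ℕₚ.+-identityʳ z))) (Σ<-cong k (λ u _ → cong f (sym (ℕₚ.+-suc z u)))) ⟩
    f (z ℕ.+ 0) + Σ< k (λ u → f (z ℕ.+ suc u)) ≡⟨ sym (Σ<-head k (λ u → f (z ℕ.+ u))) ⟩
    Σ< k (λ u → f (z ℕ.+ u)) + f (z ℕ.+ k) ≡⟨ cong (Σ< k (λ u → f (z ℕ.+ u)) +_) (periodic z) ⟩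
    Σ< k (λ u → f (z ℕ.+ u)) + f z ≡⟨ +-comm _ (f z) ⟩
    f z + Σ< k (λ u → f (z ℕ.+ u)) ∎)) (window-shift k f periodic z)
    where
    open ≡-Reasoning
    open import Algebra.Properties.Group +-0-group using () renaming (∙-cancelˡ to +-cancelˡ)

  lt : ℕ → ℕ → ℚ
  lt x       zero    = 0ℚ
  lt zero    (suc c) = 1ℚ
  lt (suc x) (suc c) = lt x c

  lt-< : ∀ {x c} → x ℕ.< c → lt x c ≡ 1ℚ
  lt-< {zero}  {suc c} _         = refl
  lt-< {suc x} {suc c} (s≤s x<c) = lt-< x<c

  lt-≥ : ∀ {x c} → c ℕ.≤ x → lt x c ≡ 0ℚ
  lt-≥ {x}     {zero}  _         = refl
  lt-≥ {suc x} {suc c} (s≤s c≤x) = lt-≥ c≤x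

  Σ<-lt : ∀ n c f → (∀ x → n ℕ.≤ x → f x ≡ 0ℚ) → Σ< n (λ x → lt x c * f x) ≡ Σ< c f
  Σ<-lt n c f f≡0 with ℕₚ.≤-total n c
  ... | inj₁ n≤c = trans (Σ<-cong n (λ x x<n → trans (cong (_* f x) (lt-< (ℕₚ.<-≤-trans x<n n≤c))) (*-identityˡ (f x))))
    (sym (Σ<-tail f n≤c f≡0))
  ... | inj₂ c≤n = trans (Σ<-tail (λ x → lt x c * f x) c≤n (λ x c≤x → trans (cong (_* f x) (lt-≥ c≤x)) (*-zeroˡ (f x))))
    (Σ<-cong c (λ x x<c → trans (cong (_* f x) (lt-< x<c)) (*-identityˡ (f x))))

  band-lt : ∀ k d → band k (suc d) ≡ lt d k
  band-lt zero    d       = refl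
  band-lt (suc k) zero    = refl
  band-lt (suc k) (suc d) = band-lt k d

  -- The nonzero columns of row i form the intervals from i + 1 to i + k and from i - k to i - 1,
  -- each a difference of initial segments, which will turn into prefix sums. Truncating i - k at 0
  -- is correct because columns start there.
  symbol-lt : ∀ k x i → symbol k (x ⊖ i) ≡ (lt x (i ℕ.+ suc k) - lt x (suc i)) - (lt x i - lt x (i ℕ.∸ k))
  symbol-lt k zero    zero    = cong (λ z → (1ℚ - 1ℚ) - (0ℚ - lt 0 z)) (sym (ℕₚ.0∸n≡0 k))
  symbol-lt k (suc x) zero    = trans (band-lt k x) (trans (lemma (lt x k)) (cong (λ z → (lt x k - 0ℚ) - (0ℚ - lt (suc x) z)) (sym (ℕₚ.0∸n≡0 k))))
    where
    lemma : ∀ a → a ≡ (a - 0ℚ) - (0ℚ - 0ℚ)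
    lemma = solve-∀ ℚ-ring
  symbol-lt k zero    (suc i) = trans (cong -_ (trans (band-lt k i) (outer k i))) (lemma (lt 0 (suc i ℕ.∸ k)))
    where
    outer : ∀ k i → lt i k ≡ 1ℚ - lt 0 (suc i ℕ.∸ k)
    outer zero    i       = refl
    outer (suc k) zero    = sym (cong (λ z → 1ℚ - lt 0 z) (ℕₚ.0∸n≡0 k))
    outer (suc k) (suc i) = outer k i
    lemma : ∀ a → - (1ℚ - a) ≡ (1ℚ - 1ℚ) - (1ℚ - a)
    lemma = solve-∀ ℚ-ring
  symbol-lt k (suc x) (suc i) = trans (cong (symbol k) (ℤₚ.[1+m]⊖[1+n]≡m⊖n x i)) (trans (symbol-lt k x i)
    (cong (λ z → (lt x (i ℕ.+ suc k) - lt x (suc i)) - (lt x i - z)) (shift x i k)))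
    where
    shift : ∀ x i k → lt x (i ℕ.∸ k) ≡ lt (suc x) (suc i ℕ.∸ k)
    shift x i       zero    = refl
    shift x zero    (suc k) = sym (cong (lt (suc x)) (ℕₚ.0∸n≡0 k))
    shift x (suc i) (suc k) = shift x i k

  ext : ∀ {n} → Vector ℚ n → ℕ → ℚ
  ext {zero}  v x       = 0ℚ
  ext {suc n} v zero    = v zero
  ext {suc n} v (suc x) = ext (v ∘ suc) x

  ext-toℕ : ∀ {n} (v : Vector ℚ n) j → ext v (toℕ j) ≡ v j
  ext-toℕ v zero    = refl
  ext-toℕ v (suc j) = ext-toℕ (v ∘ suc) j

  ext-≥ : ∀ {n} (v : Vector ℚ n) x → n ℕ.≤ x → ext v x ≡ 0ℚ
  ext-≥ {zero}  v x       _         = refl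
  ext-≥ {suc n} v (suc x) (s≤s n≤x) = ext-≥ (v ∘ suc) x n≤x

  ext-∘toℕ : ∀ {n} (g : ℕ → ℚ) x → x ℕ.< n → ext {n} (g ∘ toℕ) x ≡ g x
  ext-∘toℕ {suc n} g zero    _         = refl
  ext-∘toℕ {suc n} g (suc x) (s≤s x<n) = ext-∘toℕ (g ∘ suc) x x<n

  prefix : ∀ {n} → Vector ℚ n → ℕ → ℚ
  prefix v x = Σ< x (ext v)

  prefix-≥ : ∀ {n} (v : Vector ℚ n) x → n ℕ.≤ x → prefix v x ≡ prefix v n
  prefix-≥ v x n≤x = Σ<-tail (ext v) n≤x (ext-≥ v)

  row : ∀ {n} k i (v : Vector ℚ n) → A n k i ∙ v ≡
        (prefix v (toℕ i ℕ.+ suc k) - prefix v (suc (toℕ i))) - (prefix v (toℕ i) - prefix v (toℕ i ℕ.∸ k))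
  row {n} k i′ v = begin
    sum (λ j → symbol k (toℕ j ⊖ i) * v j)
      ≡⟨ sum-cong-≋ (λ j → cong (symbol k (toℕ j ⊖ i) *_) (sym (ext-toℕ v j))) ⟩
    sum {n} (λ j → symbol k (toℕ j ⊖ i) * f (toℕ j))
      ≡⟨ sum-Σ< {n} (λ x → symbol k (x ⊖ i) * f x) ⟩
    Σ< n (λ x → symbol k (x ⊖ i) * f x)
      ≡⟨ Σ<-cong n (λ x _ → trans (cong (_* f x) (symbol-lt k x i)) (lemma (lt x (i ℕ.+ suc k)) (lt x (suc i)) (lt x i) (lt x (i ℕ.∸ k)) (f x))) ⟩
    Σ< n (λ x → (lt x (i ℕ.+ suc k) * f x + (- 1ℚ) * (lt x (suc i) * f x)) + ((- 1ℚ) * (lt x i * f x) + lt x (i ℕ.∸ k) * f x))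
      ≡⟨ Σ<-+ n _ _ ⟩
    Σ< n (λ x → lt x (i ℕ.+ suc k) * f x + (- 1ℚ) * (lt x (suc i) * f x)) + Σ< n (λ x → (- 1ℚ) * (lt x i * f x) + lt x (i ℕ.∸ k) * f x)
      ≡⟨ cong₂ _+_ (trans (Σ<-+ n _ _) (cong₂ _+_ (cut (i ℕ.+ suc k)) (trans (Σ<-* n (- 1ℚ) (λ x → lt x (suc i) * f x)) (cong ((- 1ℚ) *_) (cut (suc i))))))
                   (trans (Σ<-+ n _ _) (cong₂ _+_ (trans (Σ<-* n (- 1ℚ) (λ x → lt x i * f x)) (cong ((- 1ℚ) *_) (cut i))) (cut (i ℕ.∸ k)))) ⟩
    (prefix v (i ℕ.+ suc k) + (- 1ℚ) * prefix v (suc i)) + ((- 1ℚ) * prefix v i + prefix v (i ℕ.∸ k))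
      ≡⟨ lemma′ (prefix v (i ℕ.+ suc k)) (prefix v (suc i)) (prefix v i) (prefix v (i ℕ.∸ k)) ⟩
    (prefix v (i ℕ.+ suc k) - prefix v (suc i)) - (prefix v i - prefix v (i ℕ.∸ k)) ∎
    where
    open ≡-Reasoning
    i = toℕ i′
    f = ext v
    cut : ∀ c → Σ< n (λ x → lt x c * f x) ≡ prefix v c
    cut c = Σ<-lt n c f (ext-≥ v)
    lemma : ∀ a b c d f → ((a - b) - (c - d)) * f ≡ (a * f + (- 1ℚ) * (b * f)) + ((- 1ℚ) * (c * f) + d * f)
    lemma = solve-∀ ℚ-ring
    lemma′ : ∀ a b c d → (a + (- 1ℚ) * b) + ((- 1ℚ) * c + d) ≡ (a - b) - (c - d)
    lemma′ = solve-∀ ℚ-ring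

  -- The symbol Σ_{1≤d≤k} (x^d - x^-d) vanishes exactly on the nontrivial roots of x^k - 1 and x^(k+1) - 1,
  -- so a kernel vector is the difference of a k-periodic and a (k+1)-periodic sequence; the boundary
  -- conditions identify the former with the latter.
  defect : (k : ℕ) .{{_ : NonZero k}} → (ℕ → ℚ) → ℕ → ℚ
  defect k c x = c (suc (x % k)) - c (suc x)

  -- The `defect` at k + x is entry x of the vector given by `fromProfile`, so `window` says that
  -- the k entries after the last one vanish, as for a vector padded by zeros. The padding in front
  -- is automatic, since x % k = x below k.
  record Profile (n k : ℕ) .{{_ : NonZero k}} (c : ℕ → ℚ) : Set where
    field
      periodic : ∀ x → c (x ℕ.+ suc k) ≡ c x
      c-0      : c 0 ≡ 0ℚ
      window   : ∀ u → u ℕ.< k → defect k c (n ℕ.+ k ℕ.+ u) ≡ 0ℚ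

  fromProfile : ∀ {n} (k : ℕ) .{{_ : NonZero k}} → (ℕ → ℚ) → Vector ℚ n
  fromProfile k c j = c (suc (toℕ j % k)) - c (toℕ j)

  -≡0⇒≡ : ∀ {a b} → a - b ≡ 0ℚ → a ≡ b
  -≡0⇒≡ {a} {b} eq = trans (lemma a b) (trans (cong (_+ b) eq) (+-identityˡ b))
    where
    lemma : ∀ a b → a ≡ (a - b) + b
    lemma = solve-∀ ℚ-ring

  ≡⇒-≡0 : ∀ {a b} → a ≡ b → a - b ≡ 0ℚ
  ≡⇒-≡0 {a} refl = +-inverseʳ a

  module _ {n k : ℕ} .{{_ : NonZero k}} where
    private K = suc k

    -- A row compares two sums of k consecutive values of `defect` at distance `K`. The k-periodic
    -- part has the same sum over any k consecutive places, and the other part has period `K`.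
    profile⇒kernel : ∀ {c} → Profile n k c → Kernel (A n k) (fromProfile k c)
    profile⇒kernel {c} profile i′ = trans (row k i′ v) (≡⇒-≡0 (begin
      Y (i ℕ.+ K) - Y (suc i) ≡⟨ cong₂ _-_ (Y≡S (i ℕ.+ K) (subst (ℕ._≤ n ℕ.+ k) (sym (ℕₚ.+-suc i k)) (ℕₚ.+-monoˡ-≤ k i<n)))
                                                            (Y≡S (suc i) (ℕₚ.≤-trans i<n (ℕₚ.m≤m+n n k))) ⟩
      S (k ℕ.+ (i ℕ.+ K)) - S (k ℕ.+ suc i) ≡⟨ cong₂ (λ a b → S a - S b) (eq₁ i k) (eq₂ i k) ⟩
      S (i ℕ.+ K ℕ.+ k) - S (i ℕ.+ K) ≡⟨ W≡ (i ℕ.+ K) ⟩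
      W (i ℕ.+ K) ≡⟨ W-periodic ⟩
      W i ≡⟨ sym (W≡ i) ⟩
      S (i ℕ.+ k) - S i ≡⟨ cong₂ _-_ (trans (cong S (ℕₚ.+-comm i k)) (sym (Y≡S i (ℕₚ.≤-trans (ℕₚ.<⇒≤ i<n) (ℕₚ.m≤m+n n k))))) (sym Y∸) ⟩
      Y i - Y (i ℕ.∸ k) ∎))
      where
      open ≡-Reasoning
      open Profile profile
      i = toℕ i′
      i<n = toℕ<n i′
      v = fromProfile {n} k c
      Y = prefix v
      D = defect k c
      S W : ℕ → ℚ
      S x = Σ< x D
      W z = Σ< k (λ u → D (z ℕ.+ u))

      eq₁ : ∀ i k → k ℕ.+ (i ℕ.+ suc k) ≡ i ℕ.+ suc k ℕ.+ k
      eq₁ = ℕ-Solver.solve-∀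
      eq₂ : ∀ i k → k ℕ.+ suc i ≡ i ℕ.+ suc k
      eq₂ = ℕ-Solver.solve-∀

      W≡ : ∀ z → S (z ℕ.+ k) - S z ≡ W z
      W≡ z = trans (cong (_- S z) (Σ<-split z k D)) (lemma (S z) (W z))
        where
        lemma : ∀ a b → (a + b) - a ≡ b
        lemma = solve-∀ ℚ-ring

      W-split : ∀ z → W z ≡ Σ< k (λ u → c (suc ((z ℕ.+ u) % k))) + Σ< k (λ u → - c (suc (z ℕ.+ u)))
      W-split z = Σ<-+ k _ _

      W-periodic : W (i ℕ.+ K) ≡ W i
      W-periodic = trans (W-split (i ℕ.+ K)) (trans (cong₂ _+_
        (trans (α-shift (i ℕ.+ K)) (sym (α-shift i)))
        (Σ<-cong k λ u _ → cong -_ (trans (cong c (eq i u k)) (periodic (suc (i ℕ.+ u)))))) (sym (W-split i)))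
        where
        eq : ∀ i u k → suc (i ℕ.+ suc k ℕ.+ u) ≡ suc (i ℕ.+ u) ℕ.+ suc k
        eq = ℕ-Solver.solve-∀
        α-shift = window-shift k (λ x → c (suc (x % k))) (λ x → cong (c ∘ suc) ([m+n]%n≡m%n x k))

      D-head : ∀ x → x ℕ.< k → D x ≡ 0ℚ
      D-head x x<k = ≡⇒-≡0 (cong (c ∘ suc) (m<n⇒m%n≡m x<k))

      D-shift : ∀ x → D (k ℕ.+ x) ≡ c (suc (x % k)) - c x
      D-shift x = cong₂ _-_ (cong (c ∘ suc) (trans (cong (_% k) (ℕₚ.+-comm k x)) ([m+n]%n≡m%n x k)))
        (trans (cong c (trans (cong suc (ℕₚ.+-comm k x)) (sym (ℕₚ.+-suc x k)))) (periodic x))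

      ext≡D : ∀ x → x ℕ.< n ℕ.+ k → ext v x ≡ D (k ℕ.+ x)
      ext≡D x x<n+k with ℕₚ.≤-<-connex n x
      ... | inj₂ x<n = trans (ext-∘toℕ (λ x → c (suc (x % k)) - c x) x x<n) (sym (D-shift x))
      ... | inj₁ n≤x = trans (ext-≥ v x n≤x) (sym (trans (cong D (trans (cong (k ℕ.+_) (sym (ℕₚ.m+[n∸m]≡n n≤x))) (eq k n (x ℕ.∸ n))))
        (window (x ℕ.∸ n) (ℕₚ.+-cancelˡ-< n _ _ (subst (ℕ._< n ℕ.+ k) (sym (ℕₚ.m+[n∸m]≡n n≤x)) x<n+k)))))
        where
        eq : ∀ k n d → k ℕ.+ (n ℕ.+ d) ≡ n ℕ.+ k ℕ.+ d
        eq = ℕ-Solver.solve-∀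

      S-head : ∀ x → x ℕ.≤ k → S x ≡ 0ℚ
      S-head x x≤k = trans (Σ<-cong x (λ u u<x → D-head u (ℕₚ.<-≤-trans u<x x≤k))) (Σ<-0 x)

      Y≡S : ∀ x → x ℕ.≤ n ℕ.+ k → Y x ≡ S (k ℕ.+ x)
      Y≡S x x≤ = sym (trans (Σ<-split k x D) (trans (cong₂ _+_ (S-head k ℕₚ.≤-refl)
        (Σ<-cong x (λ u u<x → sym (ext≡D u (ℕₚ.<-≤-trans u<x x≤))))) (+-identityˡ (Y x))))

      Y∸ : Y (i ℕ.∸ k) ≡ S i
      Y∸ with ℕₚ.≤-total i k
      ... | inj₁ i≤k = trans (cong Y (ℕₚ.m≤n⇒m∸n≡0 i≤k)) (sym (S-head i i≤k))
      ... | inj₂ k≤i = trans (Y≡S (i ℕ.∸ k) (ℕₚ.≤-trans (ℕₚ.m∸n≤m i k) (ℕₚ.≤-trans (ℕₚ.<⇒≤ i<n) (ℕₚ.m≤m+n n k)))) (cong S (ℕₚ.m+[n∸m]≡n k≤i))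

    -- The rows say that `W`, the difference of the shifted prefix sums `X` across k places, has
    -- period `K` as far as the matrix reaches. Hence `W` itself, continued periodically, serves as
    -- c.
    kernel⇒profile : ∀ v → Kernel (A n k) v → ∃ λ c → Profile n k c × (∀ j → v j ≡ fromProfile k c j)
    kernel⇒profile v v∈ = c , record { periodic = periodic ; c-0 = c-0 ; window = window } , recover
      where
      open ≡-Reasoning
      Y = prefix v
      X W c : ℕ → ℚ
      X x = Y (x ℕ.∸ k)
      W x = X (x ℕ.+ k) - X x
      c x = W (x % K)

      X-head : ∀ {x} → x ℕ.≤ k → X x ≡ 0ℚ
      X-head x≤k = cong Y (ℕₚ.m≤n⇒m∸n≡0 x≤k)

      X-+k : ∀ x → X (x ℕ.+ k) ≡ Y x
      X-+k x = cong Y (ℕₚ.m+n∸n≡m x k)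

      W-periodic : ∀ x → x ℕ.< n → W (x ℕ.+ K) ≡ W x
      W-periodic x x<n = trans (cong₂ _-_ (X-+k (x ℕ.+ K)) (trans (cong X (ℕₚ.+-suc x k)) (X-+k (suc x))))
        (trans (-≡0⇒≡ (trans (sym row′) (v∈ (fromℕ< x<n)))) (cong (_- X x) (sym (X-+k x))))
        where
        row′ = subst (λ i → A n k (fromℕ< x<n) ∙ v ≡ (Y (i ℕ.+ K) - Y (suc i)) - (Y i - Y (i ℕ.∸ k))) (toℕ-fromℕ< x<n) (row k (fromℕ< x<n) v)

      W-periodic* : ∀ t x → x ℕ.+ t ℕ.* K ℕ.≤ n ℕ.+ k → W (x ℕ.+ t ℕ.* K) ≡ W x
      W-periodic* zero    x _ = cong W (ℕₚ.+-identityʳ x)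
      W-periodic* (suc t) x ≤n+k = trans (cong W (eq x t K)) (trans (W-periodic (x ℕ.+ t ℕ.* K) <n)
        (W-periodic* t x (ℕₚ.≤-trans (ℕₚ.<⇒≤ <n) (ℕₚ.m≤m+n n k))))
        where
        eq : ∀ x t K → x ℕ.+ (K ℕ.+ t ℕ.* K) ≡ x ℕ.+ t ℕ.* K ℕ.+ K
        eq = ℕ-Solver.solve-∀
        <n : x ℕ.+ t ℕ.* K ℕ.< n
        <n = ℕₚ.+-cancelʳ-≤ k _ _ (subst (ℕ._≤ n ℕ.+ k) (trans (eq x t K) (ℕₚ.+-suc (x ℕ.+ t ℕ.* K) k)) ≤n+k)

      W≡c : ∀ x → x ℕ.≤ n ℕ.+ k → W x ≡ c x
      W≡c x x≤ = trans (cong W (m≡m%n+[m/n]*n x K)) (W-periodic* (x ℕ./ K) (x % K) (subst (ℕ._≤ n ℕ.+ k) (m≡m%n+[m/n]*n x K) x≤))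

      periodic : ∀ x → c (x ℕ.+ K) ≡ c x
      periodic x = cong W ([m+n]%n≡m%n x K)

      c-0 : c 0 ≡ 0ℚ
      c-0 = ≡⇒-≡0 (trans (X-head {k} ℕₚ.≤-refl) (sym (X-head {0} z≤n)))

      -- From z to z + k the increment of `X` changes by W (z + 1) - W z, and these corrections
      -- telescope because c (z + k + 1) = c z.
      increments : ∀ t x → x ℕ.< k → x ℕ.+ t ℕ.* k ℕ.< n ℕ.+ k ℕ.+ k →
                   X (suc (x ℕ.+ t ℕ.* k)) - X (x ℕ.+ t ℕ.* k) ≡ c (suc x) - c (suc (x ℕ.+ t ℕ.* k))
      increments zero    x x<k _ = trans (≡⇒-≡0 (trans (X-head (subst (ℕ._< k) (sym (ℕₚ.+-identityʳ x)) x<k)) (sym (X-head (subst (ℕ._≤ k) (sym (ℕₚ.+-identityʳ x)) (ℕₚ.<⇒≤ x<k))))))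
        (sym (≡⇒-≡0 (cong (c ∘ suc) (sym (ℕₚ.+-identityʳ x)))))
      increments (suc t) x x<k < = begin
        X (suc (x ℕ.+ suc t ℕ.* k)) - X (x ℕ.+ suc t ℕ.* k) ≡⟨ cong (λ z → X (suc z) - X z) (eq x t k) ⟩
        X (suc z ℕ.+ k) - X (z ℕ.+ k) ≡⟨ lemma (X (suc z ℕ.+ k)) (X (suc z)) (X (z ℕ.+ k)) (X z) ⟩
        (X (suc z) - X z) + (W (suc z) - W z) ≡⟨ cong₂ _+_ (increments t x x<k (ℕₚ.<-≤-trans z< (ℕₚ.m≤m+n (n ℕ.+ k) k)))
                                                                  (cong₂ _-_ (W≡c (suc z) z<) (W≡c z (ℕₚ.<⇒≤ z<))) ⟩
        (c (suc x) - c (suc z)) + (c (suc z) - c z) ≡⟨ lemma′ (c (suc x)) (c (suc z)) (c z) ⟩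
        c (suc x) - c z ≡⟨ cong (λ w → c (suc x) - w) (sym (periodic z)) ⟩
        c (suc x) - c (z ℕ.+ K) ≡⟨ cong (λ w → c (suc x) - c w) (trans (ℕₚ.+-suc z k) (cong suc (sym (eq x t k)))) ⟩
        c (suc x) - c (suc (x ℕ.+ suc t ℕ.* k)) ∎
        where
        z = x ℕ.+ t ℕ.* k
        eq : ∀ x t k → x ℕ.+ (k ℕ.+ t ℕ.* k) ≡ x ℕ.+ t ℕ.* k ℕ.+ k
        eq = ℕ-Solver.solve-∀
        z< : z ℕ.< n ℕ.+ k
        z< = ℕₚ.+-cancelʳ-< k _ _ (subst (ℕ._< n ℕ.+ k ℕ.+ k) (eq x t k) <)
        lemma : ∀ a b c d → a - c ≡ (b - d) + ((a - b) - (c - d))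
        lemma = solve-∀ ℚ-ring
        lemma′ : ∀ a b c → (a - b) + (b - c) ≡ a - c
        lemma′ = solve-∀ ℚ-ring

      increment : ∀ x → x ℕ.< n ℕ.+ k ℕ.+ k → X (suc x) - X x ≡ defect k c x
      increment x x< = subst (λ z → X (suc z) - X z ≡ c (suc (x % k)) - c (suc z)) (sym x≡)
        (increments (x ℕ./ k) (x % k) (m%n<n x k) (subst (ℕ._< n ℕ.+ k ℕ.+ k) x≡ x<))
        where x≡ = m≡m%n+[m/n]*n x k

      window : ∀ u → u ℕ.< k → defect k c (n ℕ.+ k ℕ.+ u) ≡ 0ℚ
      window u u<k = trans (sym (increment (n ℕ.+ k ℕ.+ u) (ℕₚ.+-monoʳ-< (n ℕ.+ k) u<k)))
        (≡⇒-≡0 (trans (cong X (sym (ℕₚ.+-suc (n ℕ.+ k) u))) (trans (constant (suc u)) (sym (constant u)))))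
        where
        constant : ∀ u → X (n ℕ.+ k ℕ.+ u) ≡ Y n
        constant u = trans (cong X (eq n k u)) (trans (X-+k (n ℕ.+ u)) (prefix-≥ v (n ℕ.+ u) (ℕₚ.m≤m+n n u)))
          where
          eq : ∀ n k u → n ℕ.+ k ℕ.+ u ≡ n ℕ.+ u ℕ.+ k
          eq = ℕ-Solver.solve-∀

      recover : ∀ j → v j ≡ fromProfile k c j
      recover j = begin
        v j ≡⟨ sym (ext-toℕ v j) ⟩
        ext v x ≡⟨ lemma (Y x) (ext v x) ⟩
        Y (suc x) - Y x ≡⟨ sym (cong₂ _-_ (X-+k (suc x)) (X-+k x)) ⟩
        X (suc (x ℕ.+ k)) - X (x ℕ.+ k) ≡⟨ increment (x ℕ.+ k) (ℕₚ.<-≤-trans (ℕₚ.+-monoˡ-< k (toℕ<n j)) (ℕₚ.m≤m+n (n ℕ.+ k) k)) ⟩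
        c (suc ((x ℕ.+ k) % k)) - c (suc (x ℕ.+ k)) ≡⟨ cong₂ _-_ (cong (c ∘ suc) ([m+n]%n≡m%n x k)) (trans (cong c (sym (ℕₚ.+-suc x k))) (periodic x)) ⟩
        c (suc (x % k)) - c x ∎
        where
        x = toℕ j
        lemma : ∀ a b → b ≡ (a + b) - a
        lemma = solve-∀ ℚ-ring

-- Pigeonhole counting with duplicate-free lists.

module ListCount where
  open import Data.List.Base using (List; []; _∷_; _++_; map; length; upTo)
  open import Data.List.Properties using (length-map; length-++; length-upTo)
  open import Data.List.Membership.Propositional using (_∈_)
  open import Data.List.Membership.Propositional.Properties
  open import Data.List.Relation.Unary.All as All using (All; []; _∷_)
  open import Data.List.Relation.Unary.Any using (here; there)
  open import Data.List.Relation.Unary.AllPairs using ([]; _∷_)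
  open import Data.List.Relation.Unary.Unique.Propositional using (Unique)
  open import Data.List.Relation.Unary.Unique.Propositional.Properties using (upTo⁺)
  open import Data.Nat.Base
  open import Data.Nat.Properties
  open import Data.Product using (_×_; _,_; ∃)
  open import Data.Sum using (inj₁; inj₂)
  open import Relation.Binary.PropositionalEquality
  open import Relation.Nullary using (yes; no; contradiction)

  length-⊆ : ∀ {a} {A : Set a} {xs ys : List A} → Unique xs → (∀ {x} → x ∈ xs → x ∈ ys) → length xs ≤ length ys
  length-⊆ {xs = []}     _              _   = z≤n
  length-⊆ {xs = x ∷ xs} (x∉ ∷ unique) xs⊆ with ∈-∃++ (xs⊆ (here refl))
  ... | as , bs , refl = subst (suc (length xs) ≤_) (sym (trans (length-++ as) (+-suc (length as) (length bs))))
    (s≤s (subst (length xs ≤_) (length-++ as) (length-⊆ unique λ z∈ → remove (xs⊆ (there z∈)) (All.lookup x∉ z∈))))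
    where
    remove : ∀ {z} → z ∈ as ++ x ∷ bs → x ≢ z → z ∈ as ++ bs
    remove z∈ x≢z with ∈-++⁻ as z∈
    ... | inj₁ z∈as            = ∈-++⁺ˡ z∈as
    ... | inj₂ (here z≡x)      = contradiction (sym z≡x) x≢z
    ... | inj₂ (there z∈bs)    = ∈-++⁺ʳ as z∈bs

  unique-map : ∀ {a b} {A : Set a} {B : Set b} (f : A → B) {xs} → (∀ {x y} → x ∈ xs → y ∈ xs → f x ≡ f y → x ≡ y) →
               Unique xs → Unique (map f xs)
  unique-map f         inj []            = []
  unique-map f {x ∷ xs} inj (x∉ ∷ unique) = All.tabulate (λ fy∈ fx≡ → let (y , y∈ , eq) = ∈-map⁻ f fy∈ in
      All.lookup x∉ y∈ (inj (here refl) (there y∈) (trans fx≡ eq)))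
    ∷ unique-map f (λ x∈ y∈ → inj (there x∈) (there y∈)) unique

  injective⇒surjective : ∀ {k} (f : ℕ → ℕ) → (∀ i → i ≤ k → f i ≤ k) →
                         (∀ i j → i ≤ k → j ≤ k → f i ≡ f j → i ≡ j) → ∀ y → y ≤ k → ∃ λ i → i < suc k × f i ≡ y
  injective⇒surjective {k} f f≤k inj y y≤k with anyUpTo? (λ i → f i ≟ y) (suc k)
  ... | yes found = found
  ... | no  none  = contradiction (subst₂ _≤_ (cong suc (trans (length-map f (upTo (suc k))) (length-upTo (suc k)))) (length-upTo (suc k))
    (length-⊆ {xs = y ∷ map f (upTo (suc k))} {ys = upTo (suc k)}
      (All.tabulate (λ z∈ y≡z → let (i , i∈ , eq) = ∈-map⁻ f z∈ in none (i , ∈-upTo⁻ i∈ , trans (sym eq) (sym y≡z)))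
        ∷ unique-map f (λ i∈ j∈ → inj _ _ (s≤s⁻¹ (∈-upTo⁻ i∈)) (s≤s⁻¹ (∈-upTo⁻ j∈))) (upTo⁺ (suc k)))
      λ { (here refl) → ∈-upTo⁺ (s≤s y≤k)
        ; (there z∈)  → let (i , i∈ , eq) = ∈-map⁻ f z∈ in subst (_∈ upTo (suc k)) (sym eq) (∈-upTo⁺ (s≤s (f≤k i (s≤s⁻¹ (∈-upTo⁻ i∈))))) }))
    1+n≰n

-- The nullity equals the number of closed loops.

module Nullity where
  open import Algebra.Bundles using (CommutativeRing)
  open import Data.Fin.Base using (Fin; zero; suc; toℕ; fromℕ<)
  open import Data.Fin.Properties using (toℕ<n; toℕ-fromℕ<)
  open import Data.Nat.Base as ℕ using (ℕ; zero; suc; _%_; _/_; NonZero; s≤s)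
  import Data.Nat.Properties as ℕₚ
  open import Data.Nat.DivMod hiding (_%_; _/_)
  import Data.Nat.Tactic.RingSolver as ℕ-Solver
  open import Data.Product using (_×_; _,_; ∃; proj₁; proj₂)
  open import Data.Rational hiding (NonZero; _/_)
  open import Data.Rational.Properties
  open import Data.Sum using (inj₁; inj₂)
  open import Data.Vec.Functional using (Vector)
  open import Function.Base using (_∘_)
  open import Relation.Binary.PropositionalEquality
  open import Relation.Nullary using (yes; no; contradiction)
  open import Tactic.RingSolver using (solve-∀)
  open import Algebra.Properties.Semiring.Sum (CommutativeRing.semiring +-*-commutativeRing)
    using (sum; sum-cong-≋; ∑-distrib-+; *-distribˡ-sum)
  open import Defs using (Kernel; A; nullity; linComb; sum-zero)
  open LinAlg
  open NatSum using (/-unique)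
  open Orbits
  open Band
  open ListCount

  δ : ℕ → ℕ → ℚ
  δ zero    zero    = 1ℚ
  δ zero    (suc _) = 0ℚ
  δ (suc _) zero    = 0ℚ
  δ (suc t) (suc s) = δ t s

  δ-< : ∀ {t s} → t ℕ.< s → δ t s ≡ 0ℚ
  δ-< {zero}  {suc s} _         = refl
  δ-< {suc t} {suc s} (s≤s t<s) = δ-< t<s

  sum-δ : ∀ {w} (x : Vector ℚ w) s → sum (λ t → x t * δ (toℕ t) s) ≡ ext x s
  sum-δ {zero}  x s       = refl
  sum-δ {suc w} x zero    = trans (cong₂ _+_ (*-identityʳ (x zero)) (sum-zero _ (λ t → *-zeroʳ (x (suc t))))) (+-identityʳ (x zero))
  sum-δ {suc w} x (suc s) = trans (cong₂ _+_ (*-zeroʳ (x zero)) (sum-δ (x ∘ suc) s)) (+-identityˡ _)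

  1+i/q : ∀ i q .{{_ : NonZero q}} → suc i % q ≢ 0 → suc i / q ≡ i / q
  1+i/q i q ≢0 = sym (/-unique i (ℕ.pred (suc i % q)) (suc i / q) (ℕₚ.≤-<-trans (ℕₚ.pred[n]≤n {suc i % q}) (m%n<n (suc i) q))
    (ℕₚ.suc-injective (trans (m≡m%n+[m/n]*n (suc i) q) (cong (ℕ._+ suc i / q ℕ.* q) (sym (ℕₚ.suc-pred (suc i % q) {{ℕ.≢-nonZero ≢0}}))))))

  module _ {k n q w : ℕ} .{{_ : NonZero k}} .{{_ : NonZero q}} (k<n : k ℕ.< n) (loops : Loops k (n ℕ.+ k) q w) where
    open Loops loops
    private
      K = suc k

      surjective = injective⇒surjective φ φ≤k φ-injective

      inverse : ℕ → ℕ
      inverse x = proj₁ (surjective (x % K) (ℕ.s≤s⁻¹ (m%n<n x K)))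

      inverse≤k : ∀ x → inverse x ℕ.≤ k
      inverse≤k x = ℕ.s≤s⁻¹ (proj₁ (proj₂ (surjective (x % K) _)))

      φ-inverse : ∀ x → φ (inverse x) ≡ x % K
      φ-inverse x = proj₂ (proj₂ (surjective (x % K) _))

      inverse-φ : ∀ i → i ℕ.≤ k → inverse (φ i) ≡ i
      inverse-φ i i≤k = φ-injective (inverse (φ i)) i (inverse≤k (φ i)) i≤k
        (trans (φ-inverse (φ i)) (m<n⇒m%n≡m (s≤s (φ≤k i i≤k))))

      module _ {c : ℕ → ℚ} (periodic : ∀ x → c (x ℕ.+ K) ≡ c x) where
        periodic* : ∀ t x → c (x ℕ.+ t ℕ.* K) ≡ c x
        periodic* zero    x = cong c (ℕₚ.+-identityʳ x)
        periodic* (suc t) x = trans (cong c (eq x t K)) (trans (periodic (x ℕ.+ t ℕ.* K)) (periodic* t x))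
          where
          eq : ∀ x t K → x ℕ.+ (K ℕ.+ t ℕ.* K) ≡ x ℕ.+ t ℕ.* K ℕ.+ K
          eq = ℕ-Solver.solve-∀

        reduce : ∀ x → c x ≡ c (x % K)
        reduce x = trans (cong c (m≡m%n+[m/n]*n x K)) (periodic* (x / K) (x % K))

        respects : ∀ {x y} → x ≈ y [mod K ] → c x ≡ c y
        respects {x} {y} (s , t , eq) = trans (sym (periodic* s x)) (trans (cong c eq) (periodic* t y))

      -- As m = k a + r, the window index m + u equals σ + (a + 1) k for u = k - r + σ and, in
      -- `high-window`, σ + a k for u = σ - r. Each vanishing defect thus equates c at `suc σ` with
      -- c at its image under `Step`; 0 is never a source.
      low-window : ∀ c σ → σ ℕ.< k → defect k c (n ℕ.+ k ℕ.+ (k ℕ.∸ r ℕ.+ σ)) ≡ c (suc σ) - c (suc σ ℕ.+ suc a ℕ.* k)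
      low-window c σ σ<k = cong₂ (λ x y → c (suc x) - c y) (trans (cong (_% k) eq) (trans ([m+kn]%n≡m%n σ (suc a) k) (m<n⇒m%n≡m σ<k))) (cong suc eq)
        where
        lemma : ∀ k a r s σ → k ℕ.* a ℕ.+ r ℕ.+ (s ℕ.+ σ) ≡ σ ℕ.+ ((r ℕ.+ s) ℕ.+ a ℕ.* k)
        lemma = ℕ-Solver.solve-∀
        eq : n ℕ.+ k ℕ.+ (k ℕ.∸ r ℕ.+ σ) ≡ σ ℕ.+ suc a ℕ.* k
        eq = trans (cong (ℕ._+ (k ℕ.∸ r ℕ.+ σ)) m≡) (trans (lemma k a r (k ℕ.∸ r) σ) (cong (λ z → σ ℕ.+ (z ℕ.+ a ℕ.* k)) (ℕₚ.m+[n∸m]≡n r≤k)))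

      high-window : ∀ c σ → r ℕ.≤ σ → σ ℕ.< k → defect k c (n ℕ.+ k ℕ.+ (σ ℕ.∸ r)) ≡ c (suc σ) - c (suc σ ℕ.+ a ℕ.* k)
      high-window c σ r≤σ σ<k = cong₂ (λ x y → c (suc x) - c y) (trans (cong (_% k) eq) (trans ([m+kn]%n≡m%n σ a k) (m<n⇒m%n≡m σ<k))) (cong suc eq)
        where
        lemma : ∀ k a r s → k ℕ.* a ℕ.+ r ℕ.+ s ≡ (r ℕ.+ s) ℕ.+ a ℕ.* k
        lemma = ℕ-Solver.solve-∀
        eq : n ℕ.+ k ℕ.+ (σ ℕ.∸ r) ≡ σ ℕ.+ a ℕ.* k
        eq = trans (cong (ℕ._+ (σ ℕ.∸ r)) m≡) (trans (lemma k a r (σ ℕ.∸ r)) (cong (ℕ._+ a ℕ.* k) (ℕₚ.m+[n∸m]≡n r≤σ)))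

      follow : ∀ {c} → Profile n k c → ∀ {i τ} → i ℕ.< k → Step k a r (φ i) τ → c (φ i) ≡ c τ
      follow {c} profile {i} {τ} i<k (low , high) with φ i in φi≡ | φ≤k i (ℕₚ.<⇒≤ i<k)
      ... | zero  | _ = contradiction (φ-injective i k (ℕₚ.<⇒≤ i<k) ℕₚ.≤-refl (trans φi≡ (sym φ-k))) (ℕₚ.<⇒≢ i<k)
      ... | suc σ | σ<k with ℕₚ.≤-<-connex (suc σ) r
      ...   | inj₁ σ<r = trans (-≡0⇒≡ (trans (sym (low-window c σ σ<k)) (window (k ℕ.∸ r ℕ.+ σ)
        (ℕₚ.<-≤-trans (ℕₚ.+-monoʳ-< (k ℕ.∸ r) σ<r) (ℕₚ.≤-reflexive (ℕₚ.m∸n+n≡m r≤k)))))) (respects periodic (low σ<r))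
        where open Profile profile
      ...   | inj₂ (s≤s r≤σ) = trans (-≡0⇒≡ (trans (sym (high-window c σ r≤σ σ<k)) (window (σ ℕ.∸ r)
        (ℕₚ.≤-<-trans (ℕₚ.m∸n≤m σ r) σ<k)))) (respects periodic (high (s≤s r≤σ)))
        where open Profile profile

      -- The k window conditions correspond to the k sources 1, ..., k, and since φ is onto, each
      -- source is some φ i with i < k.
      invariant⇒profile : ∀ c → (∀ x → c (x ℕ.+ K) ≡ c x) → c 0 ≡ 0ℚ →
                          (∀ i → i ℕ.< k → ∃ λ τ → Step k a r (φ i) τ × c (φ i) ≡ c τ) → Profile n k c
      invariant⇒profile c periodic c-0 invariant = record { periodic = periodic ; c-0 = c-0 ; window = window }
        where
        step : ∀ σ → σ ℕ.< k → ∃ λ τ → Step k a r (suc σ) τ × c (suc σ) ≡ c τ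
        step σ σ<k = subst (λ z → ∃ λ τ → Step k a r z τ × c z ≡ c τ) φi≡ (invariant i (ℕₚ.≤∧≢⇒< (ℕ.s≤s⁻¹ i<K)
          λ i≡k → contradiction (trans (sym φi≡) (trans (cong φ i≡k) φ-k)) λ ()))
          where
          found = surjective (suc σ) σ<k
          i = proj₁ found
          i<K = proj₁ (proj₂ found)
          φi≡ = proj₂ (proj₂ found)

        window : ∀ u → u ℕ.< k → defect k c (n ℕ.+ k ℕ.+ u) ≡ 0ℚ
        window u u<k with ℕₚ.≤-<-connex (k ℕ.∸ r) u
        ... | inj₁ k∸r≤u = let (τ , (low , _) , eq) = step σ σ<k in
          trans (cong (λ z → defect k c (n ℕ.+ k ℕ.+ z)) (sym (ℕₚ.m+[n∸m]≡n k∸r≤u)))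
            (trans (low-window c σ σ<k) (≡⇒-≡0 (trans eq (sym (respects periodic (low (ℕₚ.+-cancelˡ-< (k ℕ.∸ r) σ r
              (subst₂ ℕ._<_ (sym (ℕₚ.m+[n∸m]≡n k∸r≤u)) (sym (ℕₚ.m∸n+n≡m r≤k)) u<k))))))))
          where
          σ = u ℕ.∸ (k ℕ.∸ r)
          σ<k = ℕₚ.≤-<-trans (ℕₚ.m∸n≤m u (k ℕ.∸ r)) u<k
        ... | inj₂ u<k∸r = let (τ , (_ , high) , eq) = step σ σ<k in
          trans (cong (λ z → defect k c (n ℕ.+ k ℕ.+ z)) (sym (ℕₚ.m+n∸m≡n r u)))
            (trans (high-window c σ (ℕₚ.m≤m+n r u) σ<k) (≡⇒-≡0 (trans eq (sym (respects periodic (high (s≤s (ℕₚ.m≤m+n r u))))))))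
          where
          σ = r ℕ.+ u
          σ<k : σ ℕ.< k
          σ<k = ℕₚ.<-≤-trans (ℕₚ.+-monoʳ-< r u<k∸r) (ℕₚ.≤-reflexive (ℕₚ.m+[n∸m]≡n r≤k))

      -- The indicator of the t-th closed loop, whose indices are those with quotient t by q.
      loop : Fin w → ℕ → ℚ
      loop t x = δ (toℕ t) (inverse x / q)

      loop-φ : ∀ t i → i ℕ.≤ k → loop t (φ i) ≡ δ (toℕ t) (i / q)
      loop-φ t i i≤k = cong (λ z → δ (toℕ t) (z / q)) (inverse-φ i i≤k)

      inverse-% : ∀ x y → x % K ≡ y % K → inverse x ≡ inverse y
      inverse-% x y eq = φ-injective (inverse x) (inverse y) (inverse≤k x) (inverse≤k y)
        (trans (φ-inverse x) (trans eq (sym (φ-inverse y))))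

      *q/q≤ : ∀ {s} i → s ℕ.* q ℕ.≤ i → s ℕ.≤ i / q
      *q/q≤ {s} i sq≤i = subst (ℕ._≤ i / q) (m*n/n≡m s q) (/-monoˡ-≤ q sq≤i)

      loop-profile : ∀ t → Profile n k (loop t)
      loop-profile t = invariant⇒profile (loop t)
        (λ x → cong (λ z → δ (toℕ t) (z / q)) (inverse-% (x ℕ.+ K) x ([m+n]%n≡m%n x K)))
        (trans (cong (λ z → loop t z) (sym φ-k)) (trans (loop-φ t k ℕₚ.≤-refl) (outside k w*q≤k)))
        next
        where
        outside : ∀ i → w ℕ.* q ℕ.≤ i → δ (toℕ t) (i / q) ≡ 0ℚ
        outside i wq≤i = δ-< (ℕₚ.<-≤-trans (toℕ<n t) (*q/q≤ i wq≤i))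

        transport : ∀ {i j} → i ℕ.≤ k → j ℕ.≤ k → δ (toℕ t) (i / q) ≡ δ (toℕ t) (j / q) → loop t (φ i) ≡ loop t (φ j)
        transport {i} {j} i≤k j≤k eq = trans (loop-φ t i i≤k) (trans eq (sym (loop-φ t j j≤k)))

        next : ∀ i → i ℕ.< k → ∃ λ τ → Step k a r (φ i) τ × loop t (φ i) ≡ loop t τ
        next i i<k with suc i % q ℕₚ.≟ 0
        ... | no ≢0 = φ (suc i) , along i i<k (λ s _ eq → ≢0 (trans (cong (_% q) eq) (m*n%n≡0 s q)))
            , transport (ℕₚ.<⇒≤ i<k) i<k (cong (δ (toℕ t)) (sym (1+i/q i q ≢0)))
        ... | yes ≡0 with suc i / q in s≡ | trans (m≡m%n+[m/n]*n (suc i) q) (cong (ℕ._+ suc i / q ℕ.* q) ≡0)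
        ...   | zero  | ()
        ...   | suc s | 1+i≡ with ℕₚ.≤-<-connex (suc s) w
        ...     | inj₁ s<w = φ (s ℕ.* q) , close s i s<w 1+i≡ , transport (ℕₚ.<⇒≤ i<k)
                    (ℕₚ.≤-trans (ℕₚ.m≤n+m (s ℕ.* q) q) (ℕₚ.≤-trans (ℕₚ.≤-reflexive (sym 1+i≡)) i<k))
                    (cong (δ (toℕ t)) (trans (/-unique i (ℕ.pred q) s (ℕₚ.≤-reflexive (ℕₚ.suc-pred q))
                      (ℕₚ.suc-injective (trans 1+i≡ (cong (ℕ._+ s ℕ.* q) (sym (ℕₚ.suc-pred q)))))) (sym (m*n/n≡m s q))))
        -- Beyond the last loop a multiple of q is no boundary: the path simply goes on, and the
        -- indicator is 0 on both sides.
        ...     | inj₂ w≤s = φ (suc i) , along i i<k (λ s′ s′≤w eq → ℕₚ.<⇒≢ (ℕₚ.≤-<-trans (ℕₚ.*-monoˡ-≤ q s′≤w) (ℕₚ.*-monoˡ-< q w≤s)) (trans (sym eq) 1+i≡))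
            , transport (ℕₚ.<⇒≤ i<k) i<k (trans (outside i wq≤i) (sym (outside (suc i) (ℕₚ.m≤n⇒m≤1+n wq≤i))))
          where
          wq≤i : w ℕ.* q ℕ.≤ i
          wq≤i = ℕ.s≤s⁻¹ (ℕₚ.<-≤-trans (ℕₚ.*-monoˡ-< q w≤s) (ℕₚ.≤-reflexive (sym 1+i≡)))

      basis : Vector (Vector ℚ n) w
      basis t = fromProfile k (loop t)

      combine : Vector ℚ w → ℕ → ℚ
      combine x z = sum (λ t → x t * loop t z)

      linComb-basis : ∀ x j → linComb x basis j ≡ fromProfile k (combine x) j
      linComb-basis x j = begin
        sum (λ t → x t * (loop t p - loop t z)) ≡⟨ sum-cong-≋ (λ t → lemma (x t) (loop t p) (loop t z)) ⟩
        sum (λ t → x t * loop t p + (- 1ℚ) * (x t * loop t z)) ≡⟨ ∑-distrib-+ (λ t → x t * loop t p) (λ t → (- 1ℚ) * (x t * loop t z)) ⟩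
        combine x p + sum (λ t → (- 1ℚ) * (x t * loop t z)) ≡⟨ cong (combine x p +_) (sym (*-distribˡ-sum (- 1ℚ) (λ t → x t * loop t z))) ⟩
        combine x p + (- 1ℚ) * combine x z ≡⟨ lemma′ (combine x p) (combine x z) ⟩
        combine x p - combine x z ∎
        where
        open ≡-Reasoning
        z = toℕ j
        p = suc (z % k)
        lemma : ∀ x a b → x * (a - b) ≡ x * a + (- 1ℚ) * (x * b)
        lemma = solve-∀ ℚ-ring
        lemma′ : ∀ a b → a + (- 1ℚ) * b ≡ a - b
        lemma′ = solve-∀ ℚ-ring

      combine-φ : ∀ x i → i ℕ.≤ k → combine x (φ i) ≡ ext x (i / q)
      combine-φ x i i≤k = trans (sum-cong-≋ (λ t → cong (x t *_) (loop-φ t i i≤k))) (sum-δ x (i / q))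

      t*q≤k : ∀ (t : Fin w) → toℕ t ℕ.* q ℕ.≤ k
      t*q≤k t = ℕₚ.≤-trans (ℕₚ.*-monoˡ-≤ q (ℕₚ.<⇒≤ (toℕ<n t))) w*q≤k

      independent : ∀ x → (∀ j → linComb x basis j ≡ 0ℚ) → ∀ t → x t ≡ 0ℚ
      independent x vanish t = begin
        x t ≡⟨ sym (ext-toℕ x t) ⟩
        ext x (toℕ t) ≡⟨ cong (ext x) (sym (m*n/n≡m (toℕ t) q)) ⟩
        ext x (toℕ t ℕ.* q / q) ≡⟨ sym (combine-φ x (toℕ t ℕ.* q) (t*q≤k t)) ⟩
        combine x (φ (toℕ t ℕ.* q)) ≡⟨ zeros _ (φ≤k _ (t*q≤k t)) ⟩
        0ℚ ∎
        where
        open ≡-Reasoning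
        -- The first k entries are the differences c (z + 1) - c z, so their vanishing carries c 0 =
        -- 0 to all of 0, ..., k; n > k makes all of them available.
        zeros : ∀ z → z ℕ.≤ k → combine x z ≡ 0ℚ
        zeros zero    _   = sum-zero _ (λ t → trans (cong (x t *_) (Profile.c-0 (loop-profile t))) (*-zeroʳ (x t)))
        zeros (suc z) z<k = trans (-≡0⇒≡ (trans (cong (λ y → combine x (suc y) - combine x z) (sym (m<n⇒m%n≡m z<k)))
          (subst (λ y → combine x (suc (y % k)) - combine x y ≡ 0ℚ) (toℕ-fromℕ< z<n)
            (trans (sym (linComb-basis x (fromℕ< z<n))) (vanish (fromℕ< z<n)))))) (zeros z (ℕₚ.<⇒≤ z<k))
          where z<n = ℕₚ.<-trans z<k k<n

      along-loop : ∀ {c} → Profile n k c → ∀ b s → b ℕ.< w → s ℕ.< q → c (φ (s ℕ.+ b ℕ.* q)) ≡ c (φ (b ℕ.* q))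
      along-loop profile b zero    b<w s<q = refl
      along-loop {c} profile b (suc s) b<w 1+s<q = trans (sym (follow profile i<k (along i i<k λ t t≤w eq →
        contradiction (trans (sym (m<n⇒m%n≡m 1+s<q)) (trans (sym ([m+kn]%n≡m%n (suc s) b q)) (trans (cong (_% q) eq) (m*n%n≡0 t q)))) λ ())))
        (along-loop profile b s b<w (ℕₚ.<-trans (ℕₚ.n<1+n s) 1+s<q))
        where
        i = s ℕ.+ b ℕ.* q
        i<k : i ℕ.< k
        i<k = ℕₚ.<-≤-trans (ℕₚ.+-monoˡ-< (b ℕ.* q) (ℕₚ.<-trans (ℕₚ.n<1+n s) 1+s<q)) (ℕₚ.≤-trans (ℕₚ.*-monoˡ-≤ q b<w) w*q≤k)

      along-path : ∀ {c} → Profile n k c → ∀ d i → w ℕ.* q ℕ.≤ i → d ℕ.+ i ≡ k → c (φ i) ≡ 0ℚ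
      along-path {c} profile zero    i wq≤i refl = trans (cong c φ-k) (Profile.c-0 profile)
      along-path {c} profile (suc d) i wq≤i d+i≡ = trans (follow profile i<k (along i i<k λ t t≤w eq →
        ℕₚ.<⇒≢ (s≤s (ℕₚ.≤-trans (ℕₚ.*-monoˡ-≤ q t≤w) wq≤i)) (sym eq)))
        (along-path profile d (suc i) (ℕₚ.m≤n⇒m≤1+n wq≤i) (trans (ℕₚ.+-suc d i) d+i≡))
        where
        i<k : i ℕ.< k
        i<k = subst (suc i ℕ.≤_) d+i≡ (s≤s (ℕₚ.m≤n+m i d))

      -- The profile of v is constant on each loop and 0 on the path that ends at 0, so its values
      -- at the starting points of the loops are the coefficients.
      spanning : ∀ v → Kernel (A n k) v → ∃ λ x → ∀ j → v j ≡ linComb x basis j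
      spanning v v∈ = x , λ j → trans (v≡ j) (trans (cong₂ _-_ (c≡ (suc (toℕ j % k))) (c≡ (toℕ j))) (sym (linComb-basis x j)))
        where
        c = proj₁ (kernel⇒profile v v∈)
        profile = proj₁ (proj₂ (kernel⇒profile v v∈))
        v≡ = proj₂ (proj₂ (kernel⇒profile v v∈))
        open Profile profile
        x : Vector ℚ w
        x t = c (φ (toℕ t ℕ.* q))

        ext-x : ∀ s → s ℕ.< w → ext x s ≡ c (φ (s ℕ.* q))
        ext-x s s<w = ext-∘toℕ {w} (λ s → c (φ (s ℕ.* q))) s s<w

        on-φ : ∀ i → i ℕ.≤ k → c (φ i) ≡ ext x (i / q)
        on-φ i i≤k with ℕₚ.≤-<-connex w (i / q)
        ... | inj₂ <w = trans (cong (c ∘ φ) (m≡m%n+[m/n]*n i q)) (trans (along-loop profile (i / q) (i % q) <w (m%n<n i q)) (sym (ext-x (i / q) <w)))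
        ... | inj₁ w≤ = trans (along-path profile (k ℕ.∸ i) i (ℕₚ.≤-trans (ℕₚ.*-monoˡ-≤ q w≤) (m/n*n≤m i q)) (ℕₚ.m∸n+n≡m i≤k)) (sym (ext-≥ x (i / q) w≤))

        c≡ : ∀ z → c z ≡ combine x z
        c≡ z = begin
          c z ≡⟨ reduce periodic z ⟩
          c (z % K) ≡⟨ cong c (sym (φ-inverse z)) ⟩
          c (φ (inverse z)) ≡⟨ on-φ (inverse z) (inverse≤k z) ⟩
          ext x (inverse z / q) ≡⟨ sym (sum-δ x (inverse z / q)) ⟩
          combine x z ∎
          where open ≡-Reasoning

    nullity-loops : nullity (A n k) ≡ w
    nullity-loops = nullity-unique (A n k) basis record
      { members = λ t → profile⇒kernel (loop-profile t) ; independent = independent ; spanning = spanning }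

-- Fractions as labels, and the distinctness of their positions.

module Labels where
  open import Data.Nat
  open import Data.Nat.Properties
  open import Data.Nat.DivMod
  open import Data.Nat.GCD
  open import Data.Nat.Coprimality using (Coprime; coprime-/gcd)
  open import Data.Nat.Tactic.RingSolver using (solve-∀)
  open import Data.Product using (_×_; _,_; proj₁; proj₂)
  open import Data.Sum using (inj₁; inj₂)
  open import Relation.Binary.PropositionalEquality
  open import Relation.Binary.Definitions using (tri<; tri≈; tri>)
  open import Relation.Nullary using (contradiction)
  open NatSum hiding (le)

  Σ<-extend : ∀ {b} a {f f′} c → b ≤ a → (∀ x → x < a → f x ≤ f′ x) → Σ< b f + c ≤ Σ< b f′ → Σ< a f + c ≤ Σ< a f′
  Σ<-extend zero    c z≤n f≤f′ le = le
  Σ<-extend (suc a) {f} {f′} c b≤ f≤f′ le with m≤n⇒m<n∨m≡n b≤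
  ... | inj₂ refl = le
  ... | inj₁ b<   = ≤-trans (≤-reflexive (lemma (Σ< a f) (f a) c))
    (+-mono-≤ (Σ<-extend a c (s≤s⁻¹ b<) (λ x x<a → f≤f′ x (m<n⇒m<1+n x<a)) le) (f≤f′ a (n<1+n a)))
    where
    lemma : ∀ x y c → x + y + c ≡ x + c + y
    lemma = solve-∀

  -- The spacing is `suc q`. The strict places are its multiples, moved down by one because index x
  -- stands for x + 1 in the sums of floors.
  Σ<-strict : ∀ k q g {f f′} → (∀ x → x < k → f x ≤ f′ x) → g * suc q ≤ k →
              (∀ t → t < g → f (q + t * suc q) < f′ (q + t * suc q)) → Σ< k f + g ≤ Σ< k f′
  Σ<-strict k q zero    {f} f≤f′ _   f<f′ = ≤-trans (≤-reflexive (+-identityʳ (Σ< k f))) (Σ<-mono k f≤f′)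
  Σ<-strict k q (suc g) {f} {f′} f≤f′ gq≤k f<f′ = Σ<-extend k (suc g) gq≤k f≤f′
    (≤-trans (≤-reflexive (lemma (Σ< b f) (f b) g))
      (+-mono-≤ (Σ<-strict b q g (λ x x<b → f≤f′ x (<-trans x<b gq≤k)) (m≤n+m (g * suc q) q) (λ t t<g → f<f′ t (m<n⇒m<1+n t<g)))
        (f<f′ g (n<1+n g))))
    where
    b = q + g * suc q
    lemma : ∀ x y g → x + y + suc g ≡ x + g + suc y
    lemma = solve-∀

  triangle : ∀ k → Σ< k (λ x → x) + Σ< k (λ x → x) + k ≡ k * k
  triangle zero    = refl
  triangle (suc k) = trans (lemma (Σ< k (λ x → x)) k) (trans (cong (λ z → z + suc (k + k)) (triangle k)) (lemma′ k))
    where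
    lemma : ∀ s k → s + k + (s + k) + suc k ≡ s + s + k + suc (k + k)
    lemma = solve-∀
    lemma′ : ∀ k → k * k + suc (k + k) ≡ suc k * suc k
    lemma′ = solve-∀

  Label : Set
  Label = ℕ × ℕ

  -- (i , l) stands for the fraction i/(l+1).
  denominator : Label → ℕ
  denominator (i , l) = suc l

  order : Label → ℕ
  order (i , l) = gcd i (suc l)

  floor : Label → ℕ → ℕ
  floor (i , l) x = suc x * i / suc l

  floors : ℕ → Label → ℕ
  floors k v = Σ< k (floor v)

  infix 4 _≺_ _≼_

  _≺_ _≼_ : Label → Label → Set
  (i , l) ≺ (i′ , l′) = i * suc l′ < i′ * suc l
  (i , l) ≼ (i′ , l′) = i * suc l′ ≤ i′ * suc l

  floor-≤ : ∀ v x → floor v x * denominator v ≤ suc x * proj₁ v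
  floor-≤ (i , l) x = m/n*n≤m (suc x * i) (suc l)

  <-floor : ∀ v x → suc x * proj₁ v < suc (floor v x) * denominator v
  <-floor (i , l) x = subst (_< suc (suc x * i / suc l) * suc l) (sym (m≡m%n+[m/n]*n (suc x * i) (suc l)))
    (+-monoˡ-< (suc x * i / suc l * suc l) (m%n<n (suc x * i) (suc l)))

  floor-≥ : ∀ v x y → y * denominator v ≤ suc x * proj₁ v → y ≤ floor v x
  floor-≥ (i , l) x y le = subst (_≤ suc x * i / suc l) (m*n/n≡m y (suc l)) (/-monoˡ-≤ (suc l) le)

  floor-mono : ∀ v v′ x → v ≼ v′ → floor v x ≤ floor v′ x
  floor-mono v@(i , l) v′@(i′ , l′) x v≼v′ = floor-≥ v′ x f (*-cancelʳ-≤ (f * suc l′) (suc x * i′) (suc l) (begin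
    f * suc l′ * suc l ≡⟨ lemma f (suc l′) (suc l) ⟩
    f * suc l * suc l′ ≤⟨ *-monoˡ-≤ (suc l′) (floor-≤ v x) ⟩
    suc x * i * suc l′ ≡⟨ *-assoc (suc x) i (suc l′) ⟩
    suc x * (i * suc l′) ≤⟨ *-monoʳ-≤ (suc x) v≼v′ ⟩
    suc x * (i′ * suc l) ≡⟨ sym (*-assoc (suc x) i′ (suc l)) ⟩
    suc x * i′ * suc l ∎))
    where
    open ≤-Reasoning
    f = floor v x
    lemma : ∀ a b c → a * b * c ≡ a * c * b
    lemma = solve-∀

  module Reduced (i l : ℕ) where
    g = gcd i (suc l)

    g≢0 : g ≢ 0
    g≢0 = gcd[m,n]≢0 i (suc l) (inj₂ λ ())

    g-nonZero : NonZero g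
    g-nonZero = ≢-nonZero g≢0

    p q : ℕ
    p = (i / g) {{g-nonZero}}
    q = (suc l / g) {{g-nonZero}}

    p*g≡ : p * g ≡ i
    p*g≡ = m/n*n≡m {{g-nonZero}} (gcd[m,n]∣m i (suc l))

    q*g≡ : q * g ≡ suc l
    q*g≡ = m/n*n≡m {{g-nonZero}} (gcd[m,n]∣n i (suc l))

    q-nonZero : NonZero q
    q-nonZero = ≢-nonZero λ q≡0 → contradiction (trans (sym q*g≡) (cong (_* g) q≡0)) λ ()

    coprime : Coprime p q
    coprime = coprime-/gcd i (suc l) {{g-nonZero}}

    g≤ : g ≤ suc l
    g≤ = gcd[m,n]≤n i (suc l)

    q≤ : q ≤ suc l
    q≤ = m/n≤m (suc l) g {{g-nonZero}}

    private
      q*g-nonZero : NonZero (q * g)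
      q*g-nonZero = m*n≢0 q g {{q-nonZero}} {{g-nonZero}}

    floor-reduced : ∀ x → (suc x * p / q) {{q-nonZero}} ≡ floor (i , l) x
    floor-reduced x = sym (trans (/-congˡ {o = suc l} (trans (cong (suc x *_) (sym p*g≡)) (sym (*-assoc (suc x) p g))))
      (trans (/-congʳ {{_}} {{q*g-nonZero}} (sym q*g≡)) (m*n/o*n≡m/o (suc x * p) g q {{q-nonZero}} {{q*g-nonZero}})))

    q-1 = pred q

    multiple : ∀ t → suc (q-1 + t * suc q-1) ≡ suc t * q
    multiple t = trans (cong (λ z → z + t * z) (suc-pred q {{q-nonZero}})) refl

    -- The multiples of the reduced denominator are where xi/(l+1) is an integer.
    at-multiple : ∀ t → suc (q-1 + t * suc q-1) * i ≡ suc t * p * suc l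
    at-multiple t = begin
      suc (q-1 + t * suc q-1) * i ≡⟨ cong₂ _*_ (multiple t) (sym p*g≡) ⟩
      suc t * q * (p * g) ≡⟨ lemma (suc t) q p g ⟩
      suc t * p * (q * g) ≡⟨ cong (suc t * p *_) q*g≡ ⟩
      suc t * p * suc l ∎
      where
      open ≡-Reasoning
      lemma : ∀ t q p g → t * q * (p * g) ≡ t * p * (q * g)
      lemma = solve-∀

    g*q≡ : g * suc q-1 ≡ suc l
    g*q≡ = trans (cong (g *_) (suc-pred q {{q-nonZero}})) (trans (*-comm g q) q*g≡)

  -- Where x is a multiple of the reduced denominator of v′, the number x v′ is an integer, so a
  -- smaller slope has a strictly smaller floor. There are `order v′` such multiples up to
  -- `denominator v′`, hence up to k.
  floors-≺ : ∀ k v v′ → denominator v′ ≤ k → v ≺ v′ → floors k v + order v′ ≤ floors k v′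
  floors-≺ k v@(i , l) v′@(i′ , l′) l′<k v≺v′ = Σ<-strict k q-1 g (λ x _ → floor-mono v v′ x (<⇒≤ v≺v′))
    (≤-trans (≤-reflexive g*q≡) l′<k)
    (λ t _ → <-≤-trans (*-cancelʳ-< (suc l * suc l′) (floor v (x t)) (suc t * p) (strictly t))
      (floor-≥ v′ (x t) (suc t * p) (≤-reflexive (sym (at-multiple t)))))
    where
    open Reduced i′ l′
    open ≤-Reasoning
    x : ℕ → ℕ
    x t = q-1 + t * suc q-1
    strictly : ∀ t → floor v (x t) * (suc l * suc l′) < suc t * p * (suc l * suc l′)
    strictly t = begin-strict
      floor v (x t) * (suc l * suc l′) ≡⟨ sym (*-assoc (floor v (x t)) (suc l) (suc l′)) ⟩
      floor v (x t) * suc l * suc l′ ≤⟨ *-monoˡ-≤ (suc l′) (floor-≤ v (x t)) ⟩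
      suc (x t) * i * suc l′ ≡⟨ *-assoc (suc (x t)) i (suc l′) ⟩
      suc (x t) * (i * suc l′) <⟨ *-monoʳ-< (suc (x t)) v≺v′ ⟩
      suc (x t) * (i′ * suc l) ≡⟨ sym (*-assoc (suc (x t)) i′ (suc l)) ⟩
      suc (x t) * i′ * suc l ≡⟨ cong (_* suc l) (at-multiple t) ⟩
      suc t * p * suc l′ * suc l ≡⟨ lemma (suc t * p) (suc l′) (suc l) ⟩
      suc t * p * (suc l * suc l′) ∎
      where
      lemma : ∀ a b c → a * b * c ≡ a * (c * b)
      lemma = solve-∀

  Valid : ℕ → Label → Set
  Valid k (i , l) = i ≤ l × l < k

  0<order : ∀ v → 0 < order v
  0<order (i , l) = n≢0⇒n>0 (Reduced.g≢0 i l)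

  order≤k : ∀ {k v} → Valid k v → order v ≤ k
  order≤k {v = i , l} (_ , l<k) = ≤-trans (Reduced.g≤ i l) l<k

  floors-≡ : ∀ k v v′ → v ≼ v′ → v′ ≼ v → floors k v ≡ floors k v′
  floors-≡ k v v′ ≼ ≽ = Σ<-cong k (λ x _ → ≤-antisym (floor-mono v v′ x ≼) (floor-mono v′ v x ≽))

  floors-clash : ∀ {k} v v′ → floors k v + order v′ ≤ floors k v′ →
                 floors k v + floors k v + order v′ < floors k v′ + floors k v′ + order v
  floors-clash {k} v v′ le = begin-strict
    F + F + order v′ ≡⟨ +-assoc F F (order v′) ⟩
    F + (F + order v′) ≤⟨ +-mono-≤ (m+n≤o⇒m≤o F le) le ⟩
    F′ + F′ <⟨ m<m+n (F′ + F′) (0<order v) ⟩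
    F′ + F′ + order v ∎
    where
    open ≤-Reasoning
    F = floors k v
    F′ = floors k v′

  -- This is the injectivity of 2F - order, the quantity on which both positions depend, with the
  -- subtraction cleared. Different slopes are separated by `floors-≺`; equal slopes have equal F,
  -- hence equal orders, and slope and order determine the label.
  floors-injective : ∀ {k} v v′ → Valid k v → Valid k v′ →
                     floors k v + floors k v + order v′ ≡ floors k v′ + floors k v′ + order v → v ≡ v′
  floors-injective {k} v@(i , l) v′@(i′ , l′) (_ , l<k) (_ , l′<k) eq with <-cmp (i * suc l′) (i′ * suc l)
  ... | tri< v≺v′ _ _ = contradiction eq (<⇒≢ (floors-clash {k} v v′ (floors-≺ k v v′ l′<k v≺v′)))
  ... | tri> _ _ v′≺v = contradiction (sym eq) (<⇒≢ (floors-clash {k} v′ v (floors-≺ k v′ v l<k v′≺v)))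
  ... | tri≈ _ same _ = cong₂ _,_ (*-cancelʳ-≡ i i′ (suc l) (trans (cong (λ z → i * z) sl≡) same)) (suc-injective sl≡)
    where
    g≡ : order v′ ≡ order v
    g≡ = +-cancelˡ-≡ (floors k v + floors k v) _ _ (trans eq (cong (λ z → z + z + order v)
      (sym (floors-≡ k v v′ (≤-reflexive same) (≤-reflexive (sym same))))))
    sl≡ : suc l ≡ suc l′
    sl≡ = *-cancelʳ-≡ (suc l) (suc l′) (order v′) {{≢-nonZero (Reduced.g≢0 i′ l′)}} (begin
      suc l * order v′ ≡⟨ c*gcd[m,n]≡gcd[cm,cn] (suc l) i′ (suc l′) ⟩
      gcd (suc l * i′) (suc l * suc l′) ≡⟨ cong₂ gcd (trans (*-comm (suc l) i′) (trans (sym same) (*-comm i (suc l′)))) (*-comm (suc l) (suc l′)) ⟩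
      gcd (suc l′ * i) (suc l′ * suc l) ≡⟨ sym (c*gcd[m,n]≡gcd[cm,cn] (suc l′) i (suc l)) ⟩
      suc l′ * order v ≡⟨ cong (suc l′ *_) (sym g≡) ⟩
      suc l′ * order v′ ∎)
      where open ≡-Reasoning

  module Complementary (v v′ : Label) where
    i  = proj₁ v
    i′ = proj₁ v′
    s  = denominator v
    s′ = denominator v′
    instance
      s*s′-nonZero : NonZero (s * s′)
      s*s′-nonZero = m*n≢0 s s′

    cross : ∀ X → X * i * s′ + X * i′ * s ≡ X * (i * s′ + i′ * s)
    cross X = lemma X i s′ i′ s
      where
      lemma : ∀ X i s′ i′ s → X * i * s′ + X * i′ * s ≡ X * (i * s′ + i′ * s)
      lemma = solve-∀

    scale : ∀ f f′ → f * s * s′ + f′ * s′ * s ≡ (f + f′) * (s * s′)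
    scale f f′ = lemma f s s′ f′
      where
      lemma : ∀ f s s′ f′ → f * s * s′ + f′ * s′ * s ≡ (f + f′) * (s * s′)
      lemma = solve-∀

    below : i * s′ + i′ * s < s * s′ → ∀ x → floor v x + floor v′ x ≤ x
    below lt x = s≤s⁻¹ (*-cancelʳ-< (s * s′) (f + f′) (suc x) (begin-strict
      (f + f′) * (s * s′) ≡⟨ sym (scale f f′) ⟩
      f * s * s′ + f′ * s′ * s ≤⟨ +-mono-≤ (*-monoˡ-≤ s′ (floor-≤ v x)) (*-monoˡ-≤ s (floor-≤ v′ x)) ⟩
      suc x * i * s′ + suc x * i′ * s ≡⟨ cross (suc x) ⟩
      suc x * (i * s′ + i′ * s) <⟨ *-monoʳ-< (suc x) lt ⟩
      suc x * (s * s′) ∎))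
      where
      open ≤-Reasoning
      f  = floor v x
      f′ = floor v′ x

    above : s * s′ ≤ i * s′ + i′ * s → ∀ x y → suc x * i′ ≤ y * s′ → x < floor v x + y
    above ge x y le = s≤s⁻¹ (*-cancelʳ-< (s * s′) (suc x) (suc f + y) (begin-strict
      suc x * (s * s′) ≤⟨ *-monoʳ-≤ (suc x) ge ⟩
      suc x * (i * s′ + i′ * s) ≡⟨ sym (cross (suc x)) ⟩
      suc x * i * s′ + suc x * i′ * s <⟨ +-mono-<-≤ (*-monoˡ-< s′ (<-floor v x)) (*-monoˡ-≤ s le) ⟩
      suc f * s * s′ + y * s′ * s ≡⟨ scale (suc f) y ⟩
      (suc f + y) * (s * s′) ∎))
      where
      open ≤-Reasoning
      f = floor v x

    -- When v + v′ ≥ 1, rounding both multiples of X down loses at most one from X. For the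
    -- `order v′` values of X at which X v′ is an integer there is only one rounding, and nothing is
    -- lost.
    above-sum : ∀ k → s′ ≤ k → s * s′ ≤ i * s′ + i′ * s → Σ< k (λ x → x) + order v′ ≤ floors k v + floors k v′
    above-sum k s′≤k ge = subst (Σ< k (λ x → x) + order v′ ≤_) (Σ<-+ k (floor v) (floor v′))
      (Σ<-strict k R.q-1 R.g
        (λ x _ → s≤s⁻¹ (≤-trans (above ge x (suc (floor v′ x)) (<⇒≤ (<-floor v′ x))) (≤-reflexive (+-suc (floor v x) (floor v′ x)))))
        (≤-trans (≤-reflexive R.g*q≡) s′≤k)
        (λ t _ → let x = R.q-1 + t * suc R.q-1 in <-≤-trans (above ge x (suc t * R.p) (≤-reflexive (R.at-multiple t)))
          (+-monoʳ-≤ (floor v x) (floor-≥ v′ x (suc t * R.p) (≤-reflexive (sym (R.at-multiple t)))))))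
      where module R = Reduced (proj₁ v′) (proj₂ v′)

  -- The m = n + k at which the nullity will be order v - 1, respectively order v.
  rightPosition leftPosition : ℕ → Label → ℕ
  rightPosition k v = floors k v + floors k v + suc k ∸ order v
  leftPosition  k v = k * suc k + order v ∸ (floors k v + floors k v + k)

  floors-bound : ∀ k v → Valid k v → floors k v + floors k v + k ≤ k * k
  floors-bound k v@(i , l) (i≤l , _) = subst (floors k v + floors k v + k ≤_) (triangle k) (+-monoˡ-≤ k (+-mono-≤ le le))
    where
    le : floors k v ≤ Σ< k (λ x → x)
    le = Σ<-mono k (λ x _ → s≤s⁻¹ (m<n*o⇒m/o<n {n = suc x} {o = suc l} (*-monoʳ-< (suc x) (s≤s i≤l))))

  rightPosition≡ : ∀ k v → Valid k v → rightPosition k v + order v ≡ floors k v + floors k v + suc k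
  rightPosition≡ k v valid = m∸n+n≡m (≤-trans (order≤k {k} {v} valid) (≤-trans (n≤1+n k) (m≤n+m (suc k) (floors k v + floors k v))))

  k*k≤ : ∀ k → k * k ≤ k * suc k
  k*k≤ k = *-monoʳ-≤ k (n≤1+n k)

  leftPosition≡ : ∀ k v → Valid k v → leftPosition k v + (floors k v + floors k v + k) ≡ k * suc k + order v
  leftPosition≡ k v valid = m∸n+n≡m (≤-trans (floors-bound k v valid) (≤-trans (k*k≤ k) (m≤m+n (k * suc k) (order v))))

  rightPosition≤ : ∀ k v → Valid k v → rightPosition k v ≤ k * suc k
  rightPosition≤ k v valid = ≤-trans (s≤s⁻¹ (begin
      suc (rightPosition k v) ≡⟨ +-comm 1 (rightPosition k v) ⟩
      rightPosition k v + 1 ≤⟨ +-monoʳ-≤ (rightPosition k v) (0<order v) ⟩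
      rightPosition k v + order v ≡⟨ rightPosition≡ k v valid ⟩
      floors k v + floors k v + suc k ≡⟨ +-suc (floors k v + floors k v) k ⟩
      suc (floors k v + floors k v + k) ≤⟨ s≤s (floors-bound k v valid) ⟩
      suc (k * k) ∎)) (k*k≤ k)
    where open ≤-Reasoning

  leftPosition≤ : ∀ k v → Valid k v → leftPosition k v ≤ k * suc k
  leftPosition≤ k v valid = +-cancelʳ-≤ (order v) (leftPosition k v) (k * suc k) (≤-trans
    (+-monoʳ-≤ (leftPosition k v) (≤-trans (order≤k {k} {v} valid) (m≤n+m k (floors k v + floors k v))))
    (≤-reflexive (leftPosition≡ k v valid)))

  rightPosition-injective : ∀ {k} v v′ → Valid k v → Valid k v′ → rightPosition k v ≡ rightPosition k v′ → v ≡ v′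
  rightPosition-injective {k} v v′ valid valid′ eq = floors-injective v v′ valid valid′
    (+-cancelʳ-≡ (m + suc k) _ _ (trans (lemma (floors k v) m (order v′) k) (trans
      (cong₂ _+_ (trans (sym (rightPosition≡ k v valid)) (cong (_+ order v) eq)) (rightPosition≡ k v′ valid′))
      (lemma′ (floors k v′) m (order v) k))))
    where
    m = rightPosition k v′
    lemma : ∀ F m g k → F + F + g + (m + suc k) ≡ (F + F + suc k) + (m + g)
    lemma = solve-∀
    lemma′ : ∀ F m g k → (m + g) + (F + F + suc k) ≡ F + F + g + (m + suc k)
    lemma′ = solve-∀

  leftPosition-injective : ∀ {k} v v′ → Valid k v → Valid k v′ → leftPosition k v ≡ leftPosition k v′ → v ≡ v′
  leftPosition-injective {k} v v′ valid valid′ eq = floors-injective v v′ valid valid′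
    (+-cancelʳ-≡ (m + k * suc k + k) _ _ (trans (lemma (floors k v) m (order v′) k) (trans
      (cong₂ _+_ (trans (cong (_+ (floors k v + floors k v + k)) (sym eq)) (leftPosition≡ k v valid)) (sym (leftPosition≡ k v′ valid′)))
      (lemma′ (floors k v′) m (order v) k))))
    where
    m = leftPosition k v′
    lemma : ∀ F m g k → F + F + g + (m + k * suc k + k) ≡ (m + (F + F + k)) + (k * suc k + g)
    lemma = solve-∀
    lemma′ : ∀ F m g k → (k * suc k + g) + (m + (F + F + k)) ≡ F + F + g + (m + k * suc k + k)
    lemma′ = solve-∀

  positions-total : ∀ {k} v v′ → Valid k v → Valid k v′ → rightPosition k v ≡ leftPosition k v′ →
    floors k v + floors k v′ + (floors k v + floors k v′) + (k + suc k) ≡ k * suc k + (order v + order v′)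
  positions-total {k} v v′ valid valid′ eq = +-cancelˡ-≡ (leftPosition k v′) _ _ (trans (lemma₁ (leftPosition k v′) (floors k v) (floors k v′) k)
    (trans (cong₂ _+_ (leftPosition≡ k v′ valid′) (trans (sym (rightPosition≡ k v valid)) (cong (_+ order v) eq)))
      (lemma₂ (k * suc k) (order v′) (leftPosition k v′) (order v))))
    where
    lemma₁ : ∀ m F F′ k → m + (F + F′ + (F + F′) + (k + suc k)) ≡ m + (F′ + F′ + k) + (F + F + suc k)
    lemma₁ = solve-∀
    lemma₂ : ∀ K g′ m g → K + g′ + (m + g) ≡ m + (K + (g + g′))
    lemma₂ = solve-∀

  -- A coincidence reads 2 (F + F′) + 2k + 1 = k (k + 1) + order v + order v′. If v + v′ < 1, the
  -- left side is at most k (k + 1) + 1; otherwise `above-sum`, used once for each slope, makes it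
  -- exceed the right side.
  positions-disjoint : ∀ {k} v v′ → Valid k v → Valid k v′ → rightPosition k v ≢ leftPosition k v′
  positions-disjoint {k} v v′ valid valid′ eq with <-≤-connex (proj₁ v * denominator v′ + proj₁ v′ * denominator v) (denominator v * denominator v′)
  ... | inj₁ lt = contradiction (+-cancelˡ-≤ (k * suc k) 2 1 (begin
      k * suc k + 2 ≤⟨ +-monoʳ-≤ (k * suc k) (+-mono-≤ (0<order v) (0<order v′)) ⟩
      k * suc k + (order v + order v′) ≡⟨ sym (positions-total v v′ valid valid′ eq) ⟩
      F + F′ + (F + F′) + (k + suc k) ≤⟨ +-monoˡ-≤ (k + suc k) (+-mono-≤ F+F′≤ F+F′≤) ⟩
      S + S + (k + suc k) ≡⟨ lemma S k ⟩
      S + S + k + suc k ≡⟨ cong (_+ suc k) (triangle k) ⟩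
      k * k + suc k ≡⟨ lemma′ k ⟩
      k * suc k + 1 ∎)) λ { (s≤s ()) }
    where
    open ≤-Reasoning
    F  = floors k v
    F′ = floors k v′
    S  = Σ< k (λ x → x)
    F+F′≤ : F + F′ ≤ S
    F+F′≤ = ≤-trans (≤-reflexive (sym (Σ<-+ k (floor v) (floor v′)))) (Σ<-mono k (λ x _ → Complementary.below v v′ lt x))
    lemma : ∀ S k → S + S + (k + suc k) ≡ S + S + k + suc k
    lemma = solve-∀
    lemma′ : ∀ k → k * k + suc k ≡ k * suc k + 1
    lemma′ = solve-∀
  ... | inj₂ ge = contradiction (positions-total v v′ valid valid′ eq) (>⇒≢ (begin-strict
      k * suc k + (order v + order v′) <⟨ n<1+n _ ⟩
      suc (k * suc k + (order v + order v′)) ≡⟨ lemma′ k (order v) (order v′) ⟩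
      k * k + suc k + (order v + order v′) ≡⟨ cong (λ z → z + suc k + (order v + order v′)) (sym (triangle k)) ⟩
      S + S + k + suc k + (order v + order v′) ≡⟨ lemma S k (order v) (order v′) ⟩
      (S + order v′) + (S + order v) + (k + suc k) ≤⟨ +-monoˡ-≤ (k + suc k) (+-mono-≤
          (Complementary.above-sum v v′ k (proj₂ valid′) ge)
          (≤-trans (Complementary.above-sum v′ v k (proj₂ valid) (≤-trans (≤-reflexive (*-comm (denominator v′) (denominator v))) (≤-trans ge (≤-reflexive (+-comm (proj₁ v * denominator v′) _)))))
            (≤-reflexive (+-comm F′ F)))) ⟩
      F + F′ + (F + F′) + (k + suc k) ∎))
    where
    open ≤-Reasoning
    F  = floors k v
    F′ = floors k v′
    S  = Σ< k (λ x → x)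
    lemma : ∀ S k g g′ → S + S + k + suc k + (g + g′) ≡ (S + g′) + (S + g) + (k + suc k)
    lemma = solve-∀
    lemma′ : ∀ k g g′ → suc (k * suc k + (g + g′)) ≡ k * k + suc k + (g + g′)
    lemma′ = solve-∀

-- Counting nullities by counting greatest common divisors.

module Count where
  open import Data.Integer.Base as ℤ using (+<+)
  import Data.Integer.Properties as ℤₚ
  open import Data.List.Base using (List; []; _∷_; _++_; map; length; upTo; filter)
  open import Data.List.Properties using (length-map; length-++; length-upTo; filter-≐; filter-accept; filter-reject)
  open import Data.List.Membership.Propositional using (_∈_)
  open import Data.List.Membership.Propositional.Properties
  open import Data.List.Relation.Unary.All as All using (All; []; _∷_)
  open import Data.List.Relation.Unary.Unique.Propositional using (Unique)
  import Data.List.Relation.Unary.Unique.Propositional.Properties as Unique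
  open import Data.List.Relation.Unary.AllPairs using ([]; _∷_)
  open import Data.Nat
  open import Data.Nat.Properties
  open import Data.Nat.DivMod
  open import Data.Nat.GCD
  open import Data.Nat.Tactic.RingSolver using (solve-∀)
  open import Data.Product using (_×_; _,_; proj₁; proj₂)
  open import Data.Sum using (inj₁; inj₂)
  open import Function.Base using (_∘_)
  open import Level using (0ℓ)
  open import Relation.Binary.PropositionalEquality
  open import Relation.Nullary using (yes; no; contradiction; ¬?; ¬_)
  open import Relation.Unary using (Pred; Decidable)
  open import Defs using (N; A; nullity; period; representative)
  open NatSum hiding (le)
  open Orbits
  open Nullity
  open ListCount
  open Labels

  nullity-position : ∀ {k m q w} .{{_ : NonZero q}} .{{_ : NonZero k}} → k + k < m → Loops k m q w → nullity (A (m ∸ k) k) ≡ w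
  nullity-position {k} {m} {q} {w} 2k<m loops = nullity-loops {n = m ∸ k} (m+n≤o⇒m≤o∸n (suc k) 2k<m)
    (subst (λ m → Loops k m q w) (sym (m∸n+n≡m (≤-trans (m≤m+n k k) (<⇒≤ 2k<m)))) loops)

  module _ {k : ℕ} .{{_ : NonZero k}} (v : Label) (valid : Valid k v) where
    private
      module R = Reduced (proj₁ v) (proj₂ v)
      q≤k : R.q ≤ k
      q≤k = ≤-trans R.q≤ (proj₂ valid)
      module S = Slope k R.p R.q {{R.q-nonZero}} q≤k R.coprime
      gq≤k : R.g * R.q ≤ k
      gq≤k = ≤-trans (≤-reflexive (trans (*-comm R.g R.q) R.q*g≡)) (proj₂ valid)
      floors≡ : S.floors ≡ floors k v
      floors≡ = Σ<-cong k λ x x<k → trans (S.L≡ (suc x) (s≤s (m<n⇒m<1+n x<k))) (R.floor-reduced x)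
      2F≡ : S.floors + S.floors ≡ floors k v + floors k v
      2F≡ = cong₂ _+_ floors≡ floors≡

    -- With w = order v - 1 the position 2F + k - w is `rightPosition`. The value w = order v is
    -- admissible too, since order times reduced denominator is the denominator; it is used in
    -- `nullity-left`, on the reflected side.
    nullity-right : k + k < rightPosition k v → nullity (A (rightPosition k v ∸ k) k) ≡ pred (order v)
    nullity-right 2k<m = nullity-position {{R.q-nonZero}} 2k<m (S.rightLoops (pred R.g) (≤-trans (*-monoˡ-≤ R.q (pred[n]≤n {R.g})) gq≤k) m
      (suc-injective (begin
        suc (m + pred R.g) ≡⟨ sym (+-suc m (pred R.g)) ⟩
        m + suc (pred R.g) ≡⟨ cong (m +_) (suc-pred R.g {{R.g-nonZero}}) ⟩
        m + order v ≡⟨ rightPosition≡ k v valid ⟩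
        floors k v + floors k v + suc k ≡⟨ +-comm (floors k v + floors k v) (suc k) ⟩
        suc (k + (floors k v + floors k v)) ≡⟨ cong (λ z → suc (k + z)) (sym 2F≡) ⟩
        suc (k + (S.floors + S.floors)) ∎)))
      where
      open ≡-Reasoning
      m = rightPosition k v

    nullity-left : k + k < leftPosition k v → nullity (A (leftPosition k v ∸ k) k) ≡ order v
    nullity-left 2k<m = nullity-position {{R.q-nonZero}} 2k<m (reflectLoops m (≤-<-trans z≤n 2k<m) sum≡
      (S.rightLoops R.g gq≤k m′ (trans m′+g≡ (trans (+-comm (floors k v + floors k v) k) (cong (k +_) (sym 2F≡))))))
      where
      m  = leftPosition k v
      m′ = floors k v + floors k v + k ∸ order v
      m′+g≡ : m′ + order v ≡ floors k v + floors k v + k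
      m′+g≡ = m∸n+n≡m (≤-trans (order≤k {k} {v} valid) (m≤n+m k (floors k v + floors k v)))
      sum≡ : m′ + m ≡ k * suc k
      sum≡ = +-cancelʳ-≡ (order v) _ _ (trans (lemma m′ m (order v)) (trans (cong (m +_) m′+g≡) (leftPosition≡ k v valid)))
        where
        lemma : ∀ a b c → a + b + c ≡ b + (a + c)
        lemma = solve-∀

  labels : ℕ → List Label
  labels zero    = []
  labels (suc k) = map (_, k) (upTo (suc k)) ++ labels k

  ∈-labels⁻ : ∀ {k v} → v ∈ labels k → Valid k v
  ∈-labels⁻ {suc k} v∈ with ∈-++⁻ (map (_, k) (upTo (suc k))) v∈
  ... | inj₁ v∈map with ∈-map⁻ (_, k) v∈map
  ...   | i , i∈ , refl = s≤s⁻¹ (∈-upTo⁻ i∈) , n<1+n k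
  ∈-labels⁻ {suc k} v∈ | inj₂ v∈labels = let (i≤l , l<k) = ∈-labels⁻ v∈labels in i≤l , m<n⇒m<1+n l<k

  ∈-labels⁺ : ∀ {k v} → Valid k v → v ∈ labels k
  ∈-labels⁺ {suc k} {i , l} (i≤l , l<1+k) with m≤n⇒m<n∨m≡n (s≤s⁻¹ l<1+k)
  ... | inj₁ l<k  = ∈-++⁺ʳ (map (_, k) (upTo (suc k))) (∈-labels⁺ (i≤l , l<k))
  ... | inj₂ refl = ∈-++⁺ˡ (∈-map⁺ (_, k) (∈-upTo⁺ (s≤s i≤l)))

  labels-unique : ∀ k → Unique (labels k)
  labels-unique zero    = []
  labels-unique (suc k) = Unique.++⁺ (Unique.map⁺ (cong proj₁) (Unique.upTo⁺ (suc k))) (labels-unique k)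
    λ (v∈map , v∈labels) → let (_ , _ , eq) = ∈-map⁻ (_, k) v∈map in <⇒≢ (proj₂ (∈-labels⁻ v∈labels)) (cong proj₂ eq)

  length-labels : ∀ k → length (labels k) + length (labels k) ≡ k * suc k
  length-labels zero    = refl
  length-labels (suc k) = trans (cong (λ z → z + z) (trans (length-++ (map (_, k) (upTo (suc k))))
      (cong (_+ length (labels k)) (trans (length-map (_, k) (upTo (suc k))) (length-upTo (suc k))))))
    (trans (lemma k (length (labels k))) (trans (cong (suc k + suc k +_) (length-labels k)) (lemma′ k)))
    where
    lemma : ∀ k n → suc k + n + (suc k + n) ≡ suc k + suc k + (n + n)
    lemma = solve-∀
    lemma′ : ∀ k → suc k + suc k + k * suc k ≡ suc k * suc (suc k)
    lemma′ = solve-∀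

  count : ∀ {A : Set} {P : Pred A 0ℓ} → Decidable P → List A → ℕ
  count P? xs = length (filter P? xs)

  count-complement : ∀ {A : Set} {P : Pred A 0ℓ} (P? : Decidable P) xs → count P? xs + count (¬? ∘ P?) xs ≡ length xs
  count-complement P? []       = refl
  count-complement P? (x ∷ xs) with P? x
  ... | yes _ = cong suc (count-complement P? xs)
  ... | no  _ = trans (+-suc _ _) (cong suc (count-complement P? xs))

  representative-> : ∀ {k n} .{{_ : NonZero k}} → k < n → representative (ℤ.+ n) k ≡ n
  representative-> {k} {n} k<n with ℤ.+ k ℤₚ.<? ℤ.+ n
  ... | yes _   = refl
  ... | no  k≮n = contradiction (+<+ k<n) k≮n

  period≡ : ∀ k → k * suc k ≡ period k
  period≡ k = trans (*-suc k k) (+-comm k (k * k))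

  module _ {k : ℕ} .{{_ : NonZero k}} {Q : Pred ℕ 0ℓ} (Q? : Decidable Q) where
    private
      right = map (rightPosition k) (filter (Q? ∘ pred ∘ order) (labels k))
      left  = map (leftPosition k) (filter (Q? ∘ order) (labels k))

      valid : ∀ {P : Pred Label 0ℓ} (P? : Decidable P) {v} → v ∈ filter P? (labels k) → Valid k v
      valid P? v∈ = ∈-labels⁻ (proj₁ (∈-filter⁻ P? v∈))

      unique : Unique (right ++ left)
      unique = Unique.++⁺
        (unique-map (rightPosition k) (λ u∈ v∈ → rightPosition-injective _ _ (valid (Q? ∘ pred ∘ order) u∈) (valid (Q? ∘ pred ∘ order) v∈))
          (Unique.filter⁺ (Q? ∘ pred ∘ order) (labels-unique k)))
        (unique-map (leftPosition k) (λ u∈ v∈ → leftPosition-injective _ _ (valid (Q? ∘ order) u∈) (valid (Q? ∘ order) v∈))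
          (Unique.filter⁺ (Q? ∘ order) (labels-unique k)))
        λ (m∈right , m∈left) → let (u , u∈ , eq) = ∈-map⁻ (rightPosition k) m∈right
                                   (v , v∈ , eq′) = ∈-map⁻ (leftPosition k) m∈left
                               in positions-disjoint u v (valid (Q? ∘ pred ∘ order) u∈) (valid (Q? ∘ order) v∈) (trans (sym eq) eq′)

      Q′? : Decidable (λ n → Q (N (ℤ.+ n) k))
      Q′? n = Q? (N (ℤ.+ n) k)

      -- Positions up to 2k belong to n ≤ k, where `N` is not the nullity of the matrix of size n.
      -- They are absorbed by a list of 2k + 1 dummy values.
      place : ∀ m → m ≤ k * suc k → (k + k < m → Q (nullity (A (m ∸ k) k))) →
              m ∈ upTo (suc (k + k)) ++ map (_+ k) (filter Q′? (upTo (period k)))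
      place m m≤ q with ≤-<-connex m (k + k)
      ... | inj₁ m≤2k = ∈-++⁺ˡ (∈-upTo⁺ (s≤s m≤2k))
      ... | inj₂ 2k<m = ∈-++⁺ʳ (upTo (suc (k + k))) (subst (_∈ map (_+ k) (filter Q′? (upTo (period k)))) (m∸n+n≡m k≤m)
        (∈-map⁺ (_+ k) (∈-filter⁺ Q′? (∈-upTo⁺ (subst (m ∸ k <_) (period≡ k) (<-≤-trans (∸-monoʳ-< {m} (>-nonZero⁻¹ k) k≤m) m≤)))
          (subst (λ n → Q (nullity (A n k))) (sym (representative-> (m+n≤o⇒m≤o∸n (suc k) 2k<m))) (q 2k<m)))))
        where k≤m = ≤-trans (m≤m+n k k) (<⇒≤ 2k<m)

      ⊆ : ∀ {m} → m ∈ right ++ left → m ∈ upTo (suc (k + k)) ++ map (_+ k) (filter Q′? (upTo (period k)))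
      ⊆ m∈ with ∈-++⁻ right m∈
      ... | inj₁ m∈right with ∈-map⁻ (rightPosition k) m∈right
      ...   | v , v∈ , refl = place _ (rightPosition≤ k v (valid (Q? ∘ pred ∘ order) v∈)) λ 2k<m →
        subst Q (sym (nullity-right v (valid (Q? ∘ pred ∘ order) v∈) 2k<m)) (proj₂ (∈-filter⁻ (Q? ∘ pred ∘ order) {xs = labels k} v∈))
      ⊆ m∈ | inj₂ m∈left with ∈-map⁻ (leftPosition k) m∈left
      ...   | v , v∈ , refl = place _ (leftPosition≤ k v (valid (Q? ∘ order) v∈)) λ 2k<m →
        subst Q (sym (nullity-left v (valid (Q? ∘ order) v∈) 2k<m)) (proj₂ (∈-filter⁻ (Q? ∘ order) {xs = labels k} v∈))

    -- Distinct positions give this for every decidable property of the nullity. It is used for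
    -- being z and for not being z, which bounds the count from both sides.
    labels≤nullities : count (Q? ∘ pred ∘ order) (labels k) + count (Q? ∘ order) (labels k) ≤
                       suc (k + k) + count (λ n → Q? (N (ℤ.+ n) k)) (upTo (period k))
    labels≤nullities = subst₂ _≤_
      (trans (length-++ right) (cong₂ _+_ (length-map (rightPosition k) (filter (Q? ∘ pred ∘ order) (labels k))) (length-map (leftPosition k) (filter (Q? ∘ order) (labels k)))))
      (trans (length-++ (upTo (suc (k + k)))) (cong₂ _+_ (length-upTo (suc (k + k))) (length-map (_+ k) (filter Q′? (upTo (period k))))))
      (length-⊆ unique ⊆)

  orderCount : ℕ → ℕ → ℕ
  orderCount z k = count (λ v → order v ≟ z) (labels k)

  nullityCount : ℕ → (k : ℕ) .{{_ : NonZero k}} → ℕ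
  nullityCount z k = count (λ n → N (ℤ.+ n) k ≟ z) (upTo (period k))

  module _ (z k : ℕ) .{{_ : NonZero k}} where
    private
      shift : count (λ v → pred (order v) ≟ z) (labels k) ≡ orderCount (suc z) k
      shift = cong length (filter-≐ (λ v → pred (order v) ≟ z) (λ v → order v ≟ suc z)
        ((λ {v} eq → trans (sym (suc-pred (order v) {{>-nonZero (0<order v)}})) (cong suc eq)) , cong pred) (labels k))

      c = nullityCount z k
      c′ = count (λ n → ¬? (N (ℤ.+ n) k ≟ z)) (upTo (period k))
      o₁ = orderCount (suc z) k
      o₂ = orderCount z k
      o₁′ = count (λ v → ¬? (pred (order v) ≟ z)) (labels k)
      o₂′ = count (λ v → ¬? (order v ≟ z)) (labels k)

      total : c + c′ ≡ o₁ + o₂ + (o₁′ + o₂′)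
      total = begin
        c + c′ ≡⟨ count-complement (λ n → N (ℤ.+ n) k ≟ z) (upTo (period k)) ⟩
        length (upTo (period k)) ≡⟨ length-upTo (period k) ⟩
        period k ≡⟨ sym (period≡ k) ⟩
        k * suc k ≡⟨ sym (length-labels k) ⟩
        length (labels k) + length (labels k) ≡⟨ sym (cong₂ _+_ (count-complement (λ v → pred (order v) ≟ z) (labels k)) (count-complement (λ v → order v ≟ z) (labels k))) ⟩
        count (λ v → pred (order v) ≟ z) (labels k) + o₁′ + (o₂ + o₂′) ≡⟨ cong (λ t → t + o₁′ + (o₂ + o₂′)) shift ⟩
        o₁ + o₁′ + (o₂ + o₂′) ≡⟨ lemma o₁ o₁′ o₂ o₂′ ⟩
        o₁ + o₂ + (o₁′ + o₂′) ∎
        where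
        open ≡-Reasoning
        lemma : ∀ a b c d → a + b + (c + d) ≡ a + c + (b + d)
        lemma = solve-∀

    orderCount≤nullityCount : orderCount (suc z) k + orderCount z k ≤ suc (k + k) + nullityCount z k
    orderCount≤nullityCount = subst (λ t → t + orderCount z k ≤ suc (k + k) + nullityCount z k) shift (labels≤nullities (_≟ z))

    -- By `length-labels` a period has as many elements as there are positions, so the lower bound
    -- for the nullities other than z is an upper bound for those equal to z.
    nullityCount≤orderCount : nullityCount z k ≤ suc (k + k) + (orderCount (suc z) k + orderCount z k)
    nullityCount≤orderCount = +-cancelʳ-≤ c′ _ _ (≤-trans (≤-reflexive total) (≤-trans
      (+-monoʳ-≤ (o₁ + o₂) (labels≤nullities (λ n → ¬? (n ≟ z))))
      (≤-reflexive (lemma (o₁ + o₂) (suc (k + k)) c′))))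
      where
      lemma : ∀ a b c → a + (b + c) ≡ b + a + c
      lemma = solve-∀

  private
    scale : ℕ → Label → Label
    scale z (i , l) = i * suc z , pred (suc l * suc z)

    order-scale : ∀ z v → order (scale z v) ≡ order v * suc z
    order-scale z (i , l) = trans (cong₂ gcd (*-comm i (suc z)) (*-comm (suc l) (suc z)))
      (trans (sym (c*gcd[m,n]≡gcd[cm,cn] (suc z) i (suc l))) (*-comm (suc z) (gcd i (suc l))))

    scale-injective : ∀ z {u v} → scale z u ≡ scale z v → u ≡ v
    scale-injective z {i , l} {i′ , l′} eq = cong₂ _,_ (*-cancelʳ-≡ i i′ (suc z) (cong proj₁ eq))
      (suc-injective (*-cancelʳ-≡ (suc l) (suc l′) (suc z) (cong (suc ∘ proj₂) eq)))

  -- Multiplying numerator and denominator by z + 1 is a bijection, inverted by reduction to lowest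
  -- terms.
  orderCount-scale : ∀ z k → orderCount (suc z) k ≡ orderCount 1 (k / suc z)
  orderCount-scale z k = ≤-antisym
    (subst (orderCount (suc z) k ≤_) (length-map (scale z) ones) (length-⊆ (Unique.filter⁺ z? (labels-unique k)) down))
    (subst (_≤ orderCount (suc z) k) (length-map (scale z) ones) (length-⊆ (Unique.map⁺ (scale-injective z) (Unique.filter⁺ 1? (labels-unique (k / suc z)))) up))
    where
    z? : Decidable (λ v → order v ≡ suc z)
    z? v = order v ≟ suc z
    1? : Decidable (λ v → order v ≡ 1)
    1? v = order v ≟ 1
    ones = filter 1? (labels (k / suc z))

    up : ∀ {v} → v ∈ map (scale z) ones → v ∈ filter z? (labels k)
    up v∈ with ∈-map⁻ (scale z) v∈
    ... | u@(i , l) , u∈ , refl = let (u∈labels , order≡1) = ∈-filter⁻ 1? {xs = labels (k / suc z)} u∈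
                                      (i≤l , l<) = ∈-labels⁻ {k / suc z} u∈labels in
      ∈-filter⁺ z? (∈-labels⁺ {v = scale z u} (≤-trans (*-monoˡ-≤ (suc z) i≤l) (m≤n+m (l * suc z) z) , ≤-trans (*-monoˡ-≤ (suc z) l<) (m/n*n≤m k (suc z))))
        (trans (order-scale z u) (trans (cong (_* suc z) order≡1) (*-identityˡ (suc z))))

    down : ∀ {v} → v ∈ filter z? (labels k) → v ∈ map (scale z) ones
    down {v@(i , l)} v∈ = subst (_∈ map (scale z) ones) scale-u≡ (∈-map⁺ (scale z)
      (∈-filter⁺ 1? (∈-labels⁺ (p≤ , q≤k/g)) (*-cancelʳ-≡ (order u) 1 (suc z) (trans (sym (order-scale z u)) (trans (cong order scale-u≡) (trans order≡ (sym (*-identityˡ (suc z)))))))))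
      where
      v∈labels = proj₁ (∈-filter⁻ z? {xs = labels k} v∈)
      order≡   = proj₂ (∈-filter⁻ z? {xs = labels k} v∈)
      open Reduced i l
      u : Label
      u = p , pred q
      q≡ : suc (pred q) * suc z ≡ suc l
      q≡ = trans (cong₂ _*_ (suc-pred q {{q-nonZero}}) (sym order≡)) q*g≡
      p≡ : p * suc z ≡ i
      p≡ = trans (cong (p *_) (sym order≡)) p*g≡
      scale-u≡ : scale z u ≡ v
      scale-u≡ = cong₂ _,_ p≡ (cong pred q≡)
      p≤ : p ≤ pred q
      p≤ = s≤s⁻¹ (*-cancelʳ-< (suc z) p (suc (pred q)) (subst₂ _<_ (sym p≡) (sym q≡) (s≤s (proj₁ (∈-labels⁻ {k} v∈labels)))))
      q≤k/g : pred q < k / suc z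
      q≤k/g = subst (_≤ k / suc z) (m*n/n≡m (suc (pred q)) (suc z)) (/-monoˡ-≤ (suc z) (subst (_≤ k) (sym q≡) (proj₂ (∈-labels⁻ v∈labels))))

  private
    indicator-sum : ∀ k g → 1 ≤ g → g ≤ k → Σ< k (λ z → length (filter (_≟ suc z) (g ∷ []))) ≡ 1
    indicator-sum zero    (suc g) _ ()
    indicator-sum (suc k) g 1≤g g≤1+k with m≤n⇒m<n∨m≡n g≤1+k
    ... | inj₁ g<1+k = cong₂ _+_ (indicator-sum k g 1≤g (s≤s⁻¹ g<1+k)) (cong length (filter-reject (_≟ suc k) {xs = []} (<⇒≢ g<1+k)))
    ... | inj₂ refl = cong₂ _+_ (trans (Σ<-cong k (λ z z<k → cong length (filter-reject (_≟ suc z) {xs = []} (>⇒≢ (s≤s z<k))))) (Σ<-0 k))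
      (cong length (filter-accept (_≟ suc k) {xs = []} refl))

    count-∷ : ∀ {A : Set} (f : A → ℕ) z x xs → count (λ v → f v ≟ z) (x ∷ xs) ≡ length (filter (_≟ z) (f x ∷ [])) + count (λ v → f v ≟ z) xs
    count-∷ f z x xs with f x ≟ z
    ... | yes eq = trans (cong length (filter-accept (λ v → f v ≟ z) {xs = xs} eq))
      (sym (cong (λ l → length l + count (λ v → f v ≟ z) xs) (filter-accept (_≟ z) {xs = []} eq)))
    ... | no ≢ = trans (cong length (filter-reject (λ v → f v ≟ z) {xs = xs} ≢))
      (sym (cong (λ l → length l + count (λ v → f v ≟ z) xs) (filter-reject (_≟ z) {xs = []} ≢)))

    partition : ∀ {A : Set} k (f : A → ℕ) xs → All (λ x → 1 ≤ f x × f x ≤ k) xs → Σ< k (λ z → count (λ v → f v ≟ suc z) xs) ≡ length xs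
    partition k f []       []                = Σ<-0 k
    partition k f (x ∷ xs) ((1≤ , ≤k) ∷ all) = trans (Σ<-cong k (λ z _ → count-∷ f (suc z) x xs))
      (trans (Σ<-+ k _ _) (cong₂ _+_ (indicator-sum k (f x) 1≤ ≤k) (partition k f xs all)))

  orderCount-sum : ∀ k → Σ< k (λ z → orderCount 1 (k / suc z)) + Σ< k (λ z → orderCount 1 (k / suc z)) ≡ k * suc k
  orderCount-sum k = trans (cong (λ s → s + s) (trans (Σ<-cong k (λ z _ → sym (orderCount-scale z k)))
    (partition k order (labels k) (All.tabulate λ {v} v∈ → 0<order v , order≤k {k} {v} (∈-labels⁻ {k} v∈))))) (length-labels k)

-- Rational estimates for harmonic sums and for the partial sums of ζ(2).

module Rat where
  open import Algebra.Bundles using (CommutativeRing)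
  open import Data.Integer.Base as ℤ using (ℤ; -[1+_])
  import Data.Integer.Properties as ℤₚ
  open import Data.Nat.Base as ℕ using (ℕ; zero; suc; z≤n; s≤s)
  import Data.Nat.Properties as ℕₚ
  open import Data.Product using (_,_; ∃)
  open import Data.Rational
  open import Data.Rational.Properties
  import Data.Rational.Unnormalised as ℚᵘ
  import Data.Rational.Unnormalised.Properties as ℚᵘₚ
  open import Data.Sum using (inj₁; inj₂)
  open import Function.Base using (_∘_)
  open import Relation.Binary.PropositionalEquality
  open import Tactic.RingSolver using (solve-∀)
  open LinAlg using (ℚ-ring)
  open Sum (CommutativeRing.commutativeSemiring +-*-commutativeRing) public
  open Band public using (Σ<-split)

  0≤+ : ∀ {p q} → 0ℚ ≤ p → 0ℚ ≤ q → 0ℚ ≤ p + q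
  0≤+ = +-mono-≤

  0≤* : ∀ {p q} → 0ℚ ≤ p → 0ℚ ≤ q → 0ℚ ≤ p * q
  0≤* {p} {q} 0≤p 0≤q = subst (_≤ p * q) (*-zeroʳ p) (*-monoˡ-≤-nonNeg p {{nonNegative 0≤p}} 0≤q)

  ≤-from : ∀ {x y} d → 0ℚ ≤ d → x + d ≡ y → x ≤ y
  ≤-from {x} d 0≤d refl = subst (_≤ x + d) (+-identityʳ x) (+-monoʳ-≤ x 0≤d)

  0≤- : ∀ {x y} → x ≤ y → 0ℚ ≤ y - x
  0≤- {x} {y} x≤y = subst (_≤ y - x) (+-inverseʳ x) (+-monoˡ-≤ (- x) x≤y)

  *-mono : ∀ r {p q} → 0ℚ ≤ r → p ≤ q → r * p ≤ r * q
  *-mono r 0≤r = *-monoˡ-≤-nonNeg r {{nonNegative 0≤r}}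

  ∣∣≤ : ∀ {x y} → x ≤ y → - x ≤ y → ∣ x ∣ ≤ y
  ∣∣≤ {x} x≤y -x≤y with ∣p∣≡p∨∣p∣≡-p x
  ... | inj₁ eq = subst (_≤ _) (sym eq) x≤y
  ... | inj₂ eq = subst (_≤ _) (sym eq) -x≤y

  ≤∣∣ : ∀ x → x ≤ ∣ x ∣
  ≤∣∣ x with ≤-total 0ℚ x
  ... | inj₁ 0≤x = ≤-reflexive (sym (0≤p⇒∣p∣≡p 0≤x))
  ... | inj₂ x≤0 = ≤-trans x≤0 (0≤∣p∣ x)

  Σ<-mono-≤ : ∀ n {f g} → (∀ i → i ℕ.< n → f i ≤ g i) → Σ< n f ≤ Σ< n g
  Σ<-mono-≤ zero    f≤g = ≤-refl
  Σ<-mono-≤ (suc n) f≤g = +-mono-≤ (Σ<-mono-≤ n (λ i i<n → f≤g i (ℕₚ.m<n⇒m<1+n i<n))) (f≤g n (ℕₚ.n<1+n n))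

  Σ<-∣∣ : ∀ n {f g} → (∀ i → i ℕ.< n → ∣ f i ∣ ≤ g i) → ∣ Σ< n f ∣ ≤ Σ< n g
  Σ<-∣∣ zero    f≤g = ≤-refl
  Σ<-∣∣ (suc n) {f} f≤g = ≤-trans (∣p+q∣≤∣p∣+∣q∣ (Σ< n f) (f n))
    (+-mono-≤ (Σ<-∣∣ n (λ i i<n → f≤g i (ℕₚ.m<n⇒m<1+n i<n))) (f≤g n (ℕₚ.n<1+n n)))

  -- Recursive, so that `ι (suc n)` unfolds to `1ℚ + ι n`, the form in which the ring identities use
  -- it.
  ι : ℕ → ℚ
  ι zero    = 0ℚ
  ι (suc n) = 1ℚ + ι n

  ι-+ : ∀ m n → ι (m ℕ.+ n) ≡ ι m + ι n
  ι-+ zero    n = sym (+-identityˡ (ι n))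
  ι-+ (suc m) n = trans (cong (1ℚ +_) (ι-+ m n)) (sym (+-assoc 1ℚ (ι m) (ι n)))

  ι-* : ∀ m n → ι (m ℕ.* n) ≡ ι m * ι n
  ι-* zero    n = sym (*-zeroˡ (ι n))
  ι-* (suc m) n = trans (ι-+ n (m ℕ.* n)) (trans (cong (ι n +_) (ι-* m n)) (lemma (ι m) (ι n)))
    where
    lemma : ∀ a b → b + a * b ≡ (1ℚ + a) * b
    lemma = solve-∀ ℚ-ring

  0≤1 : 0ℚ ≤ 1ℚ
  0≤1 = <⇒≤ (positive⁻¹ 1ℚ)

  0≤ι : ∀ n → 0ℚ ≤ ι n
  0≤ι zero    = ≤-refl
  0≤ι (suc n) = 0≤+ 0≤1 (0≤ι n)

  ι-mono : ∀ {m n} → m ℕ.≤ n → ι m ≤ ι n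
  ι-mono {n = n} z≤n = 0≤ι n
  ι-mono (s≤s m≤n)   = +-monoʳ-≤ 1ℚ (ι-mono m≤n)

  1≤ι : ∀ n → 1ℚ ≤ ι (suc n)
  1≤ι n = ι-mono {1} {suc n} (s≤s z≤n)

  ι-Σ< : ∀ n f → ι (NatSum.Σ< n f) ≡ Σ< n (ι ∘ f)
  ι-Σ< zero    f = refl
  ι-Σ< (suc n) f = trans (ι-+ (NatSum.Σ< n f) (f n)) (cong (_+ ι (f n)) (ι-Σ< n f))

  toℚᵘ-ι : ∀ n → toℚᵘ (ι n) ℚᵘ.≃ ℚᵘ.mkℚᵘ (ℤ.+ n) 0
  toℚᵘ-ι zero    = ℚᵘₚ.≃-refl
  toℚᵘ-ι (suc n) = ℚᵘₚ.≃-trans (toℚᵘ-homo-+ 1ℚ (ι n)) (ℚᵘₚ.≃-trans (ℚᵘₚ.+-congʳ (toℚᵘ 1ℚ) (toℚᵘ-ι n))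
    (ℚᵘ.*≡* (cong (λ z → (ℤ.+ 1 ℤ.+ z) ℤ.* ℤ.+ 1) (ℤₚ.*-identityʳ (ℤ.+ n)))))

  /-ι : ∀ a n → (ℤ.+ a / suc n) * ι (suc n) ≡ ι a
  /-ι a n = toℚᵘ-injective (ℚᵘₚ.≃-trans (toℚᵘ-homo-* (ℤ.+ a / suc n) (ι (suc n)))
    (ℚᵘₚ.≃-trans (ℚᵘₚ.*-cong (toℚᵘ-fromℚᵘ (ℚᵘ.mkℚᵘ (ℤ.+ a) n)) (toℚᵘ-ι (suc n)))
      (ℚᵘₚ.≃-trans (ℚᵘ.*≡* (trans (ℤₚ.*-identityʳ (ℤ.+ a ℤ.* ℤ.+ suc n)) (cong (λ z → ℤ.+ a ℤ.* ℤ.+ z) (sym (ℕₚ.*-identityʳ (suc n)))))) (ℚᵘₚ.≃-sym (toℚᵘ-ι a)))))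

  recip : ℕ → ℚ
  recip n = ℤ.+ 1 / suc n

  recip-ι : ∀ n → recip n * ι (suc n) ≡ 1ℚ
  recip-ι n = trans (/-ι 1 n) (+-identityʳ 1ℚ)

  0≤recip : ∀ n → 0ℚ ≤ recip n
  0≤recip n = nonNegative⁻¹ (recip n) {{normalize-nonNeg 1 (suc n)}}

  recip-cancel : ∀ n {x y} → ι (suc n) * x ≤ ι (suc n) * y → x ≤ y
  recip-cancel n {x} {y} le = subst₂ _≤_ (undo x) (undo y) (*-mono (recip n) (0≤recip n) le)
    where
    undo : ∀ x → recip n * (ι (suc n) * x) ≡ x
    undo x = trans (sym (*-assoc (recip n) (ι (suc n)) x)) (trans (cong (_* x) (recip-ι n)) (*-identityˡ x))

  recip-anti : ∀ {m n} → m ℕ.≤ n → recip n ≤ recip m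
  recip-anti {m} {n} m≤n = recip-cancel n (begin
    ι (suc n) * recip n ≡⟨ *-comm (ι (suc n)) (recip n) ⟩
    recip n * ι (suc n) ≡⟨ trans (recip-ι n) (sym (recip-ι m)) ⟩
    recip m * ι (suc m) ≤⟨ *-mono (recip m) (0≤recip m) (ι-mono (s≤s m≤n)) ⟩
    recip m * ι (suc n) ≡⟨ *-comm (recip m) (ι (suc n)) ⟩
    ι (suc n) * recip m ∎)
    where open ≤-Reasoning

  recip≤1 : ∀ n → recip n ≤ 1ℚ
  recip≤1 n = recip-anti {0} {n} z≤n

  recip-unique : ∀ n x → x * ι (suc n) ≡ 1ℚ → x ≡ recip n
  recip-unique n x eq = begin
    x ≡⟨ sym (*-identityʳ x) ⟩
    x * 1ℚ ≡⟨ cong (x *_) (sym (recip-ι n)) ⟩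
    x * (recip n * ι (suc n)) ≡⟨ lemma x (recip n) (ι (suc n)) ⟩
    recip n * (x * ι (suc n)) ≡⟨ cong (recip n *_) eq ⟩
    recip n * 1ℚ ≡⟨ *-identityʳ (recip n) ⟩
    recip n ∎
    where
    open ≡-Reasoning
    lemma : ∀ x r i → x * (r * i) ≡ r * (x * i)
    lemma = solve-∀ ℚ-ring

  archimedean : ∀ q → ∃ λ n → q ≤ ι n
  archimedean q@(mkℚ (ℤ.+ a) d _) = a , toℚᵘ-cancel-≤ (ℚᵘₚ.≤-respʳ-≃ (ℚᵘₚ.≃-sym (toℚᵘ-ι a))
    (ℚᵘ.*≤* (subst₂ ℤ._≤_ (sym (ℤₚ.*-identityʳ (ℤ.+ a))) (ℤₚ.pos-* a (suc d)) (ℤ.+≤+ (ℕₚ.m≤m*n a (suc d))))))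
  archimedean q@(mkℚ (-[1+ a ]) d _) = 0 , <⇒≤ (negative⁻¹ q)

  archimedean-* : ∀ q ε → 0ℚ < ε → ∃ λ n → q ≤ ι n * ε
  archimedean-* q ε 0<ε = let (n , le) = archimedean (q * 1/ ε) in n ,
    subst (_≤ ι n * ε) (trans (*-assoc q (1/ ε) ε) (trans (cong (q *_) (*-inverseˡ ε)) (*-identityʳ q)))
      (*-monoʳ-≤-nonNeg ε {{nonNegative (<⇒≤ 0<ε)}} le)
    where instance ε≢0 = ≢-nonZero (λ ε≡0 → <-irrefl (sym ε≡0) 0<ε)

  recip-small : ∀ q ε → 0ℚ < ε → ∃ λ m → ∀ n → m ℕ.≤ n → q * recip n ≤ ε
  recip-small q ε 0<ε = let (m , le) = archimedean-* ∣ q ∣ ε 0<ε in m , λ n m≤n → recip-cancel n (begin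
    ι (suc n) * (q * recip n) ≡⟨ lemma (ι (suc n)) q (recip n) ⟩
    q * (recip n * ι (suc n)) ≡⟨ trans (cong (q *_) (recip-ι n)) (*-identityʳ q) ⟩
    q ≤⟨ ≤∣∣ q ⟩
    ∣ q ∣ ≤⟨ le ⟩
    ι m * ε ≤⟨ *-monoʳ-≤-nonNeg ε {{nonNegative (<⇒≤ 0<ε)}} (ι-mono (ℕₚ.m≤n⇒m≤1+n m≤n)) ⟩
    ι (suc n) * ε ∎)
    where
    open ≤-Reasoning
    lemma : ∀ a q r → a * (q * r) ≡ q * (r * a)
    lemma = solve-∀ ℚ-ring

  harmonic : ℕ → ℚ
  harmonic n = Σ< n recip

  harmonic-≤ι : ∀ n → harmonic n ≤ ι n
  harmonic-≤ι zero    = ≤-refl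
  harmonic-≤ι (suc n) = subst (harmonic (suc n) ≤_) (+-comm (ι n) 1ℚ) (+-mono-≤ (harmonic-≤ι n) (recip≤1 n))

  -- The first m terms are at most 1 and the others at most 1/(m + 1). With m fixed by the tolerance
  -- this does the work of a logarithmic bound.
  harmonic-bound : ∀ m n → harmonic n ≤ ι m + recip m * ι n
  harmonic-bound m n with ℕₚ.≤-total n m
  ... | inj₁ n≤m = ≤-trans (harmonic-≤ι n) (≤-trans (ι-mono n≤m) (≤-from (recip m * ι n) (0≤* (0≤recip m) (0≤ι n)) refl))
  ... | inj₂ m≤n = subst (λ n → harmonic n ≤ ι m + recip m * ι n) (ℕₚ.m+[n∸m]≡n m≤n) (beyond (n ℕ.∸ m))
    where
    lemma : ∀ a r i → a + r * i + r ≡ a + r * (1ℚ + i)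
    lemma = solve-∀ ℚ-ring
    beyond : ∀ d → harmonic (m ℕ.+ d) ≤ ι m + recip m * ι (m ℕ.+ d)
    beyond zero    = subst (λ n → harmonic n ≤ ι m + recip m * ι n) (sym (ℕₚ.+-identityʳ m))
      (≤-trans (harmonic-≤ι m) (≤-from (recip m * ι m) (0≤* (0≤recip m) (0≤ι m)) refl))
    beyond (suc d) = subst (λ n → harmonic n ≤ ι m + recip m * ι n) (sym (ℕₚ.+-suc m d))
      (≤-trans (+-mono-≤ (beyond d) (recip-anti (ℕₚ.m≤m+n m d))) (≤-reflexive (lemma (ι m) (recip m) (ι (m ℕ.+ d)))))

  sq : ℕ → ℚ
  sq n = recip n * recip n

  ζ : ℕ → ℚ
  ζ n = Σ< n sq

  0≤sq : ∀ n → 0ℚ ≤ sq n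
  0≤sq n = 0≤* (0≤recip n) (0≤recip n)

  ζ-mono : ∀ {m n} → m ℕ.≤ n → ζ m ≤ ζ n
  ζ-mono {m} {n} m≤n = subst (λ n → ζ m ≤ ζ n) (ℕₚ.m+[n∸m]≡n m≤n) (≤-from (Σ< (n ℕ.∸ m) (λ i → sq (m ℕ.+ i)))
    (subst (_≤ Σ< (n ℕ.∸ m) (λ i → sq (m ℕ.+ i))) (Σ<-0 (n ℕ.∸ m)) (Σ<-mono-≤ (n ℕ.∸ m) (λ i _ → 0≤sq (m ℕ.+ i))))
    (sym (Σ<-split m (n ℕ.∸ m) sq)))

  1≤ζ : ∀ n → 1ℚ ≤ ζ (suc n)
  1≤ζ n = ζ-mono {1} {suc n} (s≤s z≤n)

  -- The telescoping bound 1/(n + 2)² ≤ 1/((n + 1)(n + 2)); the two sides differ by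
  -- `recip n * sq (suc n)`.
  recip-step : ∀ n → sq (suc n) + recip (suc n) ≤ recip n
  recip-step n = ≤-from (recip n * sq (suc n)) (0≤* (0≤recip n) (0≤sq (suc n))) (begin
    b * b + b + a * (b * b) ≡⟨ lemma a b ⟩
    b * (b * (1ℚ + a)) + b ≡⟨ cong (λ z → b * (b * (z + a)) + b) (sym (recip-ι n)) ⟩
    b * (b * (a * i + a)) + b ≡⟨ lemma′ a b i ⟩
    b * (a * (b * (1ℚ + i))) + b ≡⟨ cong (λ z → b * (a * z) + b) (recip-ι (suc n)) ⟩
    b * (a * 1ℚ) + b ≡⟨ cong (b * (a * 1ℚ) +_) (sym (*-identityʳ b)) ⟩
    b * (a * 1ℚ) + b * 1ℚ ≡⟨ cong (λ z → b * (a * 1ℚ) + b * z) (sym (recip-ι n)) ⟩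
    b * (a * 1ℚ) + b * (a * i) ≡⟨ lemma″ a b i ⟩
    a * (b * (1ℚ + i)) ≡⟨ trans (cong (a *_) (recip-ι (suc n))) (*-identityʳ a) ⟩
    a ∎)
    where
    open ≡-Reasoning
    a = recip n
    b = recip (suc n)
    i = ι (suc n)
    lemma : ∀ a b → b * b + b + a * (b * b) ≡ b * (b * (1ℚ + a)) + b
    lemma = solve-∀ ℚ-ring
    lemma′ : ∀ a b i → b * (b * (a * i + a)) + b ≡ b * (a * (b * (1ℚ + i))) + b
    lemma′ = solve-∀ ℚ-ring
    lemma″ : ∀ a b i → b * (a * 1ℚ) + b * (a * i) ≡ a * (b * (1ℚ + i))
    lemma″ = solve-∀ ℚ-ring

  -- A decreasing sequence of upper bounds for all partial sums, standing in for the limit ζ(2).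
  ζ-upper : ∀ {m n} → m ℕ.≤ n → ζ (suc n) + recip n ≤ ζ (suc m) + recip m
  ζ-upper {m} {n} m≤n = subst (λ n → ζ (suc n) + recip n ≤ ζ (suc m) + recip m) (ℕₚ.m+[n∸m]≡n m≤n) (down (n ℕ.∸ m))
    where
    down : ∀ d → ζ (suc (m ℕ.+ d)) + recip (m ℕ.+ d) ≤ ζ (suc m) + recip m
    down zero    = ≤-reflexive (cong (λ n → ζ (suc n) + recip n) (ℕₚ.+-identityʳ m))
    down (suc d) = ≤-trans (≤-reflexive (cong (λ n → ζ (suc n) + recip n) (ℕₚ.+-suc m d)))
      (≤-trans (≤-trans (≤-reflexive (+-assoc (ζ (suc (m ℕ.+ d))) _ _)) (+-monoʳ-≤ (ζ (suc (m ℕ.+ d))) (recip-step (m ℕ.+ d)))) (down d))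

  -- `ζ-upper` from m = 1 gives 1 + 1/4 + 1/2. Being below 2 is what makes the recursion for the
  -- deviation contract.
  ζ≤7/4 : ∀ n → ζ n ≤ ℤ.+ 7 / 4
  ζ≤7/4 zero          = ≤ᵇ⇒≤ _
  ζ≤7/4 (suc zero)    = ≤ᵇ⇒≤ _
  ζ≤7/4 (suc (suc n)) = ≤-trans (≤-from (recip (suc n)) (0≤recip (suc n)) refl) (ζ-upper {1} {suc n} (s≤s z≤n))

-- The density of coprime labels.

module Density where
  open import Data.Nat.Base as ℕ using (ℕ; zero; suc)
  import Data.Nat.Properties as ℕₚ
  import Data.Integer.Base as ℤ
  open import Data.Nat.DivMod using (m≡m%n+[m/n]*n; m%n<n; n/1≡n)
  open import Data.Product using (_×_; _,_; ∃; proj₁; proj₂)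
  open import Data.Rational
  open import Data.Rational.Properties
  open import Function.Base using (_∘_)
  open import Relation.Binary.PropositionalEquality
  open import Tactic.RingSolver using (solve-∀)
  open LinAlg using (ℚ-ring)
  open Rat

  quotient : ℕ → ℕ → ℚ
  quotient n g = ι (n ℕ./ suc g)

  quotient-split : ∀ n g → ι n * recip g ≡ ι (n ℕ.% suc g) * recip g + quotient n g
  quotient-split n g = begin
    ι n * recip g ≡⟨ cong (λ m → ι m * recip g) (m≡m%n+[m/n]*n n (suc g)) ⟩
    ι (n ℕ.% suc g ℕ.+ n ℕ./ suc g ℕ.* suc g) * recip g ≡⟨ cong (_* recip g) (trans (ι-+ (n ℕ.% suc g) _) (cong (ι (n ℕ.% suc g) +_) (ι-* (n ℕ./ suc g) (suc g)))) ⟩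
    (ι (n ℕ.% suc g) + quotient n g * ι (suc g)) * recip g ≡⟨ lemma (ι (n ℕ.% suc g)) (quotient n g) (ι (suc g)) (recip g) ⟩
    ι (n ℕ.% suc g) * recip g + quotient n g * (recip g * ι (suc g)) ≡⟨ cong (λ z → ι (n ℕ.% suc g) * recip g + quotient n g * z) (recip-ι g) ⟩
    ι (n ℕ.% suc g) * recip g + quotient n g * 1ℚ ≡⟨ cong (ι (n ℕ.% suc g) * recip g +_) (*-identityʳ (quotient n g)) ⟩
    ι (n ℕ.% suc g) * recip g + quotient n g ∎
    where
    open ≡-Reasoning
    lemma : ∀ r q i v → (r + q * i) * v ≡ r * v + q * (v * i)
    lemma = solve-∀ ℚ-ring

  0≤ι*recip : ∀ n g → 0ℚ ≤ ι n * recip g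
  0≤ι*recip n g = 0≤* (0≤ι n) (0≤recip g)

  quotient≤ : ∀ n g → quotient n g ≤ ι n * recip g
  quotient≤ n g = ≤-from (ι (n ℕ.% suc g) * recip g) (0≤ι*recip (n ℕ.% suc g) g)
    (trans (+-comm (quotient n g) _) (sym (quotient-split n g)))

  ≤quotient+1 : ∀ n g → ι n * recip g ≤ 1ℚ + quotient n g
  ≤quotient+1 n g = ≤-trans (≤-reflexive (quotient-split n g)) (+-monoˡ-≤ (quotient n g) (begin
    ι (n ℕ.% suc g) * recip g ≡⟨ *-comm (ι (n ℕ.% suc g)) (recip g) ⟩
    recip g * ι (n ℕ.% suc g) ≤⟨ *-mono (recip g) (0≤recip g) (ι-mono (ℕₚ.<⇒≤ (m%n<n n (suc g)))) ⟩
    recip g * ι (suc g) ≡⟨ recip-ι g ⟩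
    1ℚ ∎))
    where open ≤-Reasoning

  0≤quotient : ∀ n g → 0ℚ ≤ quotient n g
  0≤quotient n g = 0≤ι (n ℕ./ suc g)

  quotient²≤ : ∀ n g → quotient n g * quotient n g ≤ ι n * ι n * sq g
  quotient²≤ n g = ≤-trans (≤-trans (*-mono f (0≤quotient n g) (quotient≤ n g)) (≤-trans (≤-reflexive (*-comm f u)) (*-mono u (0≤ι*recip n g) (quotient≤ n g))))
    (≤-reflexive (lemma (ι n) (recip g)))
    where
    f = quotient n g
    u = ι n * recip g
    lemma : ∀ x r → x * r * (x * r) ≡ x * x * (r * r)
    lemma = solve-∀ ℚ-ring

  -- With u = n/(g + 1) and f its floor, u² - f² = (u - f)(u + f) ≤ 2u.
  ≤quotient²+ : ∀ n g → ι n * ι n * sq g ≤ quotient n g * quotient n g + (1ℚ + 1ℚ) * (ι n * recip g)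
  ≤quotient²+ n g = ≤-from (u * (1ℚ + f - u) + f * (1ℚ + f - u) + (u - f))
    (0≤+ (0≤+ (0≤* (0≤ι*recip n g) 0≤d) (0≤* (0≤quotient n g) 0≤d)) (0≤- (quotient≤ n g)))
    (lemma (ι n) (recip g) f)
    where
    f = quotient n g
    u = ι n * recip g
    0≤d = 0≤- (≤quotient+1 n g)
    lemma : ∀ x r f → x * x * (r * r) + (x * r * (1ℚ + f - x * r) + f * (1ℚ + f - x * r) + (x * r - f)) ≡ f * f + (1ℚ + 1ℚ) * (x * r)
    lemma = solve-∀ ℚ-ring

  -- The deviation E n of the number of coprime labels from c n² satisfies Σ_g E(⌊n/g⌋) = O(ε n²) + O(n log n).
  -- As Σ_{g≥2} g⁻² ≤ 3/4 < 1, this bounds E itself by iteration.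
  module _ (h : ℕ → ℕ) (h-sum : ∀ n → NatSum.Σ< n (λ g → h (n ℕ./ suc g)) ℕ.+ NatSum.Σ< n (λ g → h (n ℕ./ suc g)) ≡ n ℕ.* suc n)
           (h-bound : ∀ n → h n ℕ.+ h n ℕ.≤ n ℕ.* suc n)
           (c ε : ℚ) (0≤c : 0ℚ ≤ c) (c≤½ : c ≤ ½) (0<ε : 0ℚ < ε) (l : ℕ)
           (close : ∀ n → ∣ ι n * ι n * (½ - c * ζ n) ∣ ≤ ε * (ι n * ι n) + ι l * ι n) where

    ι-h≤ : ∀ n → ι (h n) + ι (h n) ≤ ι n * ι n + ι n
    ι-h≤ n = begin
      ι (h n) + ι (h n) ≡⟨ sym (ι-+ (h n) (h n)) ⟩
      ι (h n ℕ.+ h n) ≤⟨ ι-mono (h-bound n) ⟩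
      ι (n ℕ.* suc n) ≡⟨ ι-* n (suc n) ⟩
      ι n * (1ℚ + ι n) ≡⟨ lemma (ι n) ⟩
      ι n * ι n + ι n ∎
      where
      open ≤-Reasoning
      lemma : ∀ x → x * (1ℚ + x) ≡ x * x + x
      lemma = solve-∀ ℚ-ring

    deviation : ℕ → ℚ
    deviation n = ι (h n) - c * (ι n * ι n)

    Bound : ℚ → ℚ → Set
    Bound b j = ∀ n → ∣ deviation n ∣ ≤ b * (ι n * ι n) + j * ι n

    private
      0≤ε = <⇒≤ 0<ε
      3/4 = ℤ.+ 3 / 4

      deviation-sum : ∀ n → Σ< n (λ g → deviation (n ℕ./ suc g)) ≡
                      ½ * (ι n * ι n + ι n) - c * Σ< n (λ g → quotient n g * quotient n g)
      deviation-sum n = begin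
        Σ< n (λ g → ι (hq g) + (- (c * f² g))) ≡⟨ Σ<-cong n (λ g _ → cong (ι (hq g) +_) (neg-* c (f² g))) ⟩
        Σ< n (λ g → ι (hq g) + (- c) * f² g) ≡⟨ trans (Σ<-+ n (λ g → ι (hq g)) (λ g → (- c) * f² g)) (cong₂ _+_ (sym (ι-Σ< n hq)) (Σ<-* n (- c) f²)) ⟩
        ι (NatSum.Σ< n hq) + (- c) * Σ< n f² ≡⟨ cong (_+ (- c) * Σ< n f²) total ⟩
        ½ * (ι n * ι n + ι n) + (- c) * Σ< n f² ≡⟨ cong (½ * (ι n * ι n + ι n) +_) (sym (neg-* c (Σ< n f²))) ⟩
        ½ * (ι n * ι n + ι n) - c * Σ< n f² ∎
        where
        open ≡-Reasoning
        hq : ℕ → ℕ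
        hq g = h (n ℕ./ suc g)
        f² : ℕ → ℚ
        f² g = quotient n g * quotient n g
        neg-* : ∀ a b → - (a * b) ≡ (- a) * b
        neg-* = solve-∀ ℚ-ring
        double : ∀ a → ½ * (a + a) ≡ a
        double = solve-∀ ℚ-ring
        lemma : ∀ x → x * (1ℚ + x) ≡ x * x + x
        lemma = solve-∀ ℚ-ring
        total : ι (NatSum.Σ< n hq) ≡ ½ * (ι n * ι n + ι n)
        total = trans (sym (double (ι (NatSum.Σ< n hq)))) (cong (½ *_) (trans (sym (ι-+ (NatSum.Σ< n hq) (NatSum.Σ< n hq)))
          (trans (cong ι (h-sum n)) (trans (ι-* n (suc n)) (lemma (ι n))))))

      -- Replacing each ⌊n/g⌋² by n²/g² costs at most 2n/g, and c ≤ ½ turns the total into n times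
      -- `harmonic n`. What is left, n² (½ - c ζ n), is controlled by `close`.
      remainder : ∀ n → ∣ ½ * (ι n * ι n + ι n) - c * Σ< n (λ g → quotient n g * quotient n g) ∣ ≤
                  ε * (ι n * ι n) + ι l * ι n + ½ * ι n + ι n * harmonic n
      remainder n = subst (λ t → ∣ t ∣ ≤ ε * (x * x) + ι l * x + ½ * x + x * H) (lemma x c (ζ n) s)
        (≤-trans (∣p+q∣≤∣p∣+∣q∣ (x * x * (½ - c * ζ n) + ½ * x) (c * (x * x * ζ n - s)))
          (+-mono-≤ (≤-trans (∣p+q∣≤∣p∣+∣q∣ (x * x * (½ - c * ζ n)) (½ * x)) (+-mono-≤ (close n) (≤-reflexive (0≤p⇒∣p∣≡p (0≤* (<⇒≤ (positive⁻¹ ½)) (0≤ι n))))))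
            (≤-trans (≤-reflexive (0≤p⇒∣p∣≡p (0≤* 0≤c (0≤- s≤)))) (begin
              c * (x * x * ζ n - s) ≤⟨ *-mono c 0≤c (≤-from (s + (1ℚ + 1ℚ) * (x * H) - x * x * ζ n) (0≤- ≤s) (cancel (x * x * ζ n) s ((1ℚ + 1ℚ) * (x * H)))) ⟩
              c * ((1ℚ + 1ℚ) * (x * H)) ≤⟨ *-monoʳ-≤-nonNeg ((1ℚ + 1ℚ) * (x * H)) {{nonNegative (0≤* (0≤+ 0≤1 0≤1) (0≤* (0≤ι n) 0≤H))}} c≤½ ⟩
              ½ * ((1ℚ + 1ℚ) * (x * H)) ≡⟨ half (x * H) ⟩
              x * H ∎))))
        where
        open ≤-Reasoning
        x = ι n
        H = harmonic n
        s = Σ< n (λ g → quotient n g * quotient n g)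
        0≤H : 0ℚ ≤ H
        0≤H = subst (_≤ H) (Σ<-0 n) (Σ<-mono-≤ n (λ g _ → 0≤recip g))
        s≤ : s ≤ x * x * ζ n
        s≤ = subst (s ≤_) (Σ<-* n (x * x) sq) (Σ<-mono-≤ n (λ g _ → quotient²≤ n g))
        ≤s : x * x * ζ n ≤ s + (1ℚ + 1ℚ) * (x * H)
        ≤s = subst₂ _≤_ (Σ<-* n (x * x) sq)
          (trans (Σ<-+ n _ _) (cong (s +_) (trans (Σ<-* n (1ℚ + 1ℚ) (λ g → x * recip g)) (cong ((1ℚ + 1ℚ) *_) (Σ<-* n x recip)))))
          (Σ<-mono-≤ n (λ g _ → ≤quotient²+ n g))
        lemma : ∀ x c z s → x * x * (½ - c * z) + ½ * x + c * (x * x * z - s) ≡ ½ * (x * x + x) - c * s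
        lemma = solve-∀ ℚ-ring
        cancel : ∀ a s t → a - s + (s + t - a) ≡ t
        cancel = solve-∀ ℚ-ring
        half : ∀ a → ½ * ((1ℚ + 1ℚ) * a) ≡ a
        half = solve-∀ ℚ-ring

      tail : ∀ {b j} → 0ℚ ≤ b → 0ℚ ≤ j → Bound b j → ∀ n′ → let n = suc n′ in
             ∣ Σ< n′ (λ g → deviation (n ℕ./ suc (suc g))) ∣ ≤ 3/4 * b * (ι n * ι n) + j * (ι n * harmonic n)
      tail {b} {j} 0≤b 0≤j bound n′ = begin
        ∣ Σ< n′ (λ g → deviation (n ℕ./ suc (suc g))) ∣ ≤⟨ Σ<-∣∣ n′ (λ g _ → bound (n ℕ./ suc (suc g))) ⟩
        Σ< n′ (λ g → b * (f g * f g) + j * f g) ≤⟨ Σ<-mono-≤ n′ (λ g _ → +-mono-≤ (*-mono b 0≤b (quotient²≤ n (suc g))) (*-mono j 0≤j (quotient≤ n (suc g)))) ⟩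
        Σ< n′ (λ g → b * (x * x * sq (suc g)) + j * (x * recip (suc g))) ≡⟨ trans (Σ<-+ n′ _ _) (cong₂ _+_ (trans (Σ<-* n′ b _) (cong (b *_) (Σ<-* n′ (x * x) (sq ∘ suc))))
                                                                              (trans (Σ<-* n′ j _) (cong (j *_) (Σ<-* n′ x (recip ∘ suc))))) ⟩
        b * (x * x * Σ< n′ (sq ∘ suc)) + j * (x * Σ< n′ (recip ∘ suc)) ≤⟨ +-mono-≤ (*-mono b 0≤b (*-mono (x * x) (0≤* (0≤ι n) (0≤ι n)) ζ-tail)) (*-mono j 0≤j (*-mono x (0≤ι n) harmonic-tail)) ⟩
        b * (x * x * 3/4) + j * (x * harmonic n) ≡⟨ cong (_+ j * (x * harmonic n)) (lemma b x 3/4) ⟩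
        3/4 * b * (x * x) + j * (x * harmonic n) ∎
        where
        open ≤-Reasoning
        n = suc n′
        x = ι n
        f : ℕ → ℚ
        f g = quotient n (suc g)
        ζ-tail : Σ< n′ (sq ∘ suc) ≤ 3/4
        ζ-tail = ≤-trans (≤-reflexive (trans (shift (Σ< n′ (sq ∘ suc))) (cong (_- 1ℚ) (sym (Σ<-head n′ sq))))) (+-monoˡ-≤ (- 1ℚ) (ζ≤7/4 n))
          where
          shift : ∀ s → s ≡ sq 0 + s - 1ℚ
          shift = solve-∀ ℚ-ring
        harmonic-tail : Σ< n′ (recip ∘ suc) ≤ harmonic n
        harmonic-tail = ≤-from (recip 0) (0≤recip 0) (trans (+-comm (Σ< n′ (recip ∘ suc)) (recip 0)) (sym (Σ<-head n′ recip)))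
        lemma : ∀ b x t → b * (x * x * t) ≡ t * b * (x * x)
        lemma = solve-∀ ℚ-ring

    private
      -- The term for the divisor 1 is the deviation at n itself.
      peel : ∀ n′ → ∣ deviation (suc n′) ∣ ≤
             ∣ ½ * (ι (suc n′) * ι (suc n′) + ι (suc n′)) - c * Σ< (suc n′) (λ g → quotient (suc n′) g * quotient (suc n′) g) ∣ +
             ∣ Σ< n′ (λ g → deviation (suc n′ ℕ./ suc (suc g))) ∣
      peel n′ = subst (λ d → ∣ d ∣ ≤ ∣ R ∣ + ∣ T ∣) (trans (cong (_- T) (sym eq)) (lemma (deviation (suc n′)) T)) (∣p-q∣≤∣p∣+∣q∣ R T)
        where
        T = Σ< n′ (λ g → deviation (suc n′ ℕ./ suc (suc g)))
        R = ½ * (ι (suc n′) * ι (suc n′) + ι (suc n′)) - c * Σ< (suc n′) (λ g → quotient (suc n′) g * quotient (suc n′) g)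
        lemma : ∀ a t → (a + t) - t ≡ a
        lemma = solve-∀ ℚ-ring
        eq : deviation (suc n′) + T ≡ R
        eq = trans (cong (λ m → deviation m + T) (sym (n/1≡n (suc n′))))
          (trans (sym (Σ<-head n′ (λ g → deviation (suc n′ ℕ./ suc g)))) (deviation-sum (suc n′)))

    -- One ε comes from `remainder`; the other absorbs (1 + j) n `harmonic n`, once m makes (1 +
    -- j)/(m + 1) ≤ ε. The linear coefficient may grow, but it does not depend on n and only
    -- finitely many rounds are made.
    contract : ∀ {b j} → 0ℚ ≤ b → 0ℚ ≤ j → Bound b j → ∃ λ j′ → 0ℚ ≤ j′ × Bound (3/4 * b + (ε + ε)) j′
    contract {b} {j} 0≤b 0≤j bound = j′ , 0≤j′ , bound′
      where
      m = proj₁ (recip-small (1ℚ + j) ε 0<ε)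
      small = proj₂ (recip-small (1ℚ + j) ε 0<ε)
      j′ = ι l + ½ + (1ℚ + j) * ι m
      0≤j′ : 0ℚ ≤ j′
      0≤j′ = 0≤+ (0≤+ (0≤ι l) (<⇒≤ (positive⁻¹ ½))) (0≤* (0≤+ 0≤1 0≤j) (0≤ι m))
      bound′ : Bound (3/4 * b + (ε + ε)) j′
      bound′ zero    = ≤-trans (bound 0) (≤-reflexive (lemma b j (3/4 * b + (ε + ε)) j′))
        where
        lemma : ∀ b j b′ j′ → b * (0ℚ * 0ℚ) + j * 0ℚ ≡ b′ * (0ℚ * 0ℚ) + j′ * 0ℚ
        lemma = solve-∀ ℚ-ring
      bound′ (suc n′) = ≤-trans (peel n′) (≤-trans (+-mono-≤ (remainder (suc n′)) (tail 0≤b 0≤j bound n′))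
        (final (ι (suc n′)) (harmonic (suc n′)) (0≤ι (suc n′)) (harmonic-bound m (suc n′))))
        where
        final : ∀ x H → 0ℚ ≤ x → H ≤ ι m + recip m * x →
                ε * (x * x) + ι l * x + ½ * x + x * H + (3/4 * b * (x * x) + j * (x * H)) ≤ (3/4 * b + (ε + ε)) * (x * x) + j′ * x
        final x H 0≤x H≤ = ≤-from ((1ℚ + j) * x * (ι m + recip m * x - H) + x * x * (ε - (1ℚ + j) * recip m))
          (0≤+ (0≤* (0≤* (0≤+ 0≤1 0≤j) 0≤x) (0≤- H≤)) (0≤* (0≤* 0≤x 0≤x) (0≤- (small m ℕₚ.≤-refl))))
          (lemma ε x (ι l) H (3/4 * b) j (ι m) (recip m))
          where
          lemma : ∀ ε x l H b j m r → ε * (x * x) + l * x + ½ * x + x * H + (b * (x * x) + j * (x * H)) +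
                  ((1ℚ + j) * x * (m + r * x - H) + x * x * (ε - (1ℚ + j) * r)) ≡ (b + (ε + ε)) * (x * x) + (l + ½ + (1ℚ + j) * m) * x
          lemma = solve-∀ ℚ-ring

    weaken : ∀ {b b′} j → b ≤ b′ → Bound b j → Bound b′ j
    weaken j b≤b′ bound n = ≤-trans (bound n) (+-monoˡ-≤ (j * ι n)
      (*-monoʳ-≤-nonNeg (ι n * ι n) {{nonNegative (0≤* (0≤ι n) (0≤ι n))}} b≤b′))

    private
      -- While b is at least 16ε, the map b ↦ 3b/4 + 2ε lowers it by at least 2ε. Levels spaced by
      -- 2ε above 16ε thus make the iteration a structural recursion.
      level : ℕ → ℚ
      level m = ι 16 * ε + ι m * (ε + ε)

      0≤level : ∀ m → 0ℚ ≤ level m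
      0≤level m = 0≤+ (0≤* (0≤ι 16) 0≤ε) (0≤* (0≤ι m) (0≤+ 0≤ε 0≤ε))

      descend : ∀ m j → 0ℚ ≤ j → Bound (level m) j → ∃ λ j′ → 0ℚ ≤ j′ × Bound (ι 16 * ε) j′
      descend zero    j 0≤j bound = j , 0≤j , weaken j (≤-reflexive (lemma (ι 16 * ε) (ε + ε))) bound
        where
        lemma : ∀ a b → a + 0ℚ * b ≡ a
        lemma = solve-∀ ℚ-ring
      descend (suc m) j 0≤j bound = let (j′ , 0≤j′ , bound′) = contract (0≤level (suc m)) 0≤j bound in
        descend m j′ 0≤j′ (weaken j′ step bound′)
        where
        step : 3/4 * level (suc m) + (ε + ε) ≤ level m
        step = ≤-from (½ * ε + ½ * (ι m * ε)) (0≤+ (0≤* (<⇒≤ (positive⁻¹ ½)) 0≤ε) (0≤* (<⇒≤ (positive⁻¹ ½)) (0≤* (0≤ι m) 0≤ε))) (lemma ε (ι m))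
          where
          lemma : ∀ ε m → 3/4 * (ι 16 * ε + (1ℚ + m) * (ε + ε)) + (ε + ε) + (½ * ε + ½ * (m * ε)) ≡ ι 16 * ε + m * (ε + ε)
          lemma = solve-∀ ℚ-ring

      start : Bound 1ℚ 1ℚ
      start n = ∣∣≤
        (≤-from (½ * (x * x + x) + (½ * (x * x + x - (y + y))) + c * (x * x))
          (0≤+ (0≤+ (0≤* 0≤½ (0≤+ 0≤x² (0≤ι n))) (0≤* 0≤½ (0≤- (ι-h≤ n)))) (0≤* 0≤c 0≤x²)) (lemma c x y))
        (≤-from ((½ - c) * (x * x) + (½ * (x * x) + x + y)) (0≤+ (0≤* (0≤- c≤½) 0≤x²) (0≤+ (0≤+ (0≤* 0≤½ 0≤x²) (0≤ι n)) (0≤ι (h n)))) (lemma′ c x y))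
        where
        x = ι n
        y = ι (h n)
        0≤½ = <⇒≤ (positive⁻¹ ½)
        0≤x² = 0≤* (0≤ι n) (0≤ι n)
        lemma : ∀ c x y → y - c * (x * x) + (½ * (x * x + x) + (½ * (x * x + x - (y + y))) + c * (x * x)) ≡ 1ℚ * (x * x) + 1ℚ * x
        lemma = solve-∀ ℚ-ring
        lemma′ : ∀ c x y → - (y - c * (x * x)) + ((½ - c) * (x * x) + (½ * (x * x) + x + y)) ≡ 1ℚ * (x * x) + 1ℚ * x
        lemma′ = solve-∀ ℚ-ring

    deviation-bound : ∃ λ j → 0ℚ ≤ j × Bound (ι 16 * ε) j
    deviation-bound = let (m , le) = archimedean-* 1ℚ (ε + ε) (+-mono-< 0<ε 0<ε) in
      descend m 1ℚ 0≤1 (weaken 1ℚ (≤-trans le (≤-from (ι 16 * ε) (0≤* (0≤ι 16) 0≤ε) (+-comm (ι m * (ε + ε)) (ι 16 * ε)))) start)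

-- Squaring Leibniz's series to evaluate ζ(2).

module Basel where
  open import Data.Nat.Base as ℕ using (ℕ; zero; suc; s≤s)
  import Data.Nat.Properties as ℕₚ
  import Data.Integer.Base as ℤ
  import Data.Nat.Tactic.RingSolver as ℕ-Solver
  open import Data.Product using (_,_; ∃; proj₁; proj₂)
  open import Data.Rational
  open import Data.Rational.Properties
  open import Function.Base using (_∘_)
  open import Relation.Binary.PropositionalEquality
  open import Tactic.RingSolver using (solve-∀)
  open LinAlg using (ℚ-ring)
  open Rat
  open import Defs using (alternatingSum; alternatingSum-close; term; 0<½; ½+½)

  sgn : ℕ → ℚ
  sgn zero    = 1ℚ
  sgn (suc n) = - sgn n

  sgn-+ : ∀ m n → sgn (m ℕ.+ n) ≡ sgn m * sgn n
  sgn-+ zero    n = sym (*-identityˡ (sgn n))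
  sgn-+ (suc m) n = trans (cong -_ (sgn-+ m n)) (neg-distribˡ-* (sgn m) (sgn n))

  sgn² : ∀ n → sgn n * sgn n ≡ 1ℚ
  sgn² zero    = refl
  sgn² (suc n) = trans (lemma (sgn n)) (sgn² n)
    where
    lemma : ∀ s → (- s) * (- s) ≡ s * s
    lemma = solve-∀ ℚ-ring

  alternating : ∀ n a → alternatingSum a n ≡ Σ< n (λ i → sgn i * a i)
  alternating zero    a = refl
  alternating (suc n) a = begin
    a 0 - alternatingSum (a ∘ suc) n ≡⟨ cong (λ z → a 0 - z) (alternating n (a ∘ suc)) ⟩
    a 0 - Σ< n (λ i → sgn i * a (suc i)) ≡⟨ lemma (a 0) (Σ< n (λ i → sgn i * a (suc i))) ⟩
    1ℚ * a 0 + (- 1ℚ) * Σ< n (λ i → sgn i * a (suc i)) ≡⟨ cong (1ℚ * a 0 +_) (trans (sym (Σ<-* n (- 1ℚ) _)) (Σ<-cong n (λ i _ → lemma′ (sgn i) (a (suc i))))) ⟩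
    1ℚ * a 0 + Σ< n (λ i → sgn (suc i) * a (suc i)) ≡⟨ sym (Σ<-head n (λ i → sgn i * a i)) ⟩
    Σ< (suc n) (λ i → sgn i * a i) ∎
    where
    open ≡-Reasoning
    lemma : ∀ a s → a - s ≡ 1ℚ * a + (- 1ℚ) * s
    lemma = solve-∀ ℚ-ring
    lemma′ : ∀ s a → (- 1ℚ) * (s * a) ≡ (- s) * a
    lemma′ = solve-∀ ℚ-ring

  odd : ℕ → ℚ
  odd n = recip (2 ℕ.* n)

  leibniz oddSquares : ℕ → ℚ
  leibniz N    = Σ< N (λ n → sgn n * odd n)
  oddSquares N = Σ< N (λ n → odd n * odd n)

  eta : ℕ → ℚ
  eta = alternatingSum recip

  eta-suc : ∀ n → eta (suc n) ≡ eta n + sgn n * recip n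
  eta-suc n = trans (alternating (suc n) recip) (cong (_+ sgn n * recip n) (sym (alternating n recip)))

  -- For 0 ≤ n < N this is the sum of (-1)^(m-n)/(m-n) over -N ≤ m < N with m ≠ n, after terms with
  -- opposite m - n have cancelled. It is what multiplies 1/(2n+1) when the off-diagonal products
  -- are split into partial fractions.
  ρ : ℕ → ℕ → ℚ
  ρ N n = eta (N ℕ.+ n) - eta (N ℕ.∸ suc n)

  crossTerms : ℕ → ℚ
  crossTerms N = Σ< N (λ n → odd n * ρ N n)

  -- With A = N + n + 1 and B = N - n, everything follows from A - B = 2n + 1 and A + B = 2N + 1.
  partial-fractions : ∀ v n → let N = suc (v ℕ.+ n) in
    odd n * (recip (N ℕ.+ n) + recip v) ≡ odd N * (ι 4 * odd n + recip v - recip (N ℕ.+ n))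
  partial-fractions v n = general (odd n) (recip (N ℕ.+ n)) (recip v) (odd N) (ι (suc (N ℕ.+ n))) (ι (suc v))
    (recip-ι (N ℕ.+ n)) (recip-ι v)
    (trans (cong (odd n *_) (trans (cong (_- ι (suc v)) (trans (cong ι (eq₁ v n)) (ι-+ (suc (2 ℕ.* n)) (suc v)))) (cancel (ι (suc (2 ℕ.* n))) (ι (suc v))))) (recip-ι (2 ℕ.* n)))
    (trans (cong (odd N *_) (sym (trans (cong ι (eq₂ v n)) (ι-+ (suc (N ℕ.+ n)) (suc v))))) (recip-ι (2 ℕ.* N)))
    where
    N = suc (v ℕ.+ n)
    eq₁ : ∀ v n → suc (suc (v ℕ.+ n) ℕ.+ n) ≡ suc (2 ℕ.* n) ℕ.+ suc v
    eq₁ = ℕ-Solver.solve-∀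
    eq₂ : ∀ v n → suc (2 ℕ.* suc (v ℕ.+ n)) ≡ suc (suc (v ℕ.+ n) ℕ.+ n) ℕ.+ suc v
    eq₂ = ℕ-Solver.solve-∀
    cancel : ∀ a b → a + b - b ≡ a
    cancel = solve-∀ ℚ-ring
    general : ∀ o a b p A B → a * A ≡ 1ℚ → b * B ≡ 1ℚ → o * (A - B) ≡ 1ℚ → p * (A + B) ≡ 1ℚ →
              o * (a + b) ≡ p * (ι 4 * o + b - a)
    general o a b p A B aA bB oC pS = begin
      o * (a + b) ≡⟨ lemma₁ o a b ⟩
      o * (a * 1ℚ + b * 1ℚ) * 1ℚ ≡⟨ trans (cong₂ (λ y z → o * (a * y + b * z) * 1ℚ) (sym bB) (sym aA)) (cong (o * (a * (b * B) + b * (a * A)) *_) (sym pS)) ⟩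
      o * (a * (b * B) + b * (a * A)) * (p * (A + B)) ≡⟨ lemma₂ o a b p A B ⟩
      p * (ι 4 * o * ((a * A) * (b * B)) + o * (A - B) * (b * (a * A) - a * (b * B))) ≡⟨ cong₂ (λ y z → p * (ι 4 * o * (y * z) + o * (A - B) * (b * y - a * z))) aA bB ⟩
      p * (ι 4 * o * (1ℚ * 1ℚ) + o * (A - B) * (b * 1ℚ - a * 1ℚ)) ≡⟨ cong (λ y → p * (ι 4 * o * (1ℚ * 1ℚ) + y * (b * 1ℚ - a * 1ℚ))) oC ⟩
      p * (ι 4 * o * (1ℚ * 1ℚ) + 1ℚ * (b * 1ℚ - a * 1ℚ)) ≡⟨ lemma₃ o a b p ⟩
      p * (ι 4 * o + b - a) ∎
      where
      open ≡-Reasoning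
      lemma₁ : ∀ o a b → o * (a + b) ≡ o * (a * 1ℚ + b * 1ℚ) * 1ℚ
      lemma₁ = solve-∀ ℚ-ring
      lemma₂ : ∀ o a b p A B → o * (a * (b * B) + b * (a * A)) * (p * (A + B)) ≡
               p * (ι 4 * o * ((a * A) * (b * B)) + o * (A - B) * (b * (a * A) - a * (b * B)))
      lemma₂ = solve-∀ ℚ-ring
      lemma₃ : ∀ o a b p → p * (ι 4 * o * (1ℚ * 1ℚ) + 1ℚ * (b * 1ℚ - a * 1ℚ)) ≡ p * (ι 4 * o + b - a)
      lemma₃ = solve-∀ ℚ-ring

  module _ (N : ℕ) where
    private
      f g : ℕ → ℚ
      f n = sgn (N ℕ.+ n) * recip (N ℕ.+ n)
      g n = sgn (N ℕ.+ n) * recip (N ℕ.∸ suc n)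

      sum-f : Σ< N f ≡ eta (N ℕ.+ N) - eta N
      sum-f = trans (lemma (eta N) (Σ< N f)) (cong (_- eta N) (sym (trans (alternating (N ℕ.+ N) recip)
        (trans (Σ<-split N N (λ i → sgn i * recip i)) (cong (_+ Σ< N f) (sym (alternating N recip)))))))
        where
        lemma : ∀ a b → b ≡ (a + b) - a
        lemma = solve-∀ ℚ-ring

      v+ : ∀ {n} → n ℕ.< N → suc (N ℕ.∸ suc n ℕ.+ n) ≡ N
      v+ {n} n<N = trans (sym (ℕₚ.+-suc (N ℕ.∸ suc n) n)) (ℕₚ.m∸n+n≡m n<N)

      sgn-v : ∀ {n} → n ℕ.< N → sgn (N ℕ.+ n) ≡ - sgn (N ℕ.∸ suc n)
      sgn-v {n} n<N = trans (cong (λ m → sgn (m ℕ.+ n)) (sym (v+ n<N))) (cong -_ (trans (sgn-+ (v ℕ.+ n) n) (trans (cong (_* sgn n) (sgn-+ v n))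
        (trans (*-assoc (sgn v) (sgn n) (sgn n)) (trans (cong (sgn v *_) (sgn² n)) (*-identityʳ (sgn v)))))))
        where v = N ℕ.∸ suc n

      sum-g : Σ< N g ≡ - eta N
      sum-g = begin
        Σ< N g ≡⟨ Σ<-cong N (λ n n<N → trans (cong (_* recip (N ℕ.∸ suc n)) (sgn-v n<N)) (lemma (sgn (N ℕ.∸ suc n)) (recip (N ℕ.∸ suc n)))) ⟩
        Σ< N (λ n → (- 1ℚ) * (sgn (N ℕ.∸ suc n) * recip (N ℕ.∸ suc n))) ≡⟨ Σ<-* N (- 1ℚ) _ ⟩
        (- 1ℚ) * Σ< N (λ n → sgn (N ℕ.∸ suc n) * recip (N ℕ.∸ suc n)) ≡⟨ cong ((- 1ℚ) *_) (trans (Σ<-reverse N (λ n → sgn n * recip n)) (sym (alternating N recip))) ⟩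
        (- 1ℚ) * eta N ≡⟨ lemma′ (eta N) ⟩
        - eta N ∎
        where
        open ≡-Reasoning
        lemma : ∀ s r → (- s) * r ≡ (- 1ℚ) * (s * r)
        lemma = solve-∀ ℚ-ring
        lemma′ : ∀ a → (- 1ℚ) * a ≡ - a
        lemma′ = solve-∀ ℚ-ring

      ρ-suc : ∀ n → n ℕ.< N → odd n * ρ (suc N) n ≡ odd n * ρ N n + odd N * (ι 4 * sgn N * (sgn n * odd n) + g n + (- 1ℚ) * f n)
      ρ-suc n n<N = begin
        o * (eta (suc (N ℕ.+ n)) - eta (N ℕ.∸ n)) ≡⟨ cong₂ (λ y z → o * (y - z)) (eta-suc (N ℕ.+ n)) (trans (cong eta (ℕₚ.+-∸-assoc 1 {n = N} {o = suc n} n<N)) (eta-suc v)) ⟩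
        o * ((x + s * a) - (y + sgn v * b)) ≡⟨ cong (λ z → o * ((x + s * a) - (y + z * b))) (trans (double-neg (sgn v)) (cong -_ (sym (sgn-v n<N)))) ⟩
        o * ((x + s * a) - (y + (- s) * b)) ≡⟨ lemma₁ o x y s a b ⟩
        o * (x - y) + s * (o * (a + b)) ≡⟨ cong (λ z → o * (x - y) + s * z) pf ⟩
        o * (x - y) + s * (odd N * (ι 4 * o + b - a)) ≡⟨ cong (λ z → o * (x - y) + z) (lemma₂ s (odd N) o a b) ⟩
        o * (x - y) + odd N * (ι 4 * (s * o) + s * b + (- 1ℚ) * (s * a)) ≡⟨ cong (λ z → o * (x - y) + odd N * (z + s * b + (- 1ℚ) * (s * a))) (trans (cong (λ t → ι 4 * (t * o)) (sgn-+ N n)) (lemma₃ (sgn N) (sgn n) o)) ⟩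
        o * (x - y) + odd N * (ι 4 * sgn N * (sgn n * o) + s * b + (- 1ℚ) * (s * a)) ∎
        where
        open ≡-Reasoning
        v = N ℕ.∸ suc n
        o = odd n
        a = recip (N ℕ.+ n)
        b = recip v
        s = sgn (N ℕ.+ n)
        x = eta (N ℕ.+ n)
        y = eta v
        pf : o * (a + b) ≡ odd N * (ι 4 * o + b - a)
        pf = subst (λ m → o * (recip (m ℕ.+ n) + b) ≡ odd m * (ι 4 * o + b - recip (m ℕ.+ n))) (v+ n<N) (partial-fractions v n)
        double-neg : ∀ s → s ≡ - - s
        double-neg = solve-∀ ℚ-ring
        lemma₁ : ∀ o x y s a b → o * ((x + s * a) - (y + (- s) * b)) ≡ o * (x - y) + s * (o * (a + b))
        lemma₁ = solve-∀ ℚ-ring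
        lemma₂ : ∀ s p o a b → s * (p * (ι 4 * o + b - a)) ≡ p * (ι 4 * (s * o) + s * b + (- 1ℚ) * (s * a))
        lemma₂ = solve-∀ ℚ-ring
        lemma₃ : ∀ s t o → ι 4 * (s * t * o) ≡ ι 4 * s * (t * o)
        lemma₃ = solve-∀ ℚ-ring

      ρ-last : ρ (suc N) N ≡ eta (N ℕ.+ N) + odd N
      ρ-last = begin
        eta (suc (N ℕ.+ N)) - eta (N ℕ.∸ N) ≡⟨ cong₂ _-_ (eta-suc (N ℕ.+ N)) (cong eta (ℕₚ.n∸n≡0 N)) ⟩
        eta (N ℕ.+ N) + sgn (N ℕ.+ N) * recip (N ℕ.+ N) - 0ℚ ≡⟨ cong (λ z → eta (N ℕ.+ N) + z * recip (N ℕ.+ N) - 0ℚ) (trans (sgn-+ N N) (sgn² N)) ⟩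
        eta (N ℕ.+ N) + 1ℚ * recip (N ℕ.+ N) - 0ℚ ≡⟨ lemma (eta (N ℕ.+ N)) (recip (N ℕ.+ N)) ⟩
        eta (N ℕ.+ N) + recip (N ℕ.+ N) ≡⟨ cong (λ m → eta (N ℕ.+ N) + recip (N ℕ.+ m)) (sym (ℕₚ.+-identityʳ N)) ⟩
        eta (N ℕ.+ N) + odd N ∎
        where
        open ≡-Reasoning
        lemma : ∀ a b → a + 1ℚ * b - 0ℚ ≡ a + b
        lemma = solve-∀ ℚ-ring

    -- Each segment `ρ` gains one term at either end. By `partial-fractions` the gains sum to
    -- `odd N` times a multiple of `leibniz N` minus `eta (N + N)`, and the latter cancels against
    -- the new summand n = N.
    crossTerms-suc : crossTerms (suc N) ≡ crossTerms N + odd N * (ι 4 * sgn N * leibniz N + odd N)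
    crossTerms-suc = begin
      Σ< N (λ n → odd n * ρ (suc N) n) + odd N * ρ (suc N) N
        ≡⟨ cong₂ _+_ (trans (Σ<-cong N ρ-suc) (trans (Σ<-+ N _ _) (cong (crossTerms N +_) (trans (Σ<-* N (odd N) _) (cong (odd N *_)
             (trans (Σ<-+ N _ _) (cong₂ _+_ (trans (Σ<-+ N _ _) (cong₂ _+_ (Σ<-* N (ι 4 * sgn N) _) sum-g)) (trans (Σ<-* N (- 1ℚ) f) (cong ((- 1ℚ) *_) sum-f)))))))))
             (cong (odd N *_) ρ-last) ⟩
      crossTerms N + odd N * (ι 4 * sgn N * leibniz N + - eta N + (- 1ℚ) * (eta (N ℕ.+ N) - eta N)) + odd N * (eta (N ℕ.+ N) + odd N)
        ≡⟨ lemma (crossTerms N) (odd N) (ι 4 * sgn N * leibniz N) (eta N) (eta (N ℕ.+ N)) ⟩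
      crossTerms N + odd N * (ι 4 * sgn N * leibniz N + odd N) ∎
      where
      open ≡-Reasoning
      lemma : ∀ c o l e e′ → c + o * (l + - e + (- 1ℚ) * (e′ - e)) + o * (e′ + o) ≡ c + o * (l + o)
      lemma = solve-∀ ℚ-ring

  -- 2 (Σ_{n<N} (-1)^n/(2n+1))² expanded over -N ≤ n < N, where the off-diagonal terms telescope in partial fractions.
  leibniz² : ∀ N → ι 2 * (leibniz N * leibniz N) ≡ oddSquares N + crossTerms N
  leibniz² zero    = refl
  leibniz² (suc N) = begin
    ι 2 * ((t + s * o) * (t + s * o)) ≡⟨ lemma t s o ⟩
    ι 2 * (t * t) + ι 4 * s * t * o + ι 2 * (o * o) * (s * s) ≡⟨ cong₂ (λ y z → y + ι 4 * s * t * o + ι 2 * (o * o) * z) (leibniz² N) (sgn² N) ⟩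
    oddSquares N + crossTerms N + ι 4 * s * t * o + ι 2 * (o * o) * 1ℚ ≡⟨ lemma′ (oddSquares N) (crossTerms N) (ι 4 * s * t) o ⟩
    oddSquares N + o * o + (crossTerms N + o * (ι 4 * s * t + o)) ≡⟨ cong (oddSquares N + o * o +_) (sym (crossTerms-suc N)) ⟩
    oddSquares N + o * o + crossTerms (suc N) ∎
    where
    open ≡-Reasoning
    t = leibniz N
    s = sgn N
    o = odd N
    lemma : ∀ t s o → ι 2 * ((t + s * o) * (t + s * o)) ≡ ι 2 * (t * t) + ι 4 * s * t * o + ι 2 * (o * o) * (s * s)
    lemma = solve-∀ ℚ-ring
    lemma′ : ∀ a c l o → a + c + l * o + ι 2 * (o * o) * 1ℚ ≡ a + o * o + (c + o * (l + o))
    lemma′ = solve-∀ ℚ-ring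

  -- An alternating segment with decreasing terms is bounded by its first term.
  ∣ρ∣≤ : ∀ N n → n ℕ.< N → ∣ ρ N n ∣ ≤ recip (N ℕ.∸ suc n)
  ∣ρ∣≤ N n n<N = alternatingSum-close recip (λ i → recip-anti (ℕₚ.n≤1+n i)) 0≤recip (N ℕ.∸ suc n) (N ℕ.+ n)
    (ℕₚ.≤-trans (ℕₚ.m∸n≤m N (suc n)) (ℕₚ.m≤m+n N n))

  recip-* : ∀ n v → recip n * recip v ≡ recip (n ℕ.+ suc v) * (recip n + recip v)
  recip-* n v = general (recip n) (recip v) (recip (n ℕ.+ suc v)) (ι (suc n)) (ι (suc v)) (recip-ι n) (recip-ι v)
    (trans (cong (recip (n ℕ.+ suc v) *_) (sym (ι-+ (suc n) (suc v)))) (recip-ι (n ℕ.+ suc v)))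
    where
    general : ∀ a b c A B → a * A ≡ 1ℚ → b * B ≡ 1ℚ → c * (A + B) ≡ 1ℚ → a * b ≡ c * (a + b)
    general a b c A B aA bB cS = begin
      a * b ≡⟨ sym (*-identityʳ (a * b)) ⟩
      a * b * 1ℚ ≡⟨ cong (a * b *_) (sym cS) ⟩
      a * b * (c * (A + B)) ≡⟨ lemma a b c A B ⟩
      c * (b * (a * A) + a * (b * B)) ≡⟨ cong₂ (λ y z → c * (b * y + a * z)) aA bB ⟩
      c * (b * 1ℚ + a * 1ℚ) ≡⟨ lemma′ a b c ⟩
      c * (a + b) ∎
      where
      open ≡-Reasoning
      lemma : ∀ a b c A B → a * b * (c * (A + B)) ≡ c * (b * (a * A) + a * (b * B))
      lemma = solve-∀ ℚ-ring
      lemma′ : ∀ a b c → c * (b * 1ℚ + a * 1ℚ) ≡ c * (a + b)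
      lemma′ = solve-∀ ℚ-ring

  0≤odd : ∀ n → 0ℚ ≤ odd n
  0≤odd n = 0≤recip (2 ℕ.* n)

  -- Estimate 1/(2n + 1) by 1/(n + 1); by `recip-*` the product 1/((n + 1)(N - n)) then splits with
  -- the common factor 1/(N + 1).
  ∣crossTerms∣≤ : ∀ N → ∣ crossTerms N ∣ ≤ recip N * (harmonic N + harmonic N)
  ∣crossTerms∣≤ N = begin
    ∣ crossTerms N ∣ ≤⟨ Σ<-∣∣ N pointwise ⟩
    Σ< N (λ n → recip N * (recip n + recip (N ℕ.∸ suc n))) ≡⟨ trans (Σ<-* N (recip N) _) (cong (recip N *_) (trans (Σ<-+ N _ _) (cong (harmonic N +_) (Σ<-reverse N recip)))) ⟩
    recip N * (harmonic N + harmonic N) ∎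
    where
    open ≤-Reasoning
    pointwise : ∀ n → n ℕ.< N → ∣ odd n * ρ N n ∣ ≤ recip N * (recip n + recip (N ℕ.∸ suc n))
    pointwise n n<N = begin
      ∣ odd n * ρ N n ∣ ≡⟨ trans (∣p*q∣≡∣p∣*∣q∣ (odd n) (ρ N n)) (cong (_* ∣ ρ N n ∣) (0≤p⇒∣p∣≡p (0≤odd n))) ⟩
      odd n * ∣ ρ N n ∣ ≤⟨ *-mono (odd n) (0≤odd n) (∣ρ∣≤ N n n<N) ⟩
      odd n * recip (N ℕ.∸ suc n) ≤⟨ *-monoʳ-≤-nonNeg (recip (N ℕ.∸ suc n)) {{nonNegative (0≤recip (N ℕ.∸ suc n))}} (recip-anti (ℕₚ.m≤m+n n (n ℕ.+ 0))) ⟩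
      recip n * recip (N ℕ.∸ suc n) ≡⟨ recip-* n (N ℕ.∸ suc n) ⟩
      recip (n ℕ.+ suc (N ℕ.∸ suc n)) * (recip n + recip (N ℕ.∸ suc n)) ≡⟨ cong (λ m → recip m * (recip n + recip (N ℕ.∸ suc n))) (trans (ℕₚ.+-suc n (N ℕ.∸ suc n)) (ℕₚ.m+[n∸m]≡n n<N)) ⟩
      recip N * (recip n + recip (N ℕ.∸ suc n)) ∎

  recip*ι≤1 : ∀ N → recip N * ι N ≤ 1ℚ
  recip*ι≤1 N = ≤-trans (*-mono (recip N) (0≤recip N) (ι-mono (ℕₚ.n≤1+n N))) (≤-reflexive (recip-ι N))

  crossTerms-small : ∀ ε → 0ℚ < ε → ∃ λ M → ∀ N → M ℕ.≤ N → ∣ crossTerms N ∣ ≤ ε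
  crossTerms-small ε 0<ε = M , λ N M≤N → ≤-trans (∣crossTerms∣≤ N) (bound (harmonic N) (recip N) (ι N)
      (harmonic-bound m N) (0≤recip N) (recip*ι≤1 N) (small′ N M≤N))
    where
    small = recip-small (ι 2) (ε * ½) (0<½ 0<ε)
    m = proj₁ small
    small″ = recip-small (ι 2 * ι m) (ε * ½) (0<½ 0<ε)
    M = proj₁ small″
    small′ = proj₂ small″
    bound : ∀ h r x → h ≤ ι m + recip m * x → 0ℚ ≤ r → r * x ≤ 1ℚ → ι 2 * ι m * r ≤ ε * ½ → r * (h + h) ≤ ε
    bound h r x h≤ 0≤r rx≤1 s = ≤-trans (≤-from (ι 2 * (r * (ι m + recip m * x - h)) + ι 2 * recip m * (1ℚ - r * x))
        (0≤+ (0≤* (0≤ι 2) (0≤* 0≤r (0≤- h≤))) (0≤* (0≤* (0≤ι 2) (0≤recip m)) (0≤- rx≤1)))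
        (lemma h r x (ι m) (recip m)))
      (≤-trans (+-mono-≤ s (proj₂ small m ℕₚ.≤-refl)) (≤-reflexive (½+½ ε)))
      where
      lemma : ∀ h r x m a → r * (h + h) + (ι 2 * (r * (m + a * x - h)) + ι 2 * a * (1ℚ - r * x)) ≡ ι 2 * m * r + ι 2 * a
      lemma = solve-∀ ℚ-ring

  -- Split the squares up to 2N by parity; the even ones contribute a quarter of `ζ N`.
  ζ-double : ∀ N → ι 4 * ζ (2 ℕ.* N) ≡ ι 4 * oddSquares N + ζ N
  ζ-double zero    = refl
  ζ-double (suc N) = begin
    ι 4 * ζ (2 ℕ.* suc N) ≡⟨ cong (λ n → ι 4 * ζ n) (eq N) ⟩
    ι 4 * (ζ (2 ℕ.* N) + odd N * odd N + e * e) ≡⟨ lemma (ζ (2 ℕ.* N)) (odd N * odd N) e ⟩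
    ι 4 * ζ (2 ℕ.* N) + ι 4 * (odd N * odd N) + (ι 2 * e) * (ι 2 * e) ≡⟨ cong₂ (λ y z → y + ι 4 * (odd N * odd N) + z * z) (ζ-double N) half ⟩
    ι 4 * oddSquares N + ζ N + ι 4 * (odd N * odd N) + recip N * recip N ≡⟨ lemma′ (oddSquares N) (ζ N) (odd N * odd N) (recip N * recip N) ⟩
    ι 4 * (oddSquares N + odd N * odd N) + (ζ N + recip N * recip N) ∎
    where
    open ≡-Reasoning
    e = recip (suc (2 ℕ.* N))
    eq : ∀ N → 2 ℕ.* suc N ≡ suc (suc (2 ℕ.* N))
    eq = ℕ-Solver.solve-∀
    half : ι 2 * e ≡ recip N
    half = recip-unique N (ι 2 * e) (trans (lemma (ι 2) e (ι (suc N))) (trans (cong (e *_) (trans (sym (ι-* 2 (suc N))) (cong ι (eq N)))) (recip-ι (suc (2 ℕ.* N)))))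
      where
      lemma : ∀ t e x → t * e * x ≡ e * (t * x)
      lemma = solve-∀ ℚ-ring
    lemma : ∀ z o e → ι 4 * (z + o + e * e) ≡ ι 4 * z + ι 4 * o + (ι 2 * e) * (ι 2 * e)
    lemma = solve-∀ ℚ-ring
    lemma′ : ∀ s z o r → ι 4 * s + z + ι 4 * o + r ≡ ι 4 * (s + o) + (z + r)
    lemma′ = solve-∀ ℚ-ring

  term≡ : ∀ i → term i ≡ ι 4 * odd i
  term≡ i = begin
    term i ≡⟨ sym (*-identityʳ (term i)) ⟩
    term i * 1ℚ ≡⟨ cong (term i *_) (sym (recip-ι (2 ℕ.* i))) ⟩
    term i * (odd i * ι (suc (2 ℕ.* i))) ≡⟨ lemma (term i) (odd i) (ι (suc (2 ℕ.* i))) ⟩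
    term i * ι (suc (2 ℕ.* i)) * odd i ≡⟨ cong (_* odd i) (/-ι 4 (2 ℕ.* i)) ⟩
    ι 4 * odd i ∎
    where
    open ≡-Reasoning
    lemma : ∀ a b c → a * (b * c) ≡ a * c * b
    lemma = solve-∀ ℚ-ring

  π-seq : ∀ N → alternatingSum term N ≡ ι 4 * leibniz N
  π-seq N = trans (alternating N term) (trans (Σ<-cong N (λ i _ → trans (cong (sgn i *_) (term≡ i)) (lemma (sgn i) (odd i)))) (Σ<-* N (ι 4) _))
    where
    lemma : ∀ s o → s * (ι 4 * o) ≡ ι 4 * (s * o)
    lemma = solve-∀ ℚ-ring

  -- In the limit the odd squares make up 3/4 of ζ(2), so 16 times the squared Leibniz sum is 8 ·
  -- 3/4 · ζ(2). With finite sums, `ζ-double` leaves the difference of two partial sums as an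
  -- explicit error.
  π²-6ζ : ∀ N → alternatingSum term N * alternatingSum term N - ι 6 * ζ N ≡ ι 8 * (ζ (2 ℕ.* N) - ζ N) + ι 8 * crossTerms N
  π²-6ζ N = begin
    alternatingSum term N * alternatingSum term N - ι 6 * ζ N ≡⟨ cong (λ s → s * s - ι 6 * ζ N) (π-seq N) ⟩
    ι 4 * t * (ι 4 * t) - ι 6 * ζ N ≡⟨ lemma₁ t (ζ N) ⟩
    ι 8 * (ι 2 * (t * t)) - ι 6 * ζ N ≡⟨ cong (λ z → ι 8 * z - ι 6 * ζ N) (leibniz² N) ⟩
    ι 8 * (oddSquares N + crossTerms N) - ι 6 * ζ N ≡⟨ lemma₂ (oddSquares N) (crossTerms N) (ζ N) ⟩
    ι 2 * (ι 4 * oddSquares N + ζ N) - ι 8 * ζ N + ι 8 * crossTerms N ≡⟨ cong (λ z → ι 2 * z - ι 8 * ζ N + ι 8 * crossTerms N) (sym (ζ-double N)) ⟩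
    ι 2 * (ι 4 * ζ (2 ℕ.* N)) - ι 8 * ζ N + ι 8 * crossTerms N ≡⟨ lemma₃ (ζ (2 ℕ.* N)) (ζ N) (crossTerms N) ⟩
    ι 8 * (ζ (2 ℕ.* N) - ζ N) + ι 8 * crossTerms N ∎
    where
    open ≡-Reasoning
    t = leibniz N
    lemma₁ : ∀ t z → ι 4 * t * (ι 4 * t) - ι 6 * z ≡ ι 8 * (ι 2 * (t * t)) - ι 6 * z
    lemma₁ = solve-∀ ℚ-ring
    lemma₂ : ∀ o c z → ι 8 * (o + c) - ι 6 * z ≡ ι 2 * (ι 4 * o + z) - ι 8 * z + ι 8 * c
    lemma₂ = solve-∀ ℚ-ring
    lemma₃ : ∀ y z c → ι 2 * (ι 4 * y) - ι 8 * z + ι 8 * c ≡ ι 8 * (y - z) + ι 8 * c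
    lemma₃ = solve-∀ ℚ-ring

  ζ-cauchy : ∀ {m n} → m ℕ.≤ n → ∣ ζ (suc n) - ζ (suc m) ∣ ≤ recip m
  ζ-cauchy {m} {n} m≤n = ≤-trans (≤-reflexive (0≤p⇒∣p∣≡p (0≤- (ζ-mono (s≤s m≤n)))))
    (≤-from (ζ (suc m) + recip m - (ζ (suc n) + recip n) + recip n) (0≤+ (0≤- (ζ-upper m≤n)) (0≤recip n))
      (lemma (ζ (suc n)) (ζ (suc m)) (recip m) (recip n)))
    where
    lemma : ∀ y z a b → y - z + (z + a - (y + b) + b) ≡ a
    lemma = solve-∀ ℚ-ring

  basel : ∀ ε → 0ℚ < ε → ∃ λ M → ∀ N → M ℕ.≤ N → ∣ alternatingSum term (suc N) * alternatingSum term (suc N) - ι 6 * ζ (suc N) ∣ ≤ ε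
  basel ε 0<ε = M ℕ.⊔ M′ , λ N ≤N → begin
      ∣ alternatingSum term (suc N) * alternatingSum term (suc N) - ι 6 * ζ (suc N) ∣ ≡⟨ cong ∣_∣ (π²-6ζ (suc N)) ⟩
      ∣ ι 8 * (ζ (2 ℕ.* suc N) - ζ (suc N)) + ι 8 * crossTerms (suc N) ∣ ≤⟨ ∣p+q∣≤∣p∣+∣q∣ (ι 8 * (ζ (2 ℕ.* suc N) - ζ (suc N))) (ι 8 * crossTerms (suc N)) ⟩
      ∣ ι 8 * (ζ (2 ℕ.* suc N) - ζ (suc N)) ∣ + ∣ ι 8 * crossTerms (suc N) ∣ ≡⟨ cong₂ _+_ (∣p*q∣≡∣p∣*∣q∣ (ι 8) (ζ (2 ℕ.* suc N) - ζ (suc N))) (∣p*q∣≡∣p∣*∣q∣ (ι 8) (crossTerms (suc N))) ⟩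
      ι 8 * ∣ ζ (2 ℕ.* suc N) - ζ (suc N) ∣ + ι 8 * ∣ crossTerms (suc N) ∣ ≤⟨ +-mono-≤ (*-mono (ι 8) (0≤ι 8) (ζ-cauchy {N} (ℕₚ.m≤m+n N _))) (*-mono (ι 8) (0≤ι 8) (proj₂ small (suc N) (ℕₚ.m≤n⇒m≤1+n (ℕₚ.m⊔n≤o⇒m≤o M M′ ≤N)))) ⟩
      ι 8 * recip N + ι 8 * (ε * (ℤ.+ 1 / 16)) ≤⟨ +-monoˡ-≤ (ι 8 * (ε * (ℤ.+ 1 / 16))) (proj₂ small′ N (ℕₚ.m⊔n≤o⇒n≤o M M′ ≤N)) ⟩
      ε * ½ + ι 8 * (ε * (ℤ.+ 1 / 16)) ≡⟨ lemma ε ⟩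
      ε ∎
    where
    open ≤-Reasoning
    small = crossTerms-small (ε * (ℤ.+ 1 / 16)) (subst (_< ε * (ℤ.+ 1 / 16)) (*-zeroˡ (ℤ.+ 1 / 16)) (*-monoˡ-<-pos (ℤ.+ 1 / 16) 0<ε))
    M = proj₁ small
    small′ = recip-small (ι 8) (ε * ½) (0<½ 0<ε)
    M′ = proj₁ small′
    lemma : ∀ ε → ε * ½ + ι 8 * (ε * (ℤ.+ 1 / 16)) ≡ ε
    lemma = solve-∀ ℚ-ring

-- Explicit error bounds for the proportion.

module Proportion where
  open import Data.Nat.Base as ℕ using (ℕ; zero; suc; s≤s)
  import Data.Nat.Properties as ℕₚ
  open import Data.Nat.DivMod using (m/n≤m)
  open import Data.List.Properties using (length-filter)
  open import Data.Product using (_,_; ∃₂; proj₁; proj₂)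
  open import Data.Rational
  open import Data.Rational.Properties
  open import Data.Sum using ([_,_]′)
  open import Relation.Binary.PropositionalEquality
  open import Tactic.RingSolver using (solve-∀)
  open LinAlg using (ℚ-ring)
  open Count using (orderCount; orderCount-sum; orderCount-scale; nullityCount; nullityCount≤orderCount; orderCount≤nullityCount; labels; length-labels)
  open Labels using (order)
  open Rat
  open Density
  open Basel
  open import Defs using (P; alternatingSum; term; divide; ∣p-q∣≡∣q-p∣; period)

  0≤½ : 0ℚ ≤ ½
  0≤½ = <⇒≤ (positive⁻¹ ½)

  ∣*∣≤ : ∀ a {b r} → 0ℚ ≤ a → ∣ b ∣ ≤ r → ∣ a * b ∣ ≤ a * r
  ∣*∣≤ a {b} {r} 0≤a le = ≤-trans (≤-reflexive (trans (∣p*q∣≡∣p∣*∣q∣ a b) (cong (_* ∣ b ∣) (0≤p⇒∣p∣≡p 0≤a)))) (*-mono a 0≤a le)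

  ∣+∣≤ : ∀ {a b r s} → ∣ a ∣ ≤ r → ∣ b ∣ ≤ s → ∣ a + b ∣ ≤ r + s
  ∣+∣≤ {a} {b} ≤r ≤s = ≤-trans (∣p+q∣≤∣p∣+∣q∣ a b) (+-mono-≤ ≤r ≤s)

  square : ∀ p → 0ℚ ≤ p * p
  square p = [ (λ 0≤p → 0≤* 0≤p 0≤p) , (λ p≤0 → subst (0ℚ ≤_) (lemma p) (0≤* (neg-antimono-≤ p≤0) (neg-antimono-≤ p≤0))) ]′ (≤-total 0ℚ p)
    where
    lemma : ∀ p → (- p) * (- p) ≡ p * p
    lemma = solve-∀ ℚ-ring

  orderCount-bound : ∀ n → orderCount 1 n ℕ.+ orderCount 1 n ℕ.≤ n ℕ.* suc n
  orderCount-bound n = ℕₚ.≤-trans (ℕₚ.+-mono-≤ le le) (ℕₚ.≤-reflexive (length-labels n))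
    where le = length-filter (λ v → order v ℕₚ.≟ 1) (labels n)

  module Constant (ε : ℚ) (0<ε : 0ℚ < ε) where
    private
      0≤ε = <⇒≤ 0<ε
      chosen = recip-small 1ℚ ε 0<ε

    l : ℕ
    l = proj₁ chosen

    recip-l≤ε : recip l ≤ ε
    recip-l≤ε = subst (_≤ ε) (*-identityˡ (recip l)) (proj₂ chosen l ℕₚ.≤-refl)

    private
      quotient½ = divide {ζ (suc l)} {½} (<-≤-trans (positive⁻¹ 1ℚ) (1≤ζ l)) (positive⁻¹ ½)

    -- A rational stand-in for 1/(2ζ(2)) = 3/π²: half the inverse of a partial sum that is long
    -- enough for ε.
    c : ℚ
    c = proj₁ quotient½

    0≤c : 0ℚ ≤ c
    0≤c = <⇒≤ (proj₁ (proj₂ quotient½))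

    ζ*c≡½ : ζ (suc l) * c ≡ ½
    ζ*c≡½ = proj₂ (proj₂ quotient½)

    c≤½ : c ≤ ½
    c≤½ = ≤-from ((ζ (suc l) - 1ℚ) * c) (0≤* (0≤- (1≤ζ l)) 0≤c) (trans (lemma c (ζ (suc l))) ζ*c≡½)
      where
      lemma : ∀ c z → c + (z - 1ℚ) * c ≡ z * c
      lemma = solve-∀ ℚ-ring

    -- Beyond l the partial sums agree up to `recip l`, which is at most ε. Before that the factor ½
    -- - c ζ lies between 0 and ½ and the argument is at most l + 1, so the error is linear.
    close : ∀ n → ∣ ι n * ι n * (½ - c * ζ n) ∣ ≤ ε * (ι n * ι n) + ι (suc l) * ι n
    close zero     = ≤-reflexive (lemma c ε (ι (suc l)))
      where
      lemma′ : ∀ c → 0ℚ * 0ℚ * (½ - c * 0ℚ) ≡ 0ℚ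
      lemma′ = solve-∀ ℚ-ring
      lemma″ : ∀ ε l → 0ℚ ≡ ε * (0ℚ * 0ℚ) + l * 0ℚ
      lemma″ = solve-∀ ℚ-ring
      lemma : ∀ c ε l → ∣ 0ℚ * 0ℚ * (½ - c * 0ℚ) ∣ ≡ ε * (0ℚ * 0ℚ) + l * 0ℚ
      lemma c ε l = trans (cong ∣_∣ (lemma′ c)) (lemma″ ε l)
    close (suc n) = [ large , small ]′ (ℕₚ.≤-total l n)
      where
      x = ι (suc n)
      0≤x = 0≤ι (suc n)
      0≤x² = 0≤* 0≤x 0≤x
      bound : ∀ {r} → ∣ ½ - c * ζ (suc n) ∣ ≤ r → ∣ x * x * (½ - c * ζ (suc n)) ∣ ≤ x * x * r
      bound = ∣*∣≤ (x * x) 0≤x²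

      large : l ℕ.≤ n → ∣ x * x * (½ - c * ζ (suc n)) ∣ ≤ ε * (x * x) + ι (suc l) * x
      large l≤n = ≤-trans (bound (≤-trans (≤-reflexive (cong ∣_∣ (trans (cong (_- c * ζ (suc n)) (sym ζ*c≡½)) (lemma (ζ (suc l)) c (ζ (suc n))))))
          (≤-trans (∣*∣≤ c 0≤c (≤-trans (≤-reflexive (∣p-q∣≡∣q-p∣ (ζ (suc l)) (ζ (suc n)))) (≤-trans (ζ-cauchy l≤n) recip-l≤ε)))
            (≤-trans (*-monoʳ-≤-nonNeg ε {{nonNegative 0≤ε}} c≤½) (≤-from (½ * ε) (0≤* 0≤½ 0≤ε) (double ε))))))
        (≤-from (ι (suc l) * x) (0≤* (0≤ι (suc l)) 0≤x) (cong (_+ ι (suc l) * x) (*-comm (x * x) ε)))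
        where
        lemma : ∀ z c y → z * c - c * y ≡ c * (z - y)
        lemma = solve-∀ ℚ-ring
        double : ∀ e → ½ * e + ½ * e ≡ e
        double = solve-∀ ℚ-ring

      small : n ℕ.≤ l → ∣ x * x * (½ - c * ζ (suc n)) ∣ ≤ ε * (x * x) + ι (suc l) * x
      small n≤l = ≤-trans (bound ≤½) (≤-from ((ι (suc l) - x) * x + ½ * (x * x) + ε * (x * x))
          (0≤+ (0≤+ (0≤* (0≤- (ι-mono (s≤s n≤l))) 0≤x) (0≤* 0≤½ 0≤x²)) (0≤* 0≤ε 0≤x²)) (lemma x ε (ι (suc l))))
        where
        lemma : ∀ x e l → x * x * ½ + ((l - x) * x + ½ * (x * x) + e * (x * x)) ≡ e * (x * x) + l * x
        lemma = solve-∀ ℚ-ring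
        cζ≤½ : c * ζ (suc n) ≤ ½
        cζ≤½ = ≤-trans (*-mono c 0≤c (ζ-mono (s≤s n≤l))) (≤-reflexive (trans (*-comm c (ζ (suc l))) ζ*c≡½))
        ≤½ : ∣ ½ - c * ζ (suc n) ∣ ≤ ½
        ≤½ = ≤-trans (≤-reflexive (0≤p⇒∣p∣≡p (0≤- cζ≤½))) (≤-from (c * ζ (suc n)) (0≤* 0≤c (≤-trans 0≤1 (1≤ζ n))) (cancel ½ (c * ζ (suc n))))
          where
          cancel : ∀ a b → a - b + b ≡ a
          cancel = solve-∀ ℚ-ring

    private
      density = deviation-bound (orderCount 1) orderCount-sum orderCount-bound c ε 0≤c c≤½ 0<ε (suc l) close

    j : ℚ
    j = proj₁ density

    0≤j : 0ℚ ≤ j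
    0≤j = proj₁ (proj₂ density)

    orderCount-density : ∀ n → ∣ ι (orderCount 1 n) - c * (ι n * ι n) ∣ ≤ ι 16 * ε * (ι n * ι n) + j * ι n
    orderCount-density = proj₂ (proj₂ density)

    -- As u X = 1 and c ζ(l + 1) = ½, the difference is c u times (X - 6y) + 6 (y - ζ(l + 1)). The
    -- factor c u lies between 0 and 1, and the errors add up to ε + 6ε.
    ratio : ∀ {u X y} → u * X ≡ 1ℚ → 1ℚ ≤ X → ∣ X - ι 6 * y ∣ ≤ ε → ∣ y - ζ (suc l) ∣ ≤ recip l → ∣ c - ι 3 * u ∣ ≤ ι 7 * ε
    ratio {u} {X} {y} uX≡1 1≤X X≈ y≈ = ≤-trans (≤-reflexive (cong ∣_∣ identity))
      (≤-trans (∣*∣≤ (c * u) (0≤* 0≤c 0≤u) (∣+∣≤ X≈ (∣*∣≤ (ι 6) (0≤ι 6) (≤-trans y≈ recip-l≤ε))))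
        (≤-from ((1ℚ - c * u) * (ι 7 * ε)) (0≤* (0≤- cu≤1) (0≤* (0≤ι 7) 0≤ε)) (lemma₃ (c * u) ε)))
      where
      z = ζ (suc l)
      lemma₁ : ∀ u X → u * (u * X) ≡ u * u * X
      lemma₁ = solve-∀ ℚ-ring
      lemma₂ : ∀ c u X → c * u + c * (u * (X - 1ℚ) + (½ - c) * (1ℚ + 1ℚ)) ≡ c * (u * X) + c * ((½ - c) * (1ℚ + 1ℚ))
      lemma₂ = solve-∀ ℚ-ring
      lemma₃ : ∀ a e → a * (e + ι 6 * e) + (1ℚ - a) * (ι 7 * e) ≡ ι 7 * e
      lemma₃ = solve-∀ ℚ-ring
      lemma₄ : ∀ u X → u + u * (X - 1ℚ) ≡ u * X
      lemma₄ = solve-∀ ℚ-ring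
      0≤u : 0ℚ ≤ u
      0≤u = subst (0ℚ ≤_) (trans (sym (lemma₁ u X)) (trans (cong (u *_) uX≡1) (*-identityʳ u)))
        (0≤* (square u) (≤-trans 0≤1 1≤X))
      u≤1 : u ≤ 1ℚ
      u≤1 = ≤-from (u * (X - 1ℚ)) (0≤* 0≤u (0≤- 1≤X)) (trans (lemma₄ u X) uX≡1)
      cu≤1 : c * u ≤ 1ℚ
      cu≤1 = ≤-trans (*-mono c 0≤c u≤1) (≤-trans (≤-reflexive (*-identityʳ c)) (≤-trans c≤½ (≤-from ½ 0≤½ refl)))
      identity : c - ι 3 * u ≡ c * u * ((X - ι 6 * y) + ι 6 * (y - z))
      identity = begin
        c - ι 3 * u ≡⟨ lemma₅ c u ⟩
        c * 1ℚ - ι 6 * u * ½ ≡⟨ cong₂ (λ a b → c * a - ι 6 * u * b) (sym uX≡1) (sym ζ*c≡½) ⟩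
        c * (u * X) - ι 6 * u * (z * c) ≡⟨ lemma₆ c u X y z ⟩
        c * u * ((X - ι 6 * y) + ι 6 * (y - z)) ∎
        where
        open ≡-Reasoning
        lemma₅ : ∀ c u → c - ι 3 * u ≡ c * 1ℚ - ι 6 * u * ½
        lemma₅ = solve-∀ ℚ-ring
        lemma₆ : ∀ c u X y z → c * (u * X) - ι 6 * u * (z * c) ≡ c * u * ((X - ι 6 * y) + ι 6 * (y - z))
        lemma₆ = solve-∀ ℚ-ring

    module _ (z : ℕ) where
      C : ℚ
      C = sq z + sq (suc z)

      sq≤1 : ∀ n → sq n ≤ 1ℚ
      sq≤1 n = ≤-trans (*-mono (recip n) (0≤recip n) (recip≤1 n)) (≤-trans (≤-reflexive (*-identityʳ (recip n))) (recip≤1 n))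

      0≤C : 0ℚ ≤ C
      0≤C = 0≤+ (0≤sq z) (0≤sq (suc z))

      C≤2 : C ≤ ι 2
      C≤2 = +-mono-≤ (sq≤1 z) (sq≤1 (suc z))

      orderCount-error : ∀ k g → ∣ ι (orderCount (suc g) k) - c * (ι k * ι k * sq g) ∣ ≤ ι 16 * ε * (ι k * ι k) + (j + 1ℚ) * ι k
      orderCount-error k g = subst (λ t → ∣ t ∣ ≤ ι 16 * ε * (x * x) + (j + 1ℚ) * x)
        (trans (lemma (ι (orderCount 1 (k ℕ./ suc g))) c (f * f) (x * x * sq g)) (cong (λ m → ι m - c * (x * x * sq g)) (sym (orderCount-scale g k))))
        (≤-trans (∣+∣≤ (orderCount-density (k ℕ./ suc g)) ≤x) (≤-from
          (ι 16 * ε * (x * x - f * f) + j * (x - f))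
          (0≤+ (0≤* (0≤* (0≤ι 16) 0≤ε) (0≤- f²≤x²)) (0≤* 0≤j (0≤- f≤x))) (lemma′ (ι 16 * ε) x f j)))
        where
        x = ι k
        f = quotient k g
        f≤x : f ≤ x
        f≤x = ι-mono (m/n≤m k (suc g))
        f²≤x² : f * f ≤ x * x
        f²≤x² = ≤-trans (*-mono f (0≤quotient k g) f≤x) (≤-trans (≤-reflexive (*-comm f x)) (*-mono x (0≤ι k) f≤x))
        lemma : ∀ o c f² y → o - c * f² + (- c) * (y - f²) ≡ o - c * y
        lemma = solve-∀ ℚ-ring
        lemma′ : ∀ e x f j → e * (f * f) + j * f + x + (e * (x * x - f * f) + j * (x - f)) ≡ e * (x * x) + (j + 1ℚ) * x
        lemma′ = solve-∀ ℚ-ring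
        ≤x : ∣ (- c) * (x * x * sq g - f * f) ∣ ≤ x
        ≤x = begin
          ∣ (- c) * (x * x * sq g - f * f) ∣ ≡⟨ trans (∣p*q∣≡∣p∣*∣q∣ (- c) (x * x * sq g - f * f)) (trans (cong (_* ∣ x * x * sq g - f * f ∣) (∣-p∣≡∣p∣ c)) (sym (∣p*q∣≡∣p∣*∣q∣ c (x * x * sq g - f * f)))) ⟩
          ∣ c * (x * x * sq g - f * f) ∣ ≡⟨ 0≤p⇒∣p∣≡p (0≤* 0≤c (0≤- (quotient²≤ k g))) ⟩
          c * (x * x * sq g - f * f) ≤⟨ *-mono c 0≤c (≤-from (f * f + (1ℚ + 1ℚ) * (x * recip g) - x * x * sq g) (0≤- (≤quotient²+ k g)) (cancel (x * x * sq g) (f * f) ((1ℚ + 1ℚ) * (x * recip g)))) ⟩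
          c * ((1ℚ + 1ℚ) * (x * recip g)) ≤⟨ *-monoʳ-≤-nonNeg ((1ℚ + 1ℚ) * (x * recip g)) {{nonNegative (0≤* (0≤+ 0≤1 0≤1) (0≤ι*recip k g))}} c≤½ ⟩
          ½ * ((1ℚ + 1ℚ) * (x * recip g)) ≡⟨ half (x * recip g) ⟩
          x * recip g ≤⟨ *-mono x (0≤ι k) (recip≤1 g) ⟩
          x * 1ℚ ≡⟨ *-identityʳ x ⟩
          x ∎
          where
          open ≤-Reasoning
          cancel : ∀ a s t → a - s + (s + t - a) ≡ t
          cancel = solve-∀ ℚ-ring
          half : ∀ a → ½ * ((1ℚ + 1ℚ) * a) ≡ a
          half = solve-∀ ℚ-ring

      module _ (k′ : ℕ) where
        private
          k = suc k′
          x = ι k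
          0≤x = 0≤ι k
          n = nullityCount (suc z) k
          o₁ = orderCount (suc (suc z)) k
          o₂ = orderCount (suc z) k

        nullityCount-error : ∣ ι n - (ι o₁ + ι o₂) ∣ ≤ ι 3 * x
        nullityCount-error = ∣∣≤
          (≤-from (ι 3 * x - (1ℚ + (x + x)) + (1ℚ + (x + x) + (ι o₁ + ι o₂) - ι n)) (0≤+ slack (0≤- upper)) (lemma (ι n) (ι o₁ + ι o₂) x))
          (≤-from (ι 3 * x - (1ℚ + (x + x)) + (1ℚ + (x + x) + ι n - (ι o₁ + ι o₂))) (0≤+ slack (0≤- lower)) (lemma′ (ι n) (ι o₁ + ι o₂) x))
          where
          lemma : ∀ n o x → n - o + (ι 3 * x - (1ℚ + (x + x)) + (1ℚ + (x + x) + o - n)) ≡ ι 3 * x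
          lemma = solve-∀ ℚ-ring
          lemma′ : ∀ n o x → - (n - o) + (ι 3 * x - (1ℚ + (x + x)) + (1ℚ + (x + x) + n - o)) ≡ ι 3 * x
          lemma′ = solve-∀ ℚ-ring
          slack : 0ℚ ≤ ι 3 * x - (1ℚ + (x + x))
          slack = ≤-trans (0≤- (1≤ι k′)) (≤-reflexive (lemma″ x))
            where
            lemma″ : ∀ x → x - 1ℚ ≡ ι 3 * x - (1ℚ + (x + x))
            lemma″ = solve-∀ ℚ-ring
          upper : ι n ≤ 1ℚ + (x + x) + (ι o₁ + ι o₂)
          upper = ≤-trans (ι-mono (nullityCount≤orderCount (suc z) k)) (≤-reflexive (trans (ι-+ (suc (k ℕ.+ k)) (o₁ ℕ.+ o₂)) (cong₂ _+_ (cong (1ℚ +_) (ι-+ k k)) (ι-+ o₁ o₂))))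
          lower : ι o₁ + ι o₂ ≤ 1ℚ + (x + x) + ι n
          lower = ≤-trans (≤-reflexive (sym (ι-+ o₁ o₂))) (≤-trans (ι-mono (orderCount≤nullityCount (suc z) k)) (≤-reflexive (trans (ι-+ (suc (k ℕ.+ k)) n) (cong (_+ ι n) (cong (1ℚ +_) (ι-+ k k))))))

        -- The linear error consists of 3 from `nullityCount-error`, j + 1 from each of the two
        -- order counts, and 1 for passing from k² to the period k² + k.
        nullityCount-density : ∣ ι n - c * C * (x * x + x) ∣ ≤ ι 32 * ε * (x * x) + (ι 6 + ι 2 * j) * x
        nullityCount-density = subst₂ (λ s t → ∣ s ∣ ≤ t) (lemma (ι n) (ι o₁) (ι o₂) c (x * x) x (sq z) (sq (suc z))) (lemma′ ε (x * x) x j)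
          (∣+∣≤ (∣+∣≤ nullityCount-error (∣+∣≤ (orderCount-error k (suc z)) (orderCount-error k z))) ≤x)
          where
          lemma : ∀ n o₁ o₂ c y x a b → n - (o₁ + o₂) + ((o₁ - c * (y * b)) + (o₂ - c * (y * a))) + (- (c * (a + b)) * x) ≡ n - c * (a + b) * (y + x)
          lemma = solve-∀ ℚ-ring
          lemma′ : ∀ e y x j → ι 3 * x + ((ι 16 * e * y + (j + 1ℚ) * x) + (ι 16 * e * y + (j + 1ℚ) * x)) + x ≡ ι 32 * e * y + (ι 6 + ι 2 * j) * x
          lemma′ = solve-∀ ℚ-ring
          ≤x : ∣ - (c * C) * x ∣ ≤ x
          ≤x = ≤-trans (≤-reflexive (trans (cong ∣_∣ (sym (neg-distribˡ-* (c * C) x))) (trans (∣-p∣≡∣p∣ (c * C * x)) (0≤p⇒∣p∣≡p (0≤* (0≤* 0≤c 0≤C) 0≤x)))))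
            (≤-from ((½ - c) * C * x + ½ * (ι 2 - C) * x) (0≤+ (0≤* (0≤* (0≤- c≤½) 0≤C) 0≤x) (0≤* (0≤* 0≤½ (0≤- C≤2)) 0≤x)) (lemma″ c C x))
            where
            lemma″ : ∀ c C x → c * C * x + ((½ - c) * C * x + ½ * (ι 2 - C) * x) ≡ x
            lemma″ = solve-∀ ℚ-ring

        proportion : ι 6 + ι 2 * j ≤ x * ε → ∣ P (suc z) k - c * C ∣ ≤ ι 33 * ε
        proportion large = recip-cancel m (begin
          Y * ∣ p - c * C ∣ ≡⟨ cong (_* ∣ p - c * C ∣) (sym (0≤p⇒∣p∣≡p (0≤ι (suc m)))) ⟩
          ∣ Y ∣ * ∣ p - c * C ∣ ≡⟨ sym (∣p*q∣≡∣p∣*∣q∣ Y (p - c * C)) ⟩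
          ∣ Y * (p - c * C) ∣ ≡⟨ cong ∣_∣ (trans (lemma Y p (c * C)) (cong₂ (λ a b → a - c * C * b) (/-ι n m) Y≡)) ⟩
          ∣ ι n - c * C * (x * x + x) ∣ ≤⟨ nullityCount-density ⟩
          ι 32 * ε * (x * x) + (ι 6 + ι 2 * j) * x ≤⟨ ≤-from ((x * ε - (ι 6 + ι 2 * j)) * x + ι 33 * ε * x) (0≤+ (0≤* (0≤- large) 0≤x) (0≤* (0≤* (0≤ι 33) 0≤ε) 0≤x)) (lemma′ x ε (ι 6 + ι 2 * j)) ⟩
          (x * x + x) * (ι 33 * ε) ≡⟨ cong (_* (ι 33 * ε)) (sym Y≡) ⟩
          Y * (ι 33 * ε) ∎)
          where
          open ≤-Reasoning
          m = ℕ.pred (period k)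
          Y = ι (suc m)
          p = P (suc z) k
          Y≡ : Y ≡ x * x + x
          Y≡ = trans (ι-+ (k ℕ.* k) k) (cong (_+ x) (ι-* k k))
          lemma : ∀ Y p a → Y * (p - a) ≡ p * Y - a * Y
          lemma = solve-∀ ℚ-ring
          lemma′ : ∀ x e J → ι 32 * e * (x * x) + J * x + ((x * e - J) * x + ι 33 * e * x) ≡ (x * x + x) * (ι 33 * e)
          lemma′ = solve-∀ ℚ-ring

  -- s is a partial sum of the series for π, and u = s⁻².
  proportion-limit : ∀ z η → 0ℚ < η → ∃₂ λ K M → ∀ k n → K ℕ.≤ suc k → M ℕ.≤ n → let s = alternatingSum term (2 ℕ.+ n) in
    ∀ u → u * (s * s) ≡ 1ℚ → 1ℚ ≤ s * s → ∣ P (suc z) (suc k) - ι 3 * u * (sq z + sq (suc z)) ∣ ≤ η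
  proportion-limit z η 0<η = K , M , λ k n K≤k M≤n u u≡ 1≤ →
    subst₂ (λ a b → ∣ a ∣ ≤ b) (lemma (P (suc z) (suc k)) c (sq z + sq (suc z)) (ι 3 * u)) (trans (lemma′ ε) 47ε≡η)
      (∣+∣≤ (proportion z k (≤-trans K-large (*-monoʳ-≤-nonNeg ε {{nonNegative (<⇒≤ 0<ε)}} (ι-mono K≤k))))
        (≤-trans (∣*∣≤ (sq z + sq (suc z)) (0≤C z) (ratio {u} {_} {ζ (suc (suc n))} u≡ 1≤
            (proj₂ (basel ε 0<ε) (suc n) (ℕₚ.≤-trans (ℕₚ.m⊔n≤o⇒m≤o M′ l M≤n) (ℕₚ.n≤1+n n)))
            (ζ-cauchy (ℕₚ.≤-trans (ℕₚ.m⊔n≤o⇒n≤o M′ l M≤n) (ℕₚ.n≤1+n n)))))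
          (*-monoʳ-≤-nonNeg (ι 7 * ε) {{nonNegative (0≤* (0≤ι 7) (<⇒≤ 0<ε))}} (C≤2 z))))
    where
    -- 33 from `proportion`, and 2 · 7 from `ratio` multiplied by `C≤2`.
    small = divide {ι 47} {η} (positive⁻¹ (ι 47)) 0<η
    ε = proj₁ small
    0<ε = proj₁ (proj₂ small)
    47ε≡η = proj₂ (proj₂ small)
    open Constant ε 0<ε
    K = proj₁ (archimedean-* (ι 6 + ι 2 * j) ε 0<ε)
    K-large = proj₂ (archimedean-* (ι 6 + ι 2 * j) ε 0<ε)
    M′ = proj₁ (basel ε 0<ε)
    M = M′ ℕ.⊔ l
    lemma : ∀ p c C v → p - c * C + C * (c - v) ≡ p - v * C
    lemma = solve-∀ ℚ-ring
    lemma′ : ∀ e → ι 33 * e + ι 2 * (ι 7 * e) ≡ ι 47 * e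
    lemma′ = solve-∀ ℚ-ring

-- Passage to the reals.

module Limit where
  open import Data.Nat.Base as ℕ using (ℕ; suc; z≤n; s≤s)
  import Data.Nat.Properties as ℕₚ
  import Data.Integer.Base as ℤ
  open import Data.Product using (_,_; proj₁; proj₂)
  open import Data.Rational
  open import Data.Rational.Properties
  open import Relation.Binary.PropositionalEquality
  open Rat
  open Proportion
  open import Defs using (P; ℝ; fromℚ; _*ᴿ_; _-ᴿ_; ∣_∣ᴿ; _<ᴿ_; π; π²≠0; _⁻¹⟨_⟩; 1/_²; _⟶_; alternatingSum; term; 0<½; ½+½)

  limit : (z : ℕ) .{{_ : ℕ.NonZero z}} →
    (λ k → fromℚ (P z k)) ⟶
    fromℚ (ℤ.+ 3 / 1) *ᴿ (π *ᴿ π) ⁻¹⟨ π²≠0 ⟩ *ᴿ fromℚ (1/ z ² + 1/ (suc z) ²)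
  limit (suc z) ε (δ , N₀ , 0<δ , δ≤ε) = K , close
    where
    -- `_<ᴿ_` asks for a uniform positive gap: one half of δ bounds the error, the other half is the
    -- gap.
    η = δ * ½
    estimate = proportion-limit z η (0<½ 0<δ)
    K = proj₁ estimate
    M = proj₁ (proj₂ estimate)
    bound = proj₂ (proj₂ estimate)
    -- The inverse of π² starts two terms late, where `π²≠0` begins to bound the square away from 0;
    -- hence the offset 2.
    s : ℕ → ℚ
    s n = alternatingSum term (2 ℕ.+ n)
    1≤∣s²∣ : ∀ n → 1ℚ ≤ ∣ s n * s n ∣
    1≤∣s²∣ n = subst (_≤ ∣ s n * s n ∣) (+-identityˡ 1ℚ) (proj₂ (proj₂ (proj₂ π²≠0)) (2 ℕ.+ n) (s≤s (s≤s z≤n)))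
    1≤s² : ∀ n → 1ℚ ≤ s n * s n
    1≤s² n = subst (1ℚ ≤_) (0≤p⇒∣p∣≡p (square (s n))) (1≤∣s²∣ n)
    s²-nonZero : ∀ n → NonZero (s n * s n)
    s²-nonZero n = ≢-nonZero λ s²≡0 → <-irrefl refl (<-≤-trans (positive⁻¹ 1ℚ) (subst (1ℚ ≤_) s²≡0 (1≤s² n)))
    L : ℝ
    L = fromℚ (ℤ.+ 3 / 1) *ᴿ (π *ᴿ π) ⁻¹⟨ π²≠0 ⟩ *ᴿ fromℚ (1/ suc z ² + 1/ (suc (suc z)) ²)
    close : ∀ k .{{_ : ℕ.NonZero k}} → K ℕ.≤ k → ∣ fromℚ (P (suc z) k) -ᴿ L ∣ᴿ <ᴿ ε
    close (suc k) K≤k = η , N₀ ℕ.⊔ M , 0<½ 0<δ , λ n ≤n → ≤-trans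
      (+-monoˡ-≤ η (bound k n K≤k (ℕₚ.m⊔n≤o⇒n≤o N₀ M ≤n) ((1/ (s n * s n)) {{s²-nonZero n}}) (*-inverseˡ (s n * s n) {{s²-nonZero n}}) (1≤s² n)))
      (≤-trans (≤-reflexive (trans (½+½ δ) (sym (+-identityˡ δ)))) (δ≤ε n (ℕₚ.m⊔n≤o⇒m≤o N₀ M ≤n)))

open import Data.Integer using (+_)
open import Data.Nat using (ℕ; suc; NonZero)
open import Data.Rational using (_+_; _/_)
open import Defs using (P; fromℚ; _*ᴿ_; π; π²≠0; _⁻¹⟨_⟩; 1/_²; _⟶_)

theorem8p2 : (z : ℕ) .{{_ : NonZero z}} →
    (λ k → fromℚ (P z k)) ⟶
    fromℚ (+ 3 / 1) *ᴿ (π *ᴿ π) ⁻¹⟨ π²≠0 ⟩ *ᴿ fromℚ (1/ z ² + 1/ (suc z) ²)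
theorem8p2 = Limit.limit
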